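{- Let $\mathcal{M}$ be a matroid on $n$ elements, and let $S_1,\dots,S_k$ be the sequence of sets peeled off (returned) by the procedure IterativePeel (defined in the context) run on $\mathcal{M}$, where all the estimates $\widehat q$ used in the run are accurate in the sense of the context. Let $\ell$ be an integer with $1\le \ell\le\log n$, let $T=\{i\in[k]: |S_i|\in[2^\ell,2^{\ell+1}-1]\}$, let $\gamma=|T|$, and let $a_1<\dots<a_\gamma$ denote the indices in $T$. Then, with absolute implied constants: 1. $\alpha(S_{a_\gamma})=\Omega(\gamma^2)$ (when $\gamma\ge1$); 2. $\gamma=O(\sqrt{2^\ell})$; 3. $k=O(n^{1/3})$.
   Context: $\log$ is base 2. $n_0\ge n$ is a parameter (the size of the original ground set), assumed sufficiently large. First circuits. For a matroid $\mathcal{N}$ on ground set $F$ that is dependent, and a permutation $\pi$ of $F$, let $t$ be the smallest index such that $\{\pi(1),\dots,\pi(t)\}$ is dependent; this set contains a unique circuit $C_\pi$ (the first circuit). For $S\subseteq F$ let $q_{\mathcal{N}}(S)=\Pr_\pi[C_\pi\subseteq S]$ for a uniformly random permutation $\pi$ of $F$, and let $\widehat q_{\mathcal{N}}(S)$ be the empirical estimate of $q_{\mathcal{N}}(S)$ obtained from $n_0^{10}$ independent random permutations (the same sample for all $S$). The estimates are accurate if $|\widehat q_{\mathcal{N}}(S)-q_{\mathcal{N}}(S)|\le 1/n_0^2$ for all $S\subseteq F$ (this has probability at least $1-2^{ -n_0}$). $\alpha$. For a dependent set $S$, $\alpha(S)$ is the smallest integer $\ell$ such that a uniformly random $\ell$-element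 subset of $S$ is independent with probability at most $1/2$. Greedily-optimal sets. For a matroid $\mathcal{N}$ on $m$ elements, a subset $S^*$ of its ground set is greedily-optimal if $$\widehat q_{\mathcal{N}}(S^*)\ge 1-2^{ -20}+\frac{\sum_{i=1}^{|S^*|}1/i}{2^{20}\log m}$$ and there is no $x\in S^*$ with $$\widehat q_{\mathcal{N}}(S^*\setminus\{x\})\ge 1-2^{ -20}+\frac{\sum_{i=1}^{|S^*|-1}1/i}{2^{20}\log m}.$$ FindGreedilyOptimal$(\mathcal{N})$ starts with $S^*$ equal to the whole ground set and, as long as some $x\in S^*$ satisfies the last displayed inequality for the current $S^*$, removes the first such $x$ from $S^*$; it returns the final $S^*$, which is greedily-optimal. IterativePeel$(\mathcal{M})$. First, small circuits are removed: fix an arbitrary linear order on the ground set and delete every element $x$ for which there is a set $S$ with $|S|\le 50$ whose smallest element is $x$, with $S\setminus\{x\}$ independent and $S$ dependent (afterwards there is no circuit of size at most $50$). Then set $k=0$ and, while the current matroid is non-empty (and contains a circuit), increase $k$ by one, let $S_k$ be the output of FindGreedilyOptimal on the current matroid, and delete $S_k$ from the current matroid; if $\alpha(S_k)\ge |S_k|/\log n$ or $|S_k|>n/2$ (with $n$ the number of elements of the input matroid), stop and return $S_1,\dots,S_{k-1}$. If the loop ends, return $S_1,\dots,S_k$. In the theorem, $k$ denotes the number of returned sets. -}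

module Defs where

open import Level using (0ℓ)
open import Data.Fin using (Fin)
import Data.Fin as Fin
import Data.Fin.Properties as Fin
open import Data.Fin.Subset using (Subset; _∈_; _∉_; _⊆_; _⊂_; _∪_; _─_; _-_; ⊥; ⁅_⁆; ⋃; ∣_∣; inside; outside)
open import Data.Fin.Subset.Properties using (_∈?_; _⊆?_; _⊂?_; anySubset?; ⊥⊆; x∈p∪q⁻; x∈⁅y⁆⇒x≡y)
open import Data.Integer using (ℤ; +_; -[1+_])
import Data.Integer as ℤ
open import Data.List using (List; []; _∷_; _++_; map; concatMap; filter; length; take; allFin; lookup)
open import Data.List.Membership.Propositional using () renaming (_∈_ to _∈ₗ_)
open import Data.Nat using (ℕ; zero; suc; _*_; _∸_; _^_; _≤_; _<_; _≤?_; _≟_; NonZero)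
open import Data.Nat.Properties using (anyUpTo?; allUpTo?; m^n≢0)
open import Data.Product using (Σ-syntax; ∃-syntax; _×_; _,_; proj₁; proj₂)
open import Data.Rational.Unnormalised using (ℚᵘ; 0ℚᵘ; 1ℚᵘ; ½; _/_; ↥_; ↧_)
import Data.Rational.Unnormalised as ℚ
import Data.Rational.Unnormalised.Properties as ℚ
open import Data.Sum using (_⊎_; inj₁; inj₂)
open import Data.Unit using (⊤)
open import Data.Vec using (Vec; toList)
import Data.Vec as Vec
open import Function using (_∘_)
open import Relation.Binary using (Rel; IsStrictTotalOrder)
open import Relation.Binary.PropositionalEquality using (_≡_; subst; sym)
open import Relation.Nullary using (¬_; yes; no; does)
open import Relation.Nullary.Decidable using (_×-dec_; _→-dec_; ¬?; map′; decidable-stable)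
open import Relation.Unary using (Pred; Decidable)

private
  variable
    N : ℕ

------------------------------------------------------------------------
-- Real quantities

-- a ≤ b ·log₂ m is the inequality a ≤ b · log₂ m between reals, for
-- rational a, b and m ≥ 1.  Writing a = p/r and b = s/t with r, t > 0 it
-- says p·t ≤ s·r·log₂ m, i.e. 2^(p·t) ≤ m^(s·r); powers with a negative
-- exponent are moved to the other side.

posPart negPart : ℤ → ℕ
posPart (+ n)    = n
posPart -[1+ n ] = 0
negPart (+ n)    = 0
negPart -[1+ n ] = suc n

infix 4 _≤_·log₂_
_≤_·log₂_ : ℚᵘ → ℚᵘ → ℕ → Set
a ≤ b ·log₂ m =
  2 ^ posPart u * m ^ negPart v ≤ m ^ posPart v * 2 ^ negPart u
  where
  u v : ℤ
  u = (↥ a) ℤ.* (↧ b)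
  v = (↥ b) ℤ.* (↧ a)

fromℕ : ℕ → ℚᵘ
fromℕ n = + n / 1

harmonic : ℕ → ℚᵘ
harmonic zero    = 0ℚᵘ
harmonic (suc s) = harmonic s ℚ.+ + 1 / suc s

-- The probability of P under the uniform distribution on the positions of
-- a list (0 by convention for the empty list, which does not arise below).
proportion : {A : Set} {P : Pred A 0ℓ} → Decidable P → List A → ℚᵘ
proportion P? []         = 0ℚᵘ
proportion P? (x ∷ xs) = + length (filter P? (x ∷ xs)) / suc (length xs)

-- The least j ≤ b satisfying P, or b if there is none.
least : {P : Pred ℕ 0ℓ} → Decidable P → ℕ → ℕ
least P? zero = 0
least P? (suc b) with P? 0
... | yes _ = 0
... | no  _ = suc (least (P? ∘ suc) b)

------------------------------------------------------------------------
-- Finite enumerations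

elements : Subset N → List (Fin N)
elements S = filter (_∈? S) (allFin _)

fromList : List (Fin N) → Subset N
fromList xs = ⋃ (map ⁅_⁆ xs)

comprehension : {P : Pred (Fin N) 0ℓ} → Decidable P → Subset N
comprehension P? = Vec.tabulate (λ x → does (P? x))

allSubsets : ∀ N → List (Subset N)
allSubsets zero    = Vec.[] ∷ []
allSubsets (suc N) = map (inside Vec.∷_) (allSubsets N) ++ map (outside Vec.∷_) (allSubsets N)

subsetsOfSize : ℕ → Subset N → List (Subset N)
subsetsOfSize l S = filter (λ X → (X ⊆? S) ×-dec (∣ X ∣ ≟ l)) (allSubsets _)

insertions : {A : Set} → A → List A → List (List A)
insertions x []       = (x ∷ []) ∷ []
insertions x (y ∷ ys) = (x ∷ y ∷ ys) ∷ map (y ∷_) (insertions x ys)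

permutations : {A : Set} → List A → List (List A)
permutations []       = [] ∷ []
permutations (x ∷ xs) = concatMap (insertions x) (permutations xs)

------------------------------------------------------------------------
-- Matroids

-- The ground set E is an arbitrary subset of Fin N, so that deletion does
-- not change the type of the elements.
-- Independence is required to be decidable, as it is classically for any
-- finite matroid.
record Matroid (N : ℕ) : Set₁ where
  field
    E        : Subset N
    Indep    : Pred (Subset N) 0ℓ
    Indep?   : Decidable Indep
    indep⊆E  : ∀ {I} → Indep I → I ⊆ E
    indep-⊥  : Indep ⊥
    indep-⊆  : ∀ {I J} → I ⊆ J → Indep J → Indep I
    exchange : ∀ {I J} → Indep I → Indep J → ∣ I ∣ < ∣ J ∣ →
               ∃[ x ] x ∈ J × x ∉ I × Indep (I ∪ ⁅ x ⁆)

  Dependent : Pred (Subset N) 0ℓ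
  Dependent S = S ⊆ E × ¬ Indep S

  Dependent? : Decidable Dependent
  Dependent? S = (S ⊆? E) ×-dec ¬? (Indep? S)

  Circuit : Pred (Subset N) 0ℓ
  Circuit C = Dependent C × (∀ D → D ⊂ C → Indep D)

  Circuit? : Decidable Circuit
  Circuit? C = Dependent? C ×-dec
    map′ (λ h D D⊂C → decidable-stable (Indep? D) (λ ¬i → h (D , D⊂C , ¬i)))
         (λ h (D , D⊂C , ¬i) → ¬i (h D D⊂C))
         (¬? (anySubset? (λ D → (D ⊂? C) ×-dec ¬? (Indep? D))))

  HasCircuit : Set
  HasCircuit = ∃[ C ] Circuit C

open Matroid

infixl 5 _∖_
_∖_ : Matroid N → Subset N → Matroid N
M ∖ D = record
  { E        = E M ─ D
  ; Indep    = λ I → Indep M I × I ⊆ E M ─ D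
  ; Indep?   = λ I → Indep? M I ×-dec (I ⊆? (E M ─ D))
  ; indep⊆E  = proj₂
  ; indep-⊥  = indep-⊥ M , λ x∈ → ⊥⊆ x∈
  ; indep-⊆  = λ I⊆J (i , J⊆) → indep-⊆ M I⊆J i , λ x∈ → J⊆ (I⊆J x∈)
  ; exchange = λ (i , I⊆) (j , J⊆) I<J → ext I⊆ J⊆ (exchange M i j I<J)
  }
  where
  ext : ∀ {I J} → I ⊆ E M ─ D → J ⊆ E M ─ D →
        ∃[ x ] x ∈ J × x ∉ I × Indep M (I ∪ ⁅ x ⁆) →
        ∃[ x ] x ∈ J × x ∉ I × (Indep M (I ∪ ⁅ x ⁆) × I ∪ ⁅ x ⁆ ⊆ E M ─ D)
  ext {I} I⊆ J⊆ (x , x∈J , x∉I , ind) = x , x∈J , x∉I , ind , incl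
    where
    incl : I ∪ ⁅ x ⁆ ⊆ E M ─ D
    incl y∈ with x∈p∪q⁻ I ⁅ x ⁆ y∈
    ... | inj₁ y∈I = I⊆ y∈I
    ... | inj₂ y∈x = subst (_∈ E M ─ D) (sym (x∈⁅y⁆⇒x≡y x y∈x)) (J⊆ x∈J)

-- For dependent S the search succeeds, at the latest at l = ∣ S ∣.  The
-- value is the same in every deletion of M whose ground set contains S.
α : Matroid N → Subset N → ℕ
α M S = least (λ l → proportion (Indep? M) (subsetsOfSize l S) ℚ.≤? ½) ∣ S ∣

------------------------------------------------------------------------
-- First circuits and their empirical frequencies

IsFirstCircuit : Matroid N → List (Fin N) → Pred (Subset N) 0ℓ
IsFirstCircuit M π C = ∃[ t ]
  t < suc (length π) ×
  (Dependent M (fromList (take t π)) ×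
   (∀ {s} → s < t → ¬ Dependent M (fromList (take s π))) ×
   Circuit M C × C ⊆ fromList (take t π))

-- C_π ⊆ S, where C_π is the first circuit of π.
FirstCircuitIn : Matroid N → Subset N → Pred (List (Fin N)) 0ℓ
FirstCircuitIn M S π = ∃[ C ] IsFirstCircuit M π C × C ⊆ S

FirstCircuitIn? : (M : Matroid N) (S : Subset N) → Decidable (FirstCircuitIn M S)
FirstCircuitIn? M S π = anySubset? λ C →
  anyUpTo? (λ t → Dependent? M (fromList (take t π)) ×-dec
                  allUpTo? (λ s → ¬? (Dependent? M (fromList (take s π)))) t ×-dec
                  Circuit? M C ×-dec (C ⊆? fromList (take t π)))
           (suc (length π))
  ×-dec (C ⊆? S)

Permutation : Matroid N → Set
Permutation M = Σ[ π ∈ List (Fin _) ] π ∈ₗ permutations (elements (E M))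

-- A possible outcome of drawing s permutations of the ground set.
Sample : ℕ → Matroid N → Set
Sample s M = Vec (Permutation M) s

q : Matroid N → Subset N → ℚᵘ
q M S = proportion (FirstCircuitIn? M S) (permutations (elements (E M)))

q̂ : ∀ {s} (M : Matroid N) → Sample s M → Subset N → ℚᵘ
q̂ M ω S = proportion (λ p → FirstCircuitIn? M S (proj₁ p)) (toList ω)

Accurate : ∀ n₀ .{{_ : NonZero n₀}} (M : Matroid N) → Sample (n₀ ^ 10) M → Set
Accurate n₀ M ω = ∀ S → S ⊆ E M →
  ℚ.∣ q̂ M ω S ℚ.- q M S ∣ ℚ.≤ (+ 1 / (n₀ ^ 2)) {{m^n≢0 n₀ 2}}

------------------------------------------------------------------------
-- FindGreedilyOptimal

-- p ≥ 1 - 2⁻²⁰ + (Σ_{i=1}^{s} 1/i) / (2²⁰ · log₂ m), with the positive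
-- denominator 2²⁰ · log₂ m cleared.
AboveThreshold : (m s : ℕ) → ℚᵘ → Set
AboveThreshold m s p =
  harmonic s ≤ (fromℕ (2 ^ 20) ℚ.* (p ℚ.- (1ℚᵘ ℚ.- (+ 1 / (2 ^ 20)) {{m^n≢0 2 20}}))) ·log₂ m

-- ≺ is the linear order on the elements that both "first" (in
-- FindGreedilyOptimal) and "smallest" (in the removal of small circuits)
-- refer to.
module _ (_≺_ : Rel (Fin N) 0ℓ) where

  IsSmallest : Pred (Fin N) 0ℓ → Fin N → Set
  IsSmallest P x = P x × (∀ y → P y → ¬ y ≡ x → x ≺ y)

  -- GreedyFrom P S S* : the loop that starts at S and, while some element
  -- x satisfies P S x for the current set S, removes the first such x,
  -- returns S*.
  data GreedyFrom (P : Subset N → Pred (Fin N) 0ℓ) (S : Subset N) : Subset N → Set where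
    stop   : (∀ x → ¬ P S x) → GreedyFrom P S S
    remove : ∀ {x S*} → IsSmallest (P S) x →
             GreedyFrom P (S - x) S* → GreedyFrom P S S*

  Removable : ∀ {s} (M : Matroid N) → Sample s M → Subset N → Pred (Fin N) 0ℓ
  Removable M ω S x = x ∈ S × AboveThreshold ∣ E M ∣ (∣ S ∣ ∸ 1) (q̂ M ω (S - x))

  FindGreedilyOptimal : ∀ {s} (M : Matroid N) → Sample s M → Subset N → Set
  FindGreedilyOptimal M ω = GreedyFrom (Removable M ω) (E M)

------------------------------------------------------------------------
-- IterativePeel

  module _ (sto : IsStrictTotalOrder _≡_ _≺_) where
    open IsStrictTotalOrder sto using (_<?_)

    StartsSmallDependent : Matroid N → Pred (Fin N) 0ℓ
    StartsSmallDependent M x = ∃[ S ]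
      ∣ S ∣ ≤ 50 × IsSmallest (_∈ S) x × Indep M (S - x) × Dependent M S

    StartsSmallDependent? : (M : Matroid N) → Decidable (StartsSmallDependent M)
    StartsSmallDependent? M x = anySubset? λ S →
      (∣ S ∣ ≤? 50) ×-dec
      ((x ∈? S) ×-dec
        Fin.all? (λ y → (y ∈? S) →-dec (¬? (y Fin.≟ x) →-dec (x <? y)))) ×-dec
      Indep? M (S - x) ×-dec Dependent? M S

    removeSmallCircuits : Matroid N → Matroid N
    removeSmallCircuits M = M ∖ comprehension (StartsSmallDependent? M)

  module _ (n₀ n : ℕ) where

    -- α(S) ≥ |S| / log₂ n  or  |S| > n/2
    StopAt : Matroid N → Subset N → Set
    StopAt M S = (fromℕ ∣ S ∣ ≤ fromℕ (α M S) ·log₂ n) ⊎ (n < 2 * ∣ S ∣)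

    -- PeelFrom M Ss : the runs of the main loop with current matroid M that
    -- return the list Ss, each carrying the samples drawn in it.
    data PeelFrom (M : Matroid N) : List (Subset N) → Set where
      finish : ¬ HasCircuit M → PeelFrom M []
      halt   : ∀ {S} → HasCircuit M → (ω : Sample (n₀ ^ 10) M) →
               FindGreedilyOptimal M ω S → StopAt M S → PeelFrom M []
      peel   : ∀ {S Ss} → HasCircuit M → (ω : Sample (n₀ ^ 10) M) →
               FindGreedilyOptimal M ω S → ¬ StopAt M S →
               PeelFrom (M ∖ S) Ss → PeelFrom M (S ∷ Ss)

    AllAccurate : .{{_ : NonZero n₀}} → ∀ {M Ss} → PeelFrom M Ss → Set
    AllAccurate         (finish _)       = ⊤
    AllAccurate {M = M} (halt _ ω _ _)   = Accurate n₀ M ω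
    AllAccurate {M = M} (peel _ ω _ _ r) = Accurate n₀ M ω × AllAccurate r

IterativePeel : (_≺_ : Rel (Fin N) 0ℓ) → IsStrictTotalOrder _≡_ _≺_ →
                ℕ → Matroid N → List (Subset N) → Set
IterativePeel _≺_ sto n₀ M = PeelFrom _≺_ n₀ ∣ E M ∣ (removeSmallCircuits _≺_ sto M)

EstimatesAccurate : ∀ {_≺_ : Rel (Fin N) 0ℓ} {sto : IsStrictTotalOrder _≡_ _≺_}
                    {n₀} .{{_ : NonZero n₀}} {M : Matroid N} {Ss} →
                    IterativePeel _≺_ sto n₀ M Ss → Set
EstimatesAccurate {_≺_ = _≺_} {n₀ = n₀} {M = M} r = AllAccurate _≺_ n₀ ∣ E M ∣ r

------------------------------------------------------------------------
-- The indices of the peeled sets of size about 2^ℓ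

sizeClass : (Ss : List (Subset N)) → ℕ → Subset (length Ss)
sizeClass Ss ℓ = comprehension λ i →
  (2 ^ ℓ ≤? ∣ lookup Ss i ∣) ×-dec (∣ lookup Ss i ∣ ≤? 2 ^ (suc ℓ) ∸ 1)

IsLast : ∀ {k} → Subset k → Fin k → Set
IsLast T i = i ∈ T × (∀ j → j ∈ T → j Fin.≤ i)

module Submission where

-- Let A be peeled before B, with sizes in the same class, and write a = α(A),
-- b = α(B).  In a random order of the current ground set look at the first
-- a + b − 1 elements of A ∪ B.  If fewer than a of them lie in A, then, since
-- the split is otherwise uniform, with probability at least 1/4 those in A are
-- independent while those in B are dependent, and then the first circuit is
-- not inside A.  Hence the hypergeometric lower tail P[fewer than a in A] is at
-- most a small constant, whereas if b/|B| were not larger than a/|A| by order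
-- √a/|A|, anticoncentration would bound it below by a larger constant.  So
-- along a size class the rates α/|S| satisfy r′ ≥ r + c √(r/2^ℓ), which makes
-- 2^ℓ r grow quadratically.  The bounds γ² = O(2^ℓ) for small sets and
-- disjointness for large ones meet at size n^(2/3), which gives k = O(n^(1/3)).

open import Defs
open import Level using (0ℓ)
open import Data.Bool using (true; false; if_then_else_)
open import Data.Bool.Properties using (∧-zeroʳ)
import Data.Empty as Empty
open import Data.Fin using (Fin; zero; suc)
open import Data.Fin.Subset using (Subset; _∈_; _∉_; _⊆_; _∪_; _─_; ⊥; ⁅_⁆; ∣_∣; inside; outside)
open import Data.Fin.Subset.Properties using (_∈?_; _⊆?_; ⊆-antisym; p⊆q⇒∣p∣≤∣q∣; x∈p∪q⁻; x∈p∪q⁺; x∈⁅x⁆; x∈⁅y⁆⇒x≡y; ∉⊥; ∪-identityˡ; p─q⊆p; ∣p─q∣≤∣p∣; Empty-unique; ∣⊥∣≡0)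
open import Data.Integer using (-[1+_])
import Data.Integer as ℤ
import Data.Integer.Properties as ℤ
open import Data.List using (List; []; _∷_; _++_; map; concatMap; length; lookup; take; filter; allFin)
open import Data.List.Membership.Propositional using () renaming (_∈_ to _∈ₗ_)
open import Data.List.Membership.Propositional.Properties using (∈-filter⁺; ∈-filter⁻; ∈-allFin; ∈-++⁺ˡ)
open import Data.List.Properties using (filter-all; filter-none; filter-++; filter-accept; filter-reject; map-++; map-∘; map-tabulate; length-++; length-map; ++-identityʳ)
import Data.List.Relation.Binary.Permutation.Propositional as Perm
open Perm using (_↭_; ↭-sym; ↭-trans; ↭-reflexive)
open import Data.List.Relation.Binary.Permutation.Propositional.Properties using (↭-length; All-resp-↭; ∈-resp-↭; filter-↭; shift; ++-comm)
open import Data.List.Relation.Unary.All using (All; []; _∷_)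
import Data.List.Relation.Unary.All as All
open import Data.List.Relation.Unary.All.Properties using (all-filter)
open import Data.List.Relation.Unary.AllPairs using (AllPairs; []; _∷_)
open import Data.List.Relation.Unary.Any using (here; there)
open import Data.Nat
open import Data.Nat.Combinatorics using (_C_; nCk+nC[k+1]≡[n+1]C[k+1]; nC1≡n; k>n⇒nCk≡0)
open import Data.Nat.ListAction using (sum)
open import Data.Nat.ListAction.Properties using (sum-++)
open import Data.Nat.Properties
open import Data.Nat.Tactic.RingSolver using (solve-∀)
open import Data.Product using (_×_; _,_; proj₁; proj₂; ∃-syntax)
open import Data.Rational.Unnormalised using (ℚᵘ; mkℚᵘ; 1ℚᵘ; ½)
import Data.Rational.Unnormalised as ℚ
import Data.Rational.Unnormalised.Properties as ℚ
import Data.Rational.Unnormalised.Solver as ℚ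
open import Data.Sign using (Sign)
open import Data.Sum using (_⊎_; inj₁; inj₂; [_,_]′)
open import Data.Unit using (tt)
open import Data.Vec using ([]; _∷_; here; there)
open import Data.Vec.Properties using (lookup∘tabulate; []=⇒lookup)
open import Function using (flip; _∘_; case_of_)
open import Relation.Binary using (Rel; IsStrictTotalOrder)
open import Relation.Binary.PropositionalEquality
open import Relation.Nullary
open import Relation.Nullary.Decidable using (_×-dec_; _⊎-dec_; toWitness)
open import Relation.Unary using (Pred; Decidable)
open Matroid

-- With `a + b - 1` draws, fewer than `a` in A forces at least `b` in B; this is where both
-- definitions of α apply. (In the code α(A) and α(B) are `suc a` and `suc b`.) Probabilities are
-- counts of orderings or of subsets, with denominators cleared. The anticoncentration compares all
-- hypergeometric weights with the single weight at the cut. The parameter `v` is of order √α(A):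
-- within `v` steps of the cut the ratio of neighbouring weights exceeds 1 by at most 1/(2v), so the
-- weights change by a factor of at most 2 in the relevant direction; past `2v` steps a telescoping
-- identity bounds the whole tail. The ratio estimate needs `40 v² ≤ α(A)`, which fails for small
-- α(A) even at `v = 1`; there a cruder factor 4 for one step is enough. Both estimates require that
-- about half of each set at most is drawn, that is `2 α ≤ |S|`, which is what the stopping rule
-- leaves behind for every returned set. Rates are compared rather than values of α because sizes
-- within a class differ by a factor of up to 2.

private
  variable
    N : ℕ

-- Linear arithmetic by certificate: `l ≤ r` is a combination of the hypotheses, `s` is the slack,
-- and the equation is left to the ring solver.
≤-certificate : ∀ {x y l r} → l ≤ r → ∀ s → x + r + s ≡ y + l → x ≤ y
≤-certificate {x} {y} {l} {r} l≤r s eq = +-cancelʳ-≤ r x y (begin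
  x + r      ≤⟨ m≤m+n (x + r) s ⟩
  x + r + s  ≡⟨ eq ⟩
  y + l      ≤⟨ +-monoʳ-≤ y l≤r ⟩
  y + r      ∎)
  where open ≤-Reasoning

-- Binomial coefficients and sums along antidiagonals.

C-absorb : ∀ n k → suc k * (n C suc k) + k * (n C k) ≡ n * (n C k)
C-absorb zero    zero    = refl
C-absorb zero    (suc k) rewrite k>n⇒nCk≡0 {0} {suc (suc k)} (s≤s z≤n) | k>n⇒nCk≡0 {0} {suc k} (s≤s z≤n) | *-zeroʳ k = refl
C-absorb (suc n) zero    = trans (+-identityʳ _) (trans (*-identityˡ _) (trans (nC1≡n (suc n)) (sym (*-identityʳ (suc n)))))
C-absorb (suc n) (suc k) = begin
  suc (suc k) * (suc n C suc (suc k)) + suc k * (suc n C suc k)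
    ≡⟨ cong₂ (λ x y → suc (suc k) * x + suc k * y)
         (nCk+nC[k+1]≡[n+1]C[k+1] n (suc k)) (nCk+nC[k+1]≡[n+1]C[k+1] n k) ⟨
  suc (suc k) * (y + z) + suc k * (x + y)
    ≡⟨ regroup k x y z ⟩
  (suc (suc k) * z + suc k * y) + (suc k * y + k * x) + (x + y)
    ≡⟨ cong₂ (λ u w → u + w + (x + y)) (C-absorb n (suc k)) (C-absorb n k) ⟩
  n * y + n * x + (x + y)
    ≡⟨ collect n x y ⟩
  suc n * (x + y)
    ≡⟨ cong (suc n *_) (nCk+nC[k+1]≡[n+1]C[k+1] n k) ⟩
  suc n * (suc n C suc k) ∎
  where
  open ≡-Reasoning
  x y z : ℕ
  x = n C k
  y = n C suc k
  z = n C suc (suc k)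
  regroup : ∀ k x y z → suc (suc k) * (y + z) + suc k * (x + y)
            ≡ (suc (suc k) * z + suc k * y) + (suc k * y + k * x) + (x + y)
  regroup = solve-∀
  collect : ∀ n x y → n * y + n * x + (x + y) ≡ suc n * (x + y)
  collect = solve-∀

-- Writing the upper index as `k + d` keeps the ratio of neighbouring binomial coefficients free of
-- truncated subtraction.
C-step : ∀ k d → suc k * ((k + d) C suc k) ≡ d * ((k + d) C k)
C-step k d = +-cancelʳ-≡ (k * ((k + d) C k)) _ _
  (trans (C-absorb (k + d) k)
    (trans (*-distribʳ-+ ((k + d) C k) k d) (+-comm (k * ((k + d) C k)) _)))

C-positive : ∀ {n k} → k ≤ n → 0 < n C k
C-positive {n}     {zero}  _         = s≤s z≤n
C-positive {suc n} {suc k} (s≤s k≤n) =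
  subst (0 <_) (nCk+nC[k+1]≡[n+1]C[k+1] n k) (≤-trans (C-positive k≤n) (m≤m+n _ _))

-- Started at `a = 0`, the index pairs are the possible splits of a fixed number of draws between
-- two sets.
antidiagonal : (ℕ → ℕ → ℕ) → ℕ → ℕ → ℕ
antidiagonal h a zero    = h a zero
antidiagonal h a (suc b) = h a (suc b) + antidiagonal h (suc a) b

-- The cut lies between first index at most `a` and first index above `a`. The lower part is read
-- backwards, with `h` flipped, so that both parts start next to the cut.
antidiagonal-split : ∀ h a b → antidiagonal h 0 (a + suc b) ≡
                     antidiagonal h (suc a) b + antidiagonal (flip h) (suc b) a
antidiagonal-split h zero    b = +-comm (h 0 (suc b)) _
antidiagonal-split h (suc a) b = begin
  antidiagonal h 0 (suc a + suc b)
    ≡⟨ cong (antidiagonal h 0) (+-suc a (suc b)) ⟨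
  antidiagonal h 0 (a + suc (suc b))
    ≡⟨ antidiagonal-split h a (suc b) ⟩
  (h (suc a) (suc b) + antidiagonal h (suc (suc a)) b) + antidiagonal (flip h) (suc (suc b)) a
    ≡⟨ cong (_+ antidiagonal (flip h) (suc (suc b)) a) (+-comm (h (suc a) (suc b)) _) ⟩
  (antidiagonal h (suc (suc a)) b + h (suc a) (suc b)) + antidiagonal (flip h) (suc (suc b)) a
    ≡⟨ +-assoc (antidiagonal h (suc (suc a)) b) _ _ ⟩
  antidiagonal h (suc (suc a)) b + antidiagonal (flip h) (suc b) (suc a) ∎
  where open ≡-Reasoning

antidiagonal-upper : ∀ h x y n a b →
  (∀ i j → i + j ≡ b → i < n → h (a + i) j ≤ x) →
  (∀ j → n + j ≡ b → antidiagonal h (a + n) j ≤ y) →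
  antidiagonal h a b ≤ n * x + y
antidiagonal-upper h x y zero a b small rest =
  subst (λ k → antidiagonal h k b ≤ y) (+-identityʳ a) (rest b refl)
antidiagonal-upper h x y (suc n) a zero small rest = begin
  h a 0            ≡⟨ cong (λ k → h k 0) (+-identityʳ a) ⟨
  h (a + 0) 0      ≤⟨ small 0 0 refl (s≤s z≤n) ⟩
  x                ≤⟨ m≤m+n x (n * x + y) ⟩
  x + (n * x + y)  ≡⟨ +-assoc x (n * x) y ⟨
  suc n * x + y    ∎
  where open ≤-Reasoning
antidiagonal-upper h x y (suc n) a (suc b) small rest = begin
  h a (suc b) + antidiagonal h (suc a) b
    ≤⟨ +-mono-≤
         (subst (λ k → h k (suc b) ≤ x) (+-identityʳ a) (small 0 (suc b) refl (s≤s z≤n)))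
         (antidiagonal-upper h x y n (suc a) b
           (λ i j eq i<n → subst (λ k → h k j ≤ x) (+-suc a i) (small (suc i) j (cong suc eq) (s≤s i<n)))
           (λ j eq → subst (λ k → antidiagonal h k j ≤ y) (+-suc a n) (rest j (cong suc eq)))) ⟩
  x + (n * x + y)  ≡⟨ +-assoc x (n * x) y ⟨
  suc n * x + y    ∎
  where open ≤-Reasoning

antidiagonal-lower : ∀ h x n a b → n ≤ suc b →
  (∀ i j → i + j ≡ b → i < n → x ≤ 2 * h (a + i) j) →
  n * x ≤ 2 * antidiagonal h a b
antidiagonal-lower h x zero    a b       n≤b large = z≤n
antidiagonal-lower h x (suc zero) a zero n≤b large = begin
  x + 0            ≡⟨ +-identityʳ x ⟩
  x                ≤⟨ large 0 0 refl (s≤s z≤n) ⟩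
  2 * h (a + 0) 0  ≡⟨ cong (λ k → 2 * h k 0) (+-identityʳ a) ⟩
  2 * h a 0        ∎
  where open ≤-Reasoning
antidiagonal-lower h x (suc (suc n)) a zero (s≤s ()) large
antidiagonal-lower h x (suc n) a (suc b) (s≤s n≤b) large = begin
  x + n * x
    ≤⟨ +-mono-≤
         (subst (λ k → x ≤ 2 * h k (suc b)) (+-identityʳ a) (large 0 (suc b) refl (s≤s z≤n)))
         (antidiagonal-lower h x n (suc a) b n≤b
           (λ i j eq i<n → subst (λ k → x ≤ 2 * h k j) (+-suc a i) (large (suc i) j (cong suc eq) (s≤s i<n)))) ⟩
  2 * h a (suc b) + 2 * antidiagonal h (suc a) b
    ≡⟨ *-distribˡ-+ 2 (h a (suc b)) _ ⟨
  2 * antidiagonal h a (suc b) ∎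
  where open ≤-Reasoning

antidiagonal-cong : ∀ {h h′} a b → (∀ i j → h (a + i) j ≡ h′ (a + i) j) → antidiagonal h a b ≡ antidiagonal h′ a b
antidiagonal-cong {h} {h′} a zero eq = subst (λ k → h k 0 ≡ h′ k 0) (+-identityʳ a) (eq 0 0)
antidiagonal-cong {h} {h′} a (suc b) eq = cong₂ _+_ (subst (λ k → h k (suc b) ≡ h′ k (suc b)) (+-identityʳ a) (eq 0 (suc b)))
  (antidiagonal-cong (suc a) b (λ i j → subst (λ k → h k j ≡ h′ k j) (+-suc a i) (eq (suc i) j)))

antidiagonal-+ : ∀ h h′ a b → antidiagonal (λ x y → h x y + h′ x y) a b ≡ antidiagonal h a b + antidiagonal h′ a b
antidiagonal-+ h h′ a zero = refl
antidiagonal-+ h h′ a (suc b) rewrite antidiagonal-+ h h′ (suc a) b = eq (h a (suc b)) (h′ a (suc b)) _ _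
  where
  eq : ∀ a b c d → a + b + (c + d) ≡ a + c + (b + d)
  eq = solve-∀

antidiagonal-shift : ∀ h a b → antidiagonal h (suc a) b ≡ antidiagonal (h ∘ suc) a b
antidiagonal-shift h a zero    = refl
antidiagonal-shift h a (suc b) = cong (h (suc a) (suc b) +_) (antidiagonal-shift h (suc a) b)

antidiagonal-0 : ∀ {h} a b → (∀ i j → h (a + i) j ≡ 0) → antidiagonal h a b ≡ 0
antidiagonal-0 {h} a zero    eq = subst (λ k → h k 0 ≡ 0) (+-identityʳ a) (eq 0 0)
antidiagonal-0 {h} a (suc b) eq = cong₂ _+_ (subst (λ k → h k (suc b) ≡ 0) (+-identityʳ a) (eq 0 (suc b)))
  (antidiagonal-0 (suc a) b (λ i j → subst (λ k → h k j ≡ 0) (+-suc a i) (eq (suc i) j)))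

antidiagonal-scale : ∀ {h h′} k a b → (∀ i j → i + j ≡ b → h (a + i) j ≤ k * h′ (a + i) j) →
                     antidiagonal h a b ≤ k * antidiagonal h′ a b
antidiagonal-scale {h} {h′} k a zero le = subst (λ x → h x 0 ≤ k * h′ x 0) (+-identityʳ a) (le 0 0 refl)
antidiagonal-scale {h} {h′} k a (suc b) le = subst (antidiagonal h a (suc b) ≤_) (sym (*-distribˡ-+ k (h′ a (suc b)) _))
  (+-mono-≤ (subst (λ x → h x (suc b) ≤ k * h′ x (suc b)) (+-identityʳ a) (le 0 (suc b) refl))
    (antidiagonal-scale k (suc a) b (λ i j eq → subst (λ x → h x j ≤ k * h′ x j) (+-suc a i) (le (suc i) j (cong suc eq)))))

-- One step of Bernoulli's inequality `(1 - 1/(K + 1))^j ≥ 1 - j/(K + 1)` with `r = K + 1 - j` and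
-- denominators cleared: `r (K + 1) ≤ K (r + 1)` because `r ≤ K`.
bernoulli-step : ∀ r K x z → r ≤ K → K * suc r * x ≤ suc K * (suc K * z) → r * x ≤ suc K * z
bernoulli-step r K x z r≤K h = *-cancelˡ-≤ (suc K) (begin
  suc K * (r * x)        ≡⟨ expand K r x ⟩
  (K * r + r) * x        ≤⟨ *-monoˡ-≤ x (+-monoʳ-≤ (K * r) r≤K) ⟩
  (K * r + K) * x        ≡⟨ collect K r x ⟩
  K * suc r * x          ≤⟨ h ⟩
  suc K * (suc K * z)    ∎)
  where
  open ≤-Reasoning
  expand : ∀ K r x → suc K * (r * x) ≡ (K * r + r) * x
  expand = solve-∀
  collect : ∀ K r x → (K * r + K) * x ≡ K * suc r * x
  collect = solve-∀

-- For `K = 2v` and at most `v` steps, Bernoulli's bound `r / (K + 1)` is still above one half.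
bernoulli-end : ∀ v r x z → suc v ≤ r → r * x ≤ suc (2 * v) * z → x ≤ 2 * z
bernoulli-end v r x z v<r h = *-cancelˡ-≤ (suc v) (begin
  suc v * x          ≤⟨ *-monoˡ-≤ x v<r ⟩
  r * x              ≤⟨ h ⟩
  suc (2 * v) * z    ≤⟨ *-monoˡ-≤ z (n≤1+n (suc (2 * v))) ⟩
  suc (suc (2 * v)) * z  ≡⟨ regroup v z ⟩
  suc v * (2 * z)    ∎)
  where
  open ≤-Reasoning
  regroup : ∀ v z → suc (suc (2 * v)) * z ≡ suc v * (2 * z)
  regroup = solve-∀

-- Hypergeometric weights: neighbouring ratios and tails.

hyper : ℕ → ℕ → ℕ → ℕ → ℕ
hyper p₁ p₂ a b = (p₁ C a) * (p₂ C b)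

-- The ratio of neighbouring weights, cross-multiplied; `d` and `c` stand for `p₁ - a` and `p₂ - b`.
hyper-step : ∀ a b c d →
  suc a * c * hyper (a + d) (b + c) (suc a) b ≡ d * suc b * hyper (a + d) (b + c) a (suc b)
hyper-step a b c d = begin
  suc a * c * (f' * g)      ≡⟨ left a c f' g ⟩
  (suc a * f') * (c * g)    ≡⟨ cong₂ _*_ (C-step a d) (sym (C-step b c)) ⟩
  (d * f) * (suc b * g')    ≡⟨ right b d f g' ⟩
  d * suc b * (f * g')      ∎
  where
  open ≡-Reasoning
  f f' g g' : ℕ
  f = (a + d) C a
  f' = (a + d) C suc a
  g = (b + c) C b
  g' = (b + c) C suc b
  left : ∀ a c f g → suc a * c * (f * g) ≡ (suc a * f) * (c * g)
  left = solve-∀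
  right : ∀ b d f g → (d * f) * (suc b * g) ≡ d * suc b * (f * g)
  right = solve-∀

hyper-ratio : ∀ a b c d x y → 0 < c → x * (d * suc b) ≤ y * (suc a * c) →
  x * hyper (a + d) (b + c) (suc a) b ≤ y * hyper (a + d) (b + c) a (suc b)
hyper-ratio a b (suc c) d x y 0<c h = *-cancelˡ-≤ (suc a * suc c) (begin
  suc a * suc c * (x * u)   ≡⟨ permuteˡ (suc a * suc c) x u ⟩
  x * (suc a * suc c * u)   ≡⟨ cong (x *_) (hyper-step a b (suc c) d) ⟩
  x * (d * suc b * w)       ≡⟨ *-assoc x (d * suc b) w ⟨
  x * (d * suc b) * w       ≤⟨ *-monoˡ-≤ w h ⟩
  y * (suc a * suc c) * w   ≡⟨ permuteʳ y (suc a * suc c) w ⟩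
  suc a * suc c * (y * w)   ∎)
  where
  open ≤-Reasoning
  u w : ℕ
  u = hyper (a + d) (b + suc c) (suc a) b
  w = hyper (a + d) (b + suc c) a (suc b)
  permuteˡ : ∀ k x u → k * (x * u) ≡ x * (k * u)
  permuteˡ = solve-∀
  permuteʳ : ∀ y k w → y * k * w ≡ k * (y * w)
  permuteʳ = solve-∀

-- A discrete Stein identity: summed over an antidiagonal it telescopes.
hyper-telescope : ∀ p₁ p₂ a b →
  (a * (p₁ C a)) * (suc b * (p₂ C suc b)) + p₁ * b * hyper p₁ p₂ a b ≡
  (suc a * (p₁ C suc a)) * (b * (p₂ C b)) + a * p₂ * hyper p₁ p₂ a b
hyper-telescope p₁ p₂ a b = +-cancelʳ-≡ (a * f * (b * g)) _ _ (begin
  (a * f) * (suc b * g') + p₁ * b * (f * g) + a * f * (b * g)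
    ≡⟨ left a b f g p₁ (suc b * g') ⟩
  (a * f) * (suc b * g' + b * g) + p₁ * f * (b * g)
    ≡⟨ cong₂ (λ s t → (a * f) * s + t * (b * g)) (C-absorb p₂ b) (sym (C-absorb p₁ a)) ⟩
  (a * f) * (p₂ * g) + (suc a * f' + a * f) * (b * g)
    ≡⟨ right a b f g p₂ (suc a * f') ⟩
  (suc a * f') * (b * g) + a * p₂ * (f * g) + a * f * (b * g) ∎)
  where
  open ≡-Reasoning
  f f' g g' : ℕ
  f = p₁ C a
  f' = p₁ C suc a
  g = p₂ C b
  g' = p₂ C suc b
  left : ∀ a b f g p₁ t → (a * f) * t + p₁ * b * (f * g) + a * f * (b * g) ≡ (a * f) * (t + b * g) + p₁ * f * (b * g)
  left = solve-∀
  right : ∀ a b f g p₂ s → (a * f) * (p₂ * g) + (s + a * f) * (b * g) ≡ s * (b * g) + a * p₂ * (f * g) + a * f * (b * g)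
  right = solve-∀

-- The drift `a p₂ - p₁ b` only grows along the antidiagonal, so it is at least `k` throughout. The
-- sum of `hyper-telescope` leaves just the boundary term at the start; the one at the far end
-- carries the factor `b = 0`.
hyper-tail : ∀ p₁ p₂ k a b → p₁ * b + k ≤ a * p₂ →
  k * antidiagonal (hyper p₁ p₂) a b ≤ (a * (p₁ C a)) * (suc b * (p₂ C suc b))
hyper-tail p₁ p₂ k a zero h = begin
  k * H
    ≤⟨ *-monoˡ-≤ H (m+n≤o⇒n≤o (p₁ * 0) h) ⟩
  a * p₂ * H
    ≤⟨ m≤n+m (a * p₂ * H) ((suc a * (p₁ C suc a)) * (0 * (p₂ C 0))) ⟩
  (suc a * (p₁ C suc a)) * (0 * (p₂ C 0)) + a * p₂ * H
    ≡⟨ hyper-telescope p₁ p₂ a 0 ⟨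
  V + p₁ * 0 * H
    ≡⟨ cong (λ z → V + z * H) (*-zeroʳ p₁) ⟩
  V + 0
    ≡⟨ +-identityʳ V ⟩
  V ∎
  where
  open ≤-Reasoning
  H V : ℕ
  H = hyper p₁ p₂ a 0
  V = (a * (p₁ C a)) * (1 * (p₂ C 1))
hyper-tail p₁ p₂ k a (suc b) h = +-cancelʳ-≤ (p₁ * suc b * H) _ _ (begin
  k * (H + R) + p₁ * suc b * H
    ≡⟨ regroup k H R (p₁ * suc b) ⟩
  k * R + (p₁ * suc b + k) * H
    ≤⟨ +-mono-≤ (hyper-tail p₁ p₂ k (suc a) b h') (*-monoˡ-≤ H h) ⟩
  (suc a * (p₁ C suc a)) * (suc b * (p₂ C suc b)) + a * p₂ * H
    ≡⟨ hyper-telescope p₁ p₂ a (suc b) ⟨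
  (a * (p₁ C a)) * (suc (suc b) * (p₂ C suc (suc b))) + p₁ * suc b * H ∎)
  where
  open ≤-Reasoning
  H R : ℕ
  H = hyper p₁ p₂ a (suc b)
  R = antidiagonal (hyper p₁ p₂) (suc a) b
  h' : p₁ * b + k ≤ suc a * p₂
  h' = ≤-trans (+-monoˡ-≤ k (*-monoʳ-≤ p₁ (n≤1+n b))) (≤-trans h (*-monoˡ-≤ p₂ (n≤1+n a)))
  regroup : ∀ k x y z → k * (x + y) + z * x ≡ k * y + (z + k) * x
  regroup = solve-∀

m≤m*n′ : ∀ m {n} → 1 ≤ n → m ≤ m * n
m≤m*n′ m {suc n} _ = m≤m*n m (suc n)

m≤n*m′ : ∀ m {n} → 1 ≤ n → m ≤ n * m
m≤n*m′ m {suc n} _ = m≤n*m m (suc n)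

-- At a = A + i the ratio of consecutive hypergeometric weights is G / F with
-- G − F = p₁ B − A p₂ + B − A − i (p₁ + p₂ + 2); here i = − k.
ratio-below : ∀ v a b k c d → let A = suc (a + k); B = suc b; p₁ = a + d; p₂ = b + k + c in
  1 ≤ v → k ≤ v → 40 * (v * v) ≤ A → 2 * A ≤ p₁ → 2 * B ≤ p₂ → p₁ ≤ 2 * p₂ → p₁ * B ≤ (A + v) * p₂ →
  0 < c × 2 * v * (d * suc (b + k)) ≤ suc (2 * v) * (suc a * c)
ratio-below v a b k c d 1≤v k≤v 40v²≤A 2A≤p 2B≤q p≤2q pB≤ = 0<c , final
  where
  open ≤-Reasoning
  A B p₁ p₂ F G : ℕ
  A = suc (a + k)
  B = suc b
  p₁ = a + d
  p₂ = b + k + c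
  F = suc a * c
  G = d * suc (b + k)
  v≤v² : v ≤ v * v
  v≤v² = m≤m*n′ v 1≤v
  A≤q : A ≤ p₂
  A≤q = *-cancelˡ-≤ 2 (≤-trans 2A≤p p≤2q)
  40k≤q : 40 * k ≤ p₂
  40k≤q = ≤-trans (*-monoʳ-≤ 40 (≤-trans k≤v v≤v²)) (≤-trans 40v²≤A A≤q)
  q≤3c : p₂ ≤ 3 * c
  q≤3c = *-cancelˡ-≤ 2 (≤-certificate (+-mono-≤ (*-monoʳ-≤ 3 2B≤q) 40k≤q) (34 * k + 6) (eq b k c))
    where
    eq : ∀ b k c → 2 * (b + k + c) + (3 * (b + k + c) + (b + k + c)) + (34 * k + 6)
         ≡ 2 * (3 * c) + (3 * (2 * suc b) + 40 * k)
    eq = solve-∀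
  2≤q : 2 ≤ p₂
  2≤q = ≤-trans (s≤s (≤-trans (s≤s z≤n) (m≤n+m (suc (b + 0)) b))) 2B≤q
  0<c : 0 < c
  0<c = *-cancelˡ-< 3 0 c (≤-trans (≤-trans (s≤s z≤n) 2≤q) q≤3c)
  39v²≤a : 39 * (v * v) ≤ suc a
  39v²≤a = ≤-certificate (+-mono-≤ 40v²≤A (≤-trans k≤v v≤v²)) 0 (eq (v * v) a k)
    where
    eq : ∀ w a k → 39 * w + (suc (a + k) + w) + 0 ≡ suc a + (40 * w + k)
    eq = solve-∀
  S≤4q : p₁ + p₂ + 2 ≤ 4 * p₂
  S≤4q = ≤-certificate (+-mono-≤ p≤2q 2≤q) 0 (eq p₁ p₂)
    where
    eq : ∀ p₁ p₂ → p₁ + p₂ + 2 + (2 * p₂ + p₂) + 0 ≡ 4 * p₂ + (p₁ + 2)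
    eq = solve-∀
  G≤F+6vq : G ≤ F + 6 * (v * p₂)
  G≤F+6vq = ≤-certificate
    (+-mono-≤ (+-mono-≤ pB≤ (≤-trans 2B≤q (m≤n*m′ p₂ 1≤v))) (*-mono-≤ k≤v S≤4q))
    (A + B) (eq a b k c d v)
    where
    eq : ∀ a b k c d v → let A = suc (a + k); B = suc b; p₁ = a + d; p₂ = b + k + c in
         d * suc (b + k) + ((A + v) * p₂ + v * p₂ + v * (4 * p₂)) + (A + B)
         ≡ suc a * c + 6 * (v * p₂) + (p₁ * B + 2 * B + k * (p₁ + p₂ + 2))
    eq = solve-∀
  -- `F` is at least `39 v² · p₂ / 3`, so the excess `6 v p₂` is at most the fraction `1 / (2v)` of
  -- `F`. This is what the 40 in `40 v² ≤ A` pays for.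
  12v²q≤F : 12 * (v * v * p₂) ≤ F
  12v²q≤F = *-cancelˡ-≤ 3 (begin
    3 * (12 * (v * v * p₂))  ≡⟨ left (v * v) p₂ ⟩
    36 * (v * v) * p₂        ≤⟨ *-mono-≤ (≤-trans (*-monoˡ-≤ (v * v) (m≤m+n 36 3)) 39v²≤a) q≤3c ⟩
    suc a * (3 * c)         ≡⟨ right (suc a) c ⟩
    3 * F                   ∎)
    where
    left : ∀ w p₂ → 3 * (12 * (w * p₂)) ≡ 36 * w * p₂
    left = solve-∀
    right : ∀ a c → a * (3 * c) ≡ 3 * (a * c)
    right = solve-∀
  final : 2 * v * G ≤ suc (2 * v) * F
  final = begin
    2 * v * G                          ≤⟨ *-monoʳ-≤ (2 * v) G≤F+6vq ⟩
    2 * v * (F + 6 * (v * p₂))          ≡⟨ expand v F p₂ ⟩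
    12 * (v * v * p₂) + 2 * v * F       ≤⟨ +-monoˡ-≤ (2 * v * F) 12v²q≤F ⟩
    suc (2 * v) * F                    ∎
    where
    expand : ∀ v F p₂ → 2 * v * (F + 6 * (v * p₂)) ≡ 12 * (v * v * p₂) + 2 * v * F
    expand = solve-∀

-- The same comparison at `i ≥ 0`. From distance `v` on, the term `i (p₁ + p₂ + 2)` outweighs the
-- allowed excess and the weights fall. Nearer to the cut the excess of `G` over `F` is at most
-- `v p₂ + B`: a `1 / (2v)` fraction of `F` for large `A`, and at most `3 F` for `v = 1`.
ratio-above : ∀ v a i b c d → let A = suc a; B = suc (b + i); p₁ = a + i + d; p₂ = b + c in
  1 ≤ v → 2 * B ≤ p₂ → p₂ ≤ 2 * p₁ → p₁ * B ≤ (A + v) * p₂ →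
  let F = suc (a + i) * c; G = d * suc b in
  0 < c × (v ≤ i → G ≤ F) × (v ≡ 1 → G ≤ 4 * F) × (40 * (v * v) ≤ A → 2 * v * G ≤ suc (2 * v) * F)
ratio-above v a i b c d 1≤v 2B≤q q≤2p pB≤ = 0<c , falling , rising₁ , rising
  where
  open ≤-Reasoning
  A B p₁ p₂ F G : ℕ
  A = suc a
  B = suc (b + i)
  p₁ = a + i + d
  p₂ = b + c
  F = suc (a + i) * c
  G = d * suc b
  q≤2c : p₂ ≤ 2 * c
  q≤2c = ≤-certificate 2B≤q (2 * i + 2) (eq b i c)
    where
    eq : ∀ b i c → b + c + (b + c) + (2 * i + 2) ≡ 2 * c + 2 * suc (b + i)
    eq = solve-∀
  B≤p : B ≤ p₁
  B≤p = *-cancelˡ-≤ 2 (≤-trans 2B≤q q≤2p)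
  B≤q : B ≤ p₂
  B≤q = ≤-trans (m≤n*m′ B (s≤s (z≤n {1}))) 2B≤q
  0<c : 0 < c
  0<c = *-cancelˡ-< 2 0 c (≤-trans (s≤s z≤n) (≤-trans B≤q q≤2c))
  falling : v ≤ i → G ≤ F
  falling v≤i = ≤-certificate
    (+-mono-≤ pB≤ (+-mono-≤ (≤-trans B≤p (m≤n*m′ p₁ 1≤v)) (*-monoˡ-≤ (p₁ + p₂ + 2) v≤i)))
    (A + 2 * v) (eq a i b c d v)
    where
    eq : ∀ a i b c d v → let A = suc a; B = suc (b + i); p₁ = a + i + d; p₂ = b + c in
         d * suc b + ((A + v) * p₂ + (v * p₁ + i * (p₁ + p₂ + 2))) + (A + 2 * v)
         ≡ suc (a + i) * c + (p₁ * B + (B + v * (p₁ + p₂ + 2)))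
    eq = solve-∀
  G≤F+vq+B : G ≤ F + (v * p₂ + B)
  G≤F+vq+B = ≤-certificate pB≤ (A + i * (p₁ + p₂ + 2)) (eq a i b c d v)
    where
    eq : ∀ a i b c d v → let A = suc a; B = suc (b + i); p₁ = a + i + d; p₂ = b + c in
         d * suc b + (A + v) * p₂ + (A + i * (p₁ + p₂ + 2))
         ≡ suc (a + i) * c + (v * p₂ + B) + p₁ * B
    eq = solve-∀
  rising₁ : v ≡ 1 → G ≤ 4 * F
  rising₁ refl = begin
    G                    ≤⟨ G≤F+vq+B ⟩
    F + (1 * p₂ + B)      ≤⟨ +-monoʳ-≤ F (*-cancelˡ-≤ 2 (≤-certificate (+-mono-≤ 2B≤q (*-monoʳ-≤ 3 q≤2c)) 0 (eq p₂ B c))) ⟩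
    F + 3 * c            ≤⟨ +-monoʳ-≤ F (*-monoʳ-≤ 3 (m≤n*m c (suc (a + i)))) ⟩
    F + 3 * F            ∎
    where
    eq : ∀ p₂ B c → 2 * (1 * p₂ + B) + (p₂ + 3 * (2 * c)) + 0 ≡ 2 * (3 * c) + (2 * B + 3 * p₂)
    eq = solve-∀
  rising : 40 * (v * v) ≤ A → 2 * v * G ≤ suc (2 * v) * F
  rising 40v²≤A = begin
    2 * v * G                        ≤⟨ *-monoʳ-≤ (2 * v) G≤F+vq+B ⟩
    2 * v * (F + (v * p₂ + B))        ≤⟨ *-monoʳ-≤ (2 * v) (+-monoʳ-≤ F (+-monoʳ-≤ (v * p₂) (≤-trans B≤q (m≤n*m′ p₂ 1≤v)))) ⟩
    2 * v * (F + (v * p₂ + v * p₂))    ≡⟨ expand v F p₂ ⟩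
    4 * (v * v) * p₂ + 2 * v * F      ≤⟨ +-monoˡ-≤ (2 * v * F) 4v²q≤F ⟩
    suc (2 * v) * F                  ∎
    where
    expand : ∀ v F p₂ → 2 * v * (F + (v * p₂ + v * p₂)) ≡ 4 * (v * v) * p₂ + 2 * v * F
    expand = solve-∀
    4v²q≤F : 4 * (v * v) * p₂ ≤ F
    4v²q≤F = *-cancelˡ-≤ 2 (begin
      2 * (4 * (v * v) * p₂)   ≡⟨ *-assoc 2 (4 * (v * v)) p₂ ⟨
      2 * (4 * (v * v)) * p₂   ≡⟨ cong (_* p₂) (*-assoc 2 4 (v * v)) ⟨
      8 * (v * v) * p₂         ≤⟨ *-mono-≤ (≤-trans (*-monoˡ-≤ (v * v) (m≤m+n 8 32)) (≤-trans 40v²≤A (s≤s (m≤m+n a i)))) q≤2c ⟩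
      suc (a + i) * (2 * c)   ≡⟨ double (suc (a + i)) c ⟩
      2 * F                   ∎)
      where
      double : ∀ a c → a * (2 * c) ≡ 2 * (a * c)
      double = solve-∀

-- Anticoncentration of the hypergeometric distribution at the cut.

module Anticoncentration (p₁ p₂ a b v : ℕ)
  (1≤v : 1 ≤ v) (v≤√A : v ≡ 1 ⊎ 40 * (v * v) ≤ suc a) (√A≤v : suc a ≤ 160 * (v * v))
  (2A≤p : 2 * suc a ≤ p₁) (2B≤q : 2 * suc b ≤ p₂) (p≤2q : p₁ ≤ 2 * p₂) (q≤2p : p₂ ≤ 2 * p₁)
  -- The denial of the gap to be proved, in its weak form.
  (pB≤ : p₁ * suc b ≤ (suc a + v) * p₂)
  where
  open ≤-Reasoning

  private
    h : ℕ → ℕ → ℕ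
    h = hyper p₁ p₂

    m lower upper : ℕ
    m = h a (suc b)
    lower = antidiagonal (flip h) (suc b) a
    upper = antidiagonal h (suc a) b

    B≤q : suc b ≤ p₂
    B≤q = ≤-trans (m≤n*m′ (suc b) (s≤s (z≤n {1}))) 2B≤q

    A≤p : suc a ≤ p₁
    A≤p = ≤-trans (m≤n*m′ (suc a) (s≤s (z≤n {1}))) 2A≤p

    step-below : 40 * (v * v) ≤ suc a → ∀ j a′ → a′ + suc j ≡ a → suc j ≤ v →
                 2 * v * h (suc a′) (suc b + j) ≤ suc (2 * v) * h a′ (suc (suc b + j))
    step-below 40v²≤A j a′ refl j<v =
      subst₂ (λ p′ q′ → 2 * v * hyper p′ q′ (suc a′) (suc b + j) ≤ suc (2 * v) * hyper p′ q′ a′ (suc (suc b + j)))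
        a+d≡p b+c≡q
        (subst (λ k → 2 * v * hyper (a′ + d) (k + c) (suc a′) k ≤ suc (2 * v) * hyper (a′ + d) (k + c) a′ (suc k))
          (+-suc b j)
          (hyper-ratio a′ (b + suc j) c d (2 * v) (suc (2 * v)) (proj₁ ratio) (proj₂ ratio)))
      where
      c d : ℕ
      d = p₁ ∸ a′
      c = p₂ ∸ (suc b + j)
      a+d≡p : a′ + d ≡ p₁
      a+d≡p = m+[n∸m]≡n (≤-trans (≤-trans (m≤m+n a′ (suc j)) (n≤1+n _)) A≤p)
      k≤q : 2 * suc j ≤ p₂
      k≤q = ≤-trans (*-monoʳ-≤ 2 (≤-trans j<v (m≤m*n′ v 1≤v)))
              (≤-trans (*-monoˡ-≤ (v * v) (m≤m+n 2 38))
                (≤-trans 40v²≤A (*-cancelˡ-≤ 2 (≤-trans 2A≤p p≤2q))))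
      b+c≡q : suc b + j + c ≡ p₂
      b+c≡q = m+[n∸m]≡n {suc b + j} (*-cancelˡ-≤ 2 (≤-certificate (+-mono-≤ 2B≤q k≤q) 2 (eq b j p₂)))
        where
        eq : ∀ b j p₂ → 2 * (suc b + j) + (p₂ + p₂) + 2 ≡ 2 * p₂ + (2 * suc b + 2 * suc j)
        eq = solve-∀
      q≡ : p₂ ≡ b + suc j + c
      q≡ = trans (sym b+c≡q) (cong (_+ c) (sym (+-suc b j)))
      ratio : 0 < c × 2 * v * (d * suc (b + suc j)) ≤ suc (2 * v) * (suc a′ * c)
      ratio = ratio-below v a′ b (suc j) c d 1≤v j<v 40v²≤A
        (subst (2 * suc (a′ + suc j) ≤_) (sym a+d≡p) 2A≤p)
        (subst (2 * suc b ≤_) q≡ 2B≤q)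
        (subst₂ (λ x y → x ≤ 2 * y) (sym a+d≡p) q≡ p≤2q)
        (subst₂ (λ x y → x * suc b ≤ (suc (a′ + suc j) + v) * y) (sym a+d≡p) q≡ pB≤)

    step-above : ∀ j b′ → b′ + j ≡ b →
      let x = h (suc (a + j)) b′; y = h (a + j) (suc b′) in
      (v ≤ j → x ≤ y) × (v ≡ 1 → x ≤ 4 * y) × (40 * (v * v) ≤ suc a → 2 * v * x ≤ suc (2 * v) * y)
    step-above j b′ refl with a + j ≤? p₁
    -- Here the left-hand weight vanishes, since more than `p₁` elements would be chosen out of
    -- `p₁`.
    ... | no a+j≰p = (λ _ → subst (_≤ y) x≡0 z≤n) , (λ _ → subst (_≤ 4 * y) x≡0 z≤n) ,
          (λ _ → subst (λ x → 2 * v * x ≤ suc (2 * v) * y) x≡0 (subst (_≤ suc (2 * v) * y) (sym (*-zeroʳ (2 * v))) z≤n))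
      where
      y : ℕ
      y = h (a + j) (suc b′)
      x≡0 : 0 ≡ h (suc (a + j)) b′
      x≡0 = cong (_* (p₂ C b′)) (sym (k>n⇒nCk≡0 {p₁} {suc (a + j)} (≤-trans (≰⇒> a+j≰p) (n≤1+n _))))
    ... | yes a+j≤p = (λ v≤j → subst₂ _≤_ (*-identityˡ _) (*-identityˡ _) (by 1 1 (subst₂ _≤_ (sym (*-identityˡ _)) (sym (*-identityˡ _)) (falling v≤j)))) ,
          (λ v≡1 → subst₂ _≤_ (*-identityˡ _) refl (by 1 4 (subst (_≤ 4 * (suc (a + j) * c)) (sym (*-identityˡ _)) (rising₁ v≡1)))) ,
          (λ 40v²≤A → by (2 * v) (suc (2 * v)) (rising 40v²≤A))
      where
      c d : ℕ
      d = p₁ ∸ (a + j)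
      c = p₂ ∸ b′
      a+d≡p : a + j + d ≡ p₁
      a+d≡p = m+[n∸m]≡n a+j≤p
      b+c≡q : b′ + c ≡ p₂
      b+c≡q = m+[n∸m]≡n (≤-trans (≤-trans (m≤m+n b′ j) (n≤1+n _)) B≤q)
      ratio : let F = suc (a + j) * c; G = d * suc b′ in
        0 < c × (v ≤ j → G ≤ F) × (v ≡ 1 → G ≤ 4 * F) × (40 * (v * v) ≤ suc a → 2 * v * G ≤ suc (2 * v) * F)
      ratio = ratio-above v a j b′ c d 1≤v
        (subst (2 * suc (b′ + j) ≤_) (sym b+c≡q) 2B≤q)
        (subst₂ (λ x y → y ≤ 2 * x) (sym a+d≡p) (sym b+c≡q) q≤2p)
        (subst₂ (λ x y → x * suc (b′ + j) ≤ (suc a + v) * y) (sym a+d≡p) (sym b+c≡q) pB≤)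
      falling : v ≤ j → d * suc b′ ≤ suc (a + j) * c
      falling = proj₁ (proj₂ ratio)
      rising₁ : v ≡ 1 → d * suc b′ ≤ 4 * (suc (a + j) * c)
      rising₁ = proj₁ (proj₂ (proj₂ ratio))
      rising : 40 * (v * v) ≤ suc a → 2 * v * (d * suc b′) ≤ suc (2 * v) * (suc (a + j) * c)
      rising = proj₂ (proj₂ (proj₂ ratio))
      by : ∀ x y → x * (d * suc b′) ≤ y * (suc (a + j) * c) →
           x * h (suc (a + j)) b′ ≤ y * h (a + j) (suc b′)
      by x y le = subst₂ (λ p′ q′ → x * hyper p′ q′ (suc (a + j)) b′ ≤ y * hyper p′ q′ (a + j) (suc b′))
        a+d≡p b+c≡q (hyper-ratio (a + j) b′ c d x y (proj₁ ratio) le)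

    K : ℕ
    K = 2 * v

    remaining : ∀ j r → j + r ≡ suc K → j ≤ v → suc v ≤ r
    remaining j r eq j≤v = ≤-certificate j≤v 0 (trans (double v) (trans (sym eq) (+-comm j r)))
      where
      double : ∀ v → suc v + v + 0 ≡ suc (2 * v)
      double = solve-∀

    compound : ∀ x y → K * x ≤ suc K * y → ∀ r → r * K * x ≤ suc K * (r * y)
    compound x y le r = begin
      r * K * x          ≡⟨ *-assoc r K x ⟩
      r * (K * x)        ≤⟨ *-monoʳ-≤ r le ⟩
      r * (suc K * y)    ≡⟨ permute r (suc K) y ⟩
      suc K * (r * y)    ∎
      where
      permute : ∀ r k y → r * (k * y) ≡ k * (r * y)
      permute = solve-∀

    -- The one-step ratio `K / (K + 1)` is iterated `j ≤ v` times by Bernoulli; `r` is what remains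
    -- of `K + 1` after `j` steps.
    window-below : 40 * (v * v) ≤ suc a → ∀ j r a′ → a′ + j ≡ a → j ≤ v → j + r ≡ suc K →
                   r * m ≤ suc K * h a′ (suc b + j)
    window-below 40v²≤A zero r a′ a≡ j≤v refl =
      ≤-reflexive (cong (suc K *_) (cong₂ h (trans (sym a≡) (+-identityʳ a′)) (sym (+-identityʳ (suc b)))))
    window-below 40v²≤A (suc j) r a′ a≡ j<v r≡ = bernoulli-step r K m _ r≤K (begin
      K * suc r * m                          ≡⟨ *-assoc K (suc r) m ⟩
      K * (suc r * m)                        ≤⟨ *-monoʳ-≤ K (window-below 40v²≤A j (suc r) (suc a′)
                                                  (trans (sym (+-suc a′ j)) a≡) (≤-trans (n≤1+n j) j<v)
                                                  (trans (+-suc j r) r≡)) ⟩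
      K * (suc K * x)                        ≡⟨ permute K (suc K) x ⟩
      suc K * (K * x)                        ≤⟨ *-monoʳ-≤ (suc K) (step-below 40v²≤A j a′ a≡ j<v) ⟩
      suc K * (suc K * h a′ (suc (suc b + j))) ≡⟨ cong (λ k → suc K * (suc K * h a′ k)) (sym (+-suc (suc b) j)) ⟩
      suc K * (suc K * h a′ (suc b + suc j)) ∎)
      where
      x : ℕ
      x = h (suc a′) (suc b + j)
      r≤K : r ≤ K
      r≤K = subst (r ≤_) (suc-injective r≡) (m≤n+m r j)
      permute : ∀ r k y → r * (k * y) ≡ k * (r * y)
      permute = solve-∀

    half-below : v ≡ 1 ⊎ 40 * (v * v) ≤ suc a → ∀ j a′ → a′ + j ≡ a → j < v → m ≤ 2 * h a′ (suc b + j)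
    half-below (inj₁ _) zero a′ a≡ j<v = subst (λ x → m ≤ 2 * x)
      (cong₂ h (trans (sym a≡) (+-identityʳ a′)) (sym (+-identityʳ (suc b)))) (m≤n*m m 2)
    half-below (inj₁ v≡1) (suc j) a′ a≡ j<v with s≤s () ← subst (suc j <_) v≡1 j<v
    half-below (inj₂ 40v²≤A) j a′ a≡ j<v = bernoulli-end v r m _ (remaining j r r≡ (<⇒≤ j<v))
                          (window-below 40v²≤A j r a′ a≡ (<⇒≤ j<v) r≡)
      where
      r : ℕ
      r = suc K ∸ j
      r≡ : j + r ≡ suc K
      r≡ = m+[n∸m]≡n (≤-trans (<⇒≤ j<v) (≤-trans (m≤n*m v 2) (n≤1+n _)))

    window-above : 40 * (v * v) ≤ suc a → ∀ j r b′ → b′ + j ≡ suc b → j ≤ v → j + r ≡ suc K →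
                   r * h (a + j) b′ ≤ suc K * m
    window-above 40v²≤A zero r b′ b≡ j≤v refl =
      ≤-reflexive (cong (suc K *_) (cong₂ h (+-identityʳ a) (trans (sym (+-identityʳ b′)) b≡)))
    window-above 40v²≤A (suc j) r b′ b≡ j<v r≡ = bernoulli-step r K _ m r≤K (begin
      K * suc r * h (a + suc j) b′    ≡⟨ cong₂ (λ x k → x * h k b′) (*-comm K (suc r)) (+-suc a j) ⟩
      suc r * K * h (suc (a + j)) b′  ≤⟨ compound _ y (proj₂ (proj₂ (step-above j b′ b≡′))  40v²≤A) (suc r) ⟩
      suc K * (suc r * y)             ≤⟨ *-monoʳ-≤ (suc K) (window-above 40v²≤A j (suc r) (suc b′)
                                           (cong suc b≡′) (≤-trans (n≤1+n j) j<v)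
                                           (trans (+-suc j r) r≡)) ⟩
      suc K * (suc K * m)             ∎)
      where
      y : ℕ
      y = h (a + j) (suc b′)
      b≡′ : b′ + j ≡ b
      b≡′ = suc-injective (trans (sym (+-suc b′ j)) b≡)
      r≤K : r ≤ K
      r≤K = subst (r ≤_) (suc-injective r≡) (m≤n+m r j)

    -- Past distance `v` the weights fall, so only the first `v` steps can raise them: by a factor 2
    -- in total by Bernoulli, or by the single factor 4 when `v = 1`.
    peak : v ≡ 1 ⊎ 40 * (v * v) ≤ suc a → ∀ j b′ → b′ + j ≡ suc b → h (a + j) b′ ≤ 4 * m
    peak _ zero b′ b≡ = subst (_≤ 4 * m) (sym (cong₂ h (+-identityʳ a) (trans (sym (+-identityʳ b′)) b≡))) (m≤n*m m 4)
    peak v-or (suc j) b′ b≡ with v ≤? j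
    ... | yes v≤j = begin
      h (a + suc j) b′    ≡⟨ cong (λ k → h k b′) (+-suc a j) ⟩
      h (suc (a + j)) b′  ≤⟨ proj₁ (step-above j b′ b≡′) v≤j ⟩
      h (a + j) (suc b′)  ≤⟨ peak v-or j (suc b′) (cong suc b≡′) ⟩
      4 * m               ∎
      where
      b≡′ : b′ + j ≡ b
      b≡′ = suc-injective (trans (sym (+-suc b′ j)) b≡)
    peak (inj₂ 40v²≤A) (suc j) b′ b≡ | no v≰j = ≤-trans
      (bernoulli-end v r _ m (remaining (suc j) r r≡ j<v) (window-above 40v²≤A (suc j) r b′ b≡ j<v r≡))
      (*-monoˡ-≤ m (s≤s (s≤s (z≤n {2}))))
      where
      j<v : suc j ≤ v
      j<v = ≰⇒> v≰j
      r : ℕ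
      r = suc K ∸ suc j
      r≡ : suc j + r ≡ suc K
      r≡ = m+[n∸m]≡n (≤-trans j<v (≤-trans (m≤n*m v 2) (n≤1+n _)))
    peak (inj₁ v≡1) (suc zero) b′ b≡ | no v≰j = begin
      h (a + 1) b′             ≡⟨ cong (λ k → h k b′) (+-suc a 0) ⟩
      h (suc (a + 0)) b′       ≤⟨ proj₁ (proj₂ (step-above 0 b′ b≡′)) v≡1 ⟩
      4 * h (a + 0) (suc b′)   ≡⟨ cong (4 *_) (cong₂ h (+-identityʳ a) (trans (cong suc (sym (+-identityʳ b′))) (cong suc b≡′))) ⟩
      4 * m                    ∎
      where
      b≡′ : b′ + 0 ≡ b
      b≡′ = suc-injective (trans (sym (+-suc b′ 0)) b≡)
    peak (inj₁ v≡1) (suc (suc j)) b′ b≡ | no v≰j = contradiction (subst (_≤ suc j) (sym v≡1) (s≤s z≤n)) v≰j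

    -- The drift may be short of balance by at most `v p₂` at the cut, so after `2v` steps it is at
    -- least `v p₂` and `hyper-tail` applies. Its boundary term is at most `p₁ (b + 1)` times a
    -- weight bounded by `4 * m`. The 161 comes from `A ≤ 160 v²` and `v ≤ v²`.
    far : ∀ j → K + j ≡ b → antidiagonal h (suc a + K) j ≤ 161 * v * (4 * m)
    far j refl = *-cancelˡ-≤ (v * p₂) (begin
      v * p₂ * antidiagonal h (suc a + K) j
        ≤⟨ hyper-tail p₁ p₂ (v * p₂) (suc a + K) j room ⟩
      (suc (a + K) * (p₁ C suc (a + K))) * (suc j * (p₂ C suc j))
        ≤⟨ *-monoˡ-≤ _ (subst (suc (a + K) * (p₁ C suc (a + K)) ≤_) (C-absorb p₁ (a + K)) (m≤m+n _ _)) ⟩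
      (p₁ * (p₁ C (a + K))) * (suc j * (p₂ C suc j))
        ≡⟨ regroup p₁ (p₁ C (a + K)) (suc j) (p₂ C suc j) ⟩
      p₁ * suc j * h (a + K) (suc j)
        ≤⟨ *-mono-≤ (≤-trans (*-monoʳ-≤ p₁ (s≤s (m≤n+m j K))) pB≤) (peak v≤√A K (suc j) (cong suc (+-comm j K))) ⟩
      (suc a + v) * p₂ * (4 * m)
        ≤⟨ *-monoˡ-≤ (4 * m) (*-monoˡ-≤ p₂ (+-mono-≤ √A≤v (m≤m*n′ v 1≤v))) ⟩
      (160 * (v * v) + v * v) * p₂ * (4 * m)
        ≡⟨ collect v p₂ (4 * m) ⟩
      v * p₂ * (161 * v * (4 * m)) ∎)
      where
      instance
        vq≢0 : NonZero (v * p₂)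
        vq≢0 = >-nonZero (*-mono-≤ 1≤v (≤-trans (s≤s z≤n) B≤q))
      regroup : ∀ p₁ f j g → (p₁ * f) * (j * g) ≡ p₁ * j * (f * g)
      regroup = solve-∀
      collect : ∀ v p₂ x → (160 * (v * v) + v * v) * p₂ * x ≡ v * p₂ * (161 * v * x)
      collect = solve-∀
      room : p₁ * j + v * p₂ ≤ (suc a + K) * p₂
      room = ≤-certificate (≤-trans (*-monoʳ-≤ p₁ (≤-trans (m≤n+m j K) (n≤1+n _))) pB≤) 0 (eq (p₁ * j) a v p₂)
        where
        eq : ∀ x a v p₂ → x + v * p₂ + (suc a + v) * p₂ + 0 ≡ (suc a + 2 * v) * p₂ + x
        eq = solve-∀

    lower-large : v * m ≤ 2 * lower
    lower-large = antidiagonal-lower (flip h) m v (suc b) a v≤A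
      (λ i j eq i<v → half-below v≤√A i j (trans (+-comm j i) eq) i<v)
      where
      v≤A : v ≤ suc a
      v≤A = [ (λ v≡1 → subst (_≤ suc a) (sym v≡1) (s≤s z≤n)) , (λ 40v²≤A → ≤-trans (m≤m*n′ v 1≤v) (≤-trans (m≤n*m (v * v) 40) 40v²≤A)) ]′ v≤√A

    upper-small : upper ≤ K * (4 * m) + 161 * v * (4 * m)
    upper-small = antidiagonal-upper h (4 * m) (161 * v * (4 * m)) K (suc a) b
      (λ i j eq _ → subst (λ k → h k j ≤ 4 * m) (+-suc a i)
                      (peak v≤√A (suc i) j (trans (+-suc j i) (cong suc (trans (+-comm j i) eq)))))
      (λ j eq → far j eq)

  lower-positive : 0 < antidiagonal (flip (hyper p₁ p₂)) (suc b) a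
  lower-positive = *-cancelˡ-< 2 0 lower (≤-trans (*-mono-≤ 1≤v
    (*-mono-≤ (C-positive (≤-trans (n≤1+n a) A≤p)) (C-positive B≤q))) lower-large)

  -- In units of the weight `m` at the cut: `v` terms of the lower part are at least `m / 2` each,
  -- the next `2v` terms above are at most `4m` each, and `far` bounds the rest. Then
  -- `652 = 2 · 4 + 161 · 4` and `1305 = 2 · 652 + 1`.
  anticoncentration : antidiagonal (hyper p₁ p₂) 0 (a + suc b) ≤
                      1305 * antidiagonal (flip (hyper p₁ p₂)) (suc b) a
  anticoncentration = begin
    antidiagonal h 0 (a + suc b)             ≡⟨ antidiagonal-split h a b ⟩
    upper + lower                            ≤⟨ +-monoˡ-≤ lower upper-small ⟩
    K * (4 * m) + 161 * v * (4 * m) + lower  ≡⟨ collect v m lower ⟩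
    652 * (v * m) + lower                    ≤⟨ +-monoˡ-≤ lower (*-monoʳ-≤ 652 lower-large) ⟩
    652 * (2 * lower) + lower                ≡⟨ total lower ⟩
    1305 * lower                             ∎
    where
    collect : ∀ v m l → 2 * v * (4 * m) + 161 * v * (4 * m) + l ≡ 652 * (v * m) + l
    collect = solve-∀
    total : ∀ l → 652 * (2 * l) + l ≡ 1305 * l
    total = solve-∀

-- Sums over permutations and over sublists of given length.

module _ {A : Set} where

  -- The recursion changes the summand instead of building the list of permutations;
  -- `sum-permutations` connects it to the enumeration used in the definition of `q`.
  insertionSum : A → (List A → ℕ) → List A → ℕ
  insertionSum x f []       = f (x ∷ [])
  insertionSum x f (y ∷ ys) = f (x ∷ y ∷ ys) + insertionSum x (f ∘ (y ∷_)) ys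

  permutationSum : (List A → ℕ) → List A → ℕ
  permutationSum f []       = f []
  permutationSum f (x ∷ xs) = permutationSum (insertionSum x f) xs

  insertionSum-mono : ∀ {x f g} π → (∀ ρ → ρ ↭ x ∷ π → f ρ ≤ g ρ) →
                      insertionSum x f π ≤ insertionSum x g π
  insertionSum-mono []      f≤g = f≤g _ Perm.refl
  insertionSum-mono (y ∷ π) f≤g = +-mono-≤ (f≤g _ Perm.refl)
    (insertionSum-mono π (λ ρ ρ↭ → f≤g (y ∷ ρ) (↭-trans (Perm.prep y ρ↭) (Perm.swap y _ Perm.refl))))

  permutationSum-mono : ∀ {f g} xs → (∀ π → π ↭ xs → f π ≤ g π) →
                        permutationSum f xs ≤ permutationSum g xs
  permutationSum-mono []       f≤g = f≤g [] Perm.refl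
  permutationSum-mono (x ∷ xs) f≤g = permutationSum-mono xs
    (λ π π↭ → insertionSum-mono π (λ ρ ρ↭ → f≤g ρ (↭-trans ρ↭ (Perm.prep x π↭))))

  permutationSum-cong : ∀ {f g} xs → (∀ π → π ↭ xs → f π ≡ g π) →
                        permutationSum f xs ≡ permutationSum g xs
  permutationSum-cong xs f≡g = ≤-antisym (permutationSum-mono xs (λ ρ p → ≤-reflexive (f≡g ρ p)))
                                         (permutationSum-mono xs (λ ρ p → ≤-reflexive (sym (f≡g ρ p))))

  insertionSum-linear : ∀ x k f l g π → insertionSum x (λ ρ → k * f ρ + l * g ρ) π ≡
                        k * insertionSum x f π + l * insertionSum x g π
  insertionSum-linear x k f l g []      = refl
  insertionSum-linear x k f l g (y ∷ π)
    rewrite insertionSum-linear x k (f ∘ (y ∷_)) l (g ∘ (y ∷_)) π = eq k l (f _) (g _) _ _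
    where
    eq : ∀ k l a b c d → k * a + l * b + (k * c + l * d) ≡ k * (a + c) + l * (b + d)
    eq = solve-∀

  permutationSum-linear : ∀ k f l g xs → permutationSum (λ π → k * f π + l * g π) xs ≡
                          k * permutationSum f xs + l * permutationSum g xs
  permutationSum-linear k f l g []       = refl
  permutationSum-linear k f l g (x ∷ xs) = trans
    (permutationSum-cong xs (λ π _ → insertionSum-linear x k f l g π))
    (permutationSum-linear k (insertionSum x f) l (insertionSum x g) xs)

  insertionSum-+ : ∀ x f g π → insertionSum x (λ ρ → f ρ + g ρ) π ≡ insertionSum x f π + insertionSum x g π
  insertionSum-+ x f g []      = refl
  insertionSum-+ x f g (y ∷ π)
    rewrite insertionSum-+ x (f ∘ (y ∷_)) (g ∘ (y ∷_)) π = eq (f _) (g _) _ _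
    where
    eq : ∀ a b c d → a + b + (c + d) ≡ a + c + (b + d)
    eq = solve-∀

  insertionSum-const : ∀ x k π → insertionSum x (λ _ → k) π ≡ suc (length π) * k
  insertionSum-const x k []      = sym (+-identityʳ k)
  insertionSum-const x k (y ∷ π) = cong (k +_) (insertionSum-const x k π)

  permutationSum-* : ∀ k f xs → permutationSum (λ π → k * f π) xs ≡ k * permutationSum f xs
  permutationSum-* k f xs = trans
    (permutationSum-cong xs (λ π _ → sym (+-identityʳ (k * f π))))
    (trans (permutationSum-linear k f 0 f xs) (+-identityʳ _))

  permutationSum-const : ∀ k xs → permutationSum (λ _ → k) xs ≡ length xs ! * k
  permutationSum-const k []       = sym (+-identityʳ k)
  permutationSum-const k (x ∷ xs) = begin
    permutationSum (insertionSum x (λ _ → k)) xs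
      ≡⟨ permutationSum-cong xs (λ π π↭ → trans (insertionSum-const x k π) (cong (λ n → suc n * k) (↭-length π↭))) ⟩
    permutationSum (λ _ → suc (length xs) * k) xs
      ≡⟨ permutationSum-const _ xs ⟩
    length xs ! * (suc (length xs) * k)
      ≡⟨ permute (length xs !) (suc (length xs)) k ⟩
    suc (length xs) * length xs ! * k ∎
    where
    open ≡-Reasoning
    permute : ∀ a b k → a * (b * k) ≡ b * a * k
    permute = solve-∀

  -- This is what makes `permutationSum` independent of the order in which the underlying list is
  -- presented.
  insertionSum-comm : ∀ x y f π → insertionSum y (insertionSum x f) π ≡ insertionSum x (insertionSum y f) π
  insertionSum-comm x y f []      = +-comm (f (x ∷ y ∷ [])) _
  insertionSum-comm x y f (z ∷ π) = begin
    f (x ∷ y ∷ z ∷ π) + (f (y ∷ x ∷ z ∷ π) + insertionSum x (f ∘ (y ∷_) ∘ (z ∷_)) π)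
      + insertionSum y (λ ρ → f (x ∷ z ∷ ρ) + insertionSum x (f ∘ (z ∷_)) ρ) π
      ≡⟨ cong (λ s → f (x ∷ y ∷ z ∷ π) + (f (y ∷ x ∷ z ∷ π) + insertionSum x (f ∘ (y ∷_) ∘ (z ∷_)) π) + s)
           (insertionSum-+ y _ _ π) ⟩
    f (x ∷ y ∷ z ∷ π) + (f (y ∷ x ∷ z ∷ π) + insertionSum x (f ∘ (y ∷_) ∘ (z ∷_)) π)
      + (insertionSum y (f ∘ (x ∷_) ∘ (z ∷_)) π + insertionSum y (insertionSum x (f ∘ (z ∷_))) π)
      ≡⟨ cong (λ s → f (x ∷ y ∷ z ∷ π) + (f (y ∷ x ∷ z ∷ π) + insertionSum x (f ∘ (y ∷_) ∘ (z ∷_)) π)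
                     + (insertionSum y (f ∘ (x ∷_) ∘ (z ∷_)) π + s)) (insertionSum-comm x y (f ∘ (z ∷_)) π) ⟩
    f (x ∷ y ∷ z ∷ π) + (f (y ∷ x ∷ z ∷ π) + insertionSum x (f ∘ (y ∷_) ∘ (z ∷_)) π)
      + (insertionSum y (f ∘ (x ∷_) ∘ (z ∷_)) π + insertionSum x (insertionSum y (f ∘ (z ∷_))) π)
      ≡⟨ eq (f (x ∷ y ∷ z ∷ π)) (f (y ∷ x ∷ z ∷ π)) _ _ _ ⟩
    f (y ∷ x ∷ z ∷ π) + (f (x ∷ y ∷ z ∷ π) + insertionSum y (f ∘ (x ∷_) ∘ (z ∷_)) π)
      + (insertionSum x (f ∘ (y ∷_) ∘ (z ∷_)) π + insertionSum x (insertionSum y (f ∘ (z ∷_))) π)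
      ≡⟨ cong (λ s → f (y ∷ x ∷ z ∷ π) + (f (x ∷ y ∷ z ∷ π) + insertionSum y (f ∘ (x ∷_) ∘ (z ∷_)) π) + s)
           (insertionSum-+ x _ _ π) ⟨
    f (y ∷ x ∷ z ∷ π) + (f (x ∷ y ∷ z ∷ π) + insertionSum y (f ∘ (x ∷_) ∘ (z ∷_)) π)
      + insertionSum x (λ ρ → f (y ∷ z ∷ ρ) + insertionSum y (f ∘ (z ∷_)) ρ) π ∎
    where
    open ≡-Reasoning
    eq : ∀ a b c d e → a + (b + c) + (d + e) ≡ b + (a + d) + (c + e)
    eq = solve-∀

  permutationSum-↭ : ∀ f {xs ys} → xs ↭ ys → permutationSum f xs ≡ permutationSum f ys
  permutationSum-↭ f Perm.refl = refl
  permutationSum-↭ f (Perm.prep x p) = permutationSum-↭ (insertionSum x f) p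
  permutationSum-↭ f (Perm.swap {xs} x y p) = trans
    (permutationSum-cong xs (λ π _ → insertionSum-comm x y f π))
    (permutationSum-↭ (insertionSum x (insertionSum y f)) p)
  permutationSum-↭ f (Perm.trans p q) = trans (permutationSum-↭ f p) (permutationSum-↭ f q)

  module _ {P : Pred A 0ℓ} (P? : Decidable P) where

    filter-split : ∀ xs → xs ↭ filter (¬? ∘ P?) xs ++ filter P? xs
    filter-split [] = Perm.refl
    filter-split (x ∷ xs) with P? x
    ... | yes _ = ↭-trans (Perm.prep x (filter-split xs)) (↭-sym (shift x (filter (¬? ∘ P?) xs) (filter P? xs)))
    ... | no  _ = Perm.prep x (filter-split xs)

    insertionSum-reject : ∀ {x} → ¬ P x → ∀ g π →
      insertionSum x (g ∘ filter P?) π ≡ suc (length π) * g (filter P? π)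
    insertionSum-reject ¬Px g []      = trans (cong g (filter-reject P? ¬Px)) (sym (+-identityʳ _))
    insertionSum-reject {x} ¬Px g (y ∷ π) = cong₂ _+_ (cong g (filter-reject P? ¬Px)) rest
      where
      rest : insertionSum x (g ∘ filter P? ∘ (y ∷_)) π ≡ suc (length π) * g (filter P? (y ∷ π))
      rest with P? y
      ... | yes _ = insertionSum-reject ¬Px (g ∘ (y ∷_)) π
      ... | no  _ = insertionSum-reject ¬Px g π

    permutationSum-rejects : ∀ xs ys → All (λ x → ¬ P x) xs → All P ys →
      ∃[ k ] ∀ g → permutationSum (g ∘ filter P?) (xs ++ ys) ≡ suc k * permutationSum g ys
    permutationSum-rejects [] ys [] Pys = 0 , λ g → trans
      (permutationSum-cong ys (λ π π↭ → cong g (filter-all P? (All-resp-↭ (↭-sym π↭) Pys))))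
      (sym (*-identityˡ _))
    permutationSum-rejects (x ∷ xs) ys (¬Px ∷ ¬Pxs) Pys
      with k , eq ← permutationSum-rejects xs ys ¬Pxs Pys = k + n * suc k , λ g → begin
        permutationSum (insertionSum x (g ∘ filter P?)) (xs ++ ys)
          ≡⟨ permutationSum-cong (xs ++ ys) (λ π π↭ → trans (insertionSum-reject ¬Px g π)
               (cong (λ m → suc m * g (filter P? π)) (↭-length π↭))) ⟩
        permutationSum (λ π → suc n * g (filter P? π)) (xs ++ ys)
          ≡⟨ permutationSum-* (suc n) (g ∘ filter P?) (xs ++ ys) ⟩
        suc n * permutationSum (g ∘ filter P?) (xs ++ ys)
          ≡⟨ cong (suc n *_) (eq g) ⟩
        suc n * (suc k * permutationSum g ys)
          ≡⟨ *-assoc (suc n) (suc k) _ ⟨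
        suc n * suc k * permutationSum g ys ∎
      where
      open ≡-Reasoning
      n : ℕ
      n = length (xs ++ ys)

    -- A uniform ordering induces a uniform ordering on the elements satisfying `P`. The
    -- multiplicity is nonzero and the same for every `g`, so it cancels when two such sums are
    -- compared.
    permutationSum-filter : ∀ xs →
      ∃[ k ] ∀ g → permutationSum (g ∘ filter P?) xs ≡ suc k * permutationSum g (filter P? xs)
    permutationSum-filter xs
      with k , eq ← permutationSum-rejects (filter (¬? ∘ P?) xs) (filter P? xs)
                      (all-filter (¬? ∘ P?) xs) (all-filter P? xs)
      = k , λ g → trans (permutationSum-↭ (g ∘ filter P?) (filter-split xs)) (eq g)

  combinationSum : ℕ → (List A → ℕ) → List A → ℕ
  combinationSum zero    f xs       = f []
  combinationSum (suc t) f []       = 0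
  combinationSum (suc t) f (x ∷ xs) = combinationSum t (f ∘ (x ∷_)) xs + combinationSum (suc t) f xs

  combinationSum-mono : ∀ {P : Pred A 0ℓ} {f g} t {xs} → All P xs → (∀ c → All P c → f c ≤ g c) →
                        combinationSum t f xs ≤ combinationSum t g xs
  combinationSum-mono zero    Pxs        f≤g = f≤g [] []
  combinationSum-mono (suc t) []         f≤g = z≤n
  combinationSum-mono (suc t) (Px ∷ Pxs) f≤g = +-mono-≤
    (combinationSum-mono t Pxs (λ c Pc → f≤g _ (Px ∷ Pc))) (combinationSum-mono (suc t) Pxs f≤g)

  combinationSum-cong : ∀ {P : Pred A 0ℓ} {f g} t {xs} → All P xs → (∀ c → All P c → f c ≡ g c) →
                        combinationSum t f xs ≡ combinationSum t g xs
  combinationSum-cong t Pxs f≡g = ≤-antisym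
    (combinationSum-mono t Pxs (λ c Pc → ≤-reflexive (f≡g c Pc)))
    (combinationSum-mono t Pxs (λ c Pc → ≤-reflexive (sym (f≡g c Pc))))

  combinationSum-* : ∀ t k f xs → combinationSum t (λ c → k * f c) xs ≡ k * combinationSum t f xs
  combinationSum-* zero    k f xs       = refl
  combinationSum-* (suc t) k f []       = sym (*-zeroʳ k)
  combinationSum-* (suc t) k f (x ∷ xs)
    rewrite combinationSum-* t k (f ∘ (x ∷_)) xs | combinationSum-* (suc t) k f xs = sym (*-distribˡ-+ k _ _)

  combinationSum-+ : ∀ t f g xs → combinationSum t (λ c → f c + g c) xs ≡ combinationSum t f xs + combinationSum t g xs
  combinationSum-+ zero    f g xs       = refl
  combinationSum-+ (suc t) f g []       = refl
  combinationSum-+ (suc t) f g (x ∷ xs)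
    rewrite combinationSum-+ t (f ∘ (x ∷_)) (g ∘ (x ∷_)) xs | combinationSum-+ (suc t) f g xs =
    eq (combinationSum t (f ∘ (x ∷_)) xs) (combinationSum t (g ∘ (x ∷_)) xs) _ _
    where
    eq : ∀ a b c d → a + b + (c + d) ≡ a + c + (b + d)
    eq = solve-∀

  combinationSum-empty : ∀ t f xs → length xs < t → combinationSum t f xs ≡ 0
  combinationSum-empty (suc t) f []       _         = refl
  combinationSum-empty (suc t) f (x ∷ xs) (s≤s n<t) = cong₂ _+_
    (combinationSum-empty t (f ∘ (x ∷_)) xs n<t) (combinationSum-empty (suc t) f xs (≤-trans n<t (n≤1+n t)))

  combinationSum-count : ∀ t xs → combinationSum t (λ _ → 1) xs ≡ length xs C t
  combinationSum-count zero    xs       = refl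
  combinationSum-count (suc t) []       = sym (k>n⇒nCk≡0 {0} {suc t} (s≤s z≤n))
  combinationSum-count (suc t) (x ∷ xs) = trans
    (cong₂ _+_ (combinationSum-count t xs) (combinationSum-count (suc t) xs))
    (nCk+nC[k+1]≡[n+1]C[k+1] (length xs) t)

  Symmetric : (List A → ℕ) → Set
  Symmetric g = ∀ {xs ys} → xs ↭ ys → g xs ≡ g ys

  -- Of the `t + d + 1` positions for `x`, the first `t + 1` put it into the prefix and push out the
  -- last element there; the other `d` leave the prefix as it was.
  insertionSum-take : ∀ {g} → Symmetric g → ∀ x π t d → length π ≡ t + d →
    insertionSum x (g ∘ take (suc t)) π ≡ suc t * g (x ∷ take t π) + d * g (take (suc t) π)
  insertionSum-take sy x []      zero zero eq = sym (trans (+-identityʳ _) (+-identityʳ _))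
  insertionSum-take {g} sy x (y ∷ π) zero (suc d) eq = cong₂ _+_ (sym (+-identityʳ _))
    (trans (insertionSum-const x (g (y ∷ [])) π) (cong (_* g (y ∷ [])) eq))
  insertionSum-take {g} sy x (y ∷ π) (suc t) d eq = begin
    g (x ∷ y ∷ take t π) + insertionSum x (g ∘ (y ∷_) ∘ take (suc t)) π
      ≡⟨ cong (g (x ∷ y ∷ take t π) +_) (insertionSum-take (sy ∘ Perm.prep y) x π t d (suc-injective eq)) ⟩
    g (x ∷ y ∷ take t π) + (suc t * g (y ∷ x ∷ take t π) + d * g (y ∷ take (suc t) π))
      ≡⟨ cong (λ u → g (x ∷ y ∷ take t π) + (suc t * u + d * g (y ∷ take (suc t) π))) (sy (Perm.swap y x Perm.refl)) ⟩
    g (x ∷ y ∷ take t π) + (suc t * g (x ∷ y ∷ take t π) + d * g (y ∷ take (suc t) π))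
      ≡⟨ +-assoc (g (x ∷ y ∷ take t π)) _ _ ⟨
    suc (suc t) * g (x ∷ y ∷ take t π) + d * g (y ∷ take (suc t) π) ∎
    where open ≡-Reasoning

  -- Each sublist of length `t` forms the initial segment, in some order, of `t ! * d !` orderings.
  permutationSum-take : ∀ {g} → Symmetric g → ∀ xs t d → length xs ≡ t + d →
    permutationSum (g ∘ take t) xs ≡ t ! * d ! * combinationSum t g xs
  permutationSum-take {g} sy xs zero d eq = trans (permutationSum-const (g []) xs)
    (cong (λ n → n * g []) (trans (cong _! eq) (sym (+-identityʳ (d !)))))
  permutationSum-take {g} sy (x ∷ xs) (suc t) d eq = begin
    permutationSum (insertionSum x (g ∘ take (suc t))) xs
      ≡⟨ permutationSum-cong xs (λ π π↭ → insertionSum-take sy x π t d (trans (↭-length π↭) (suc-injective eq))) ⟩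
    permutationSum (λ π → suc t * g (x ∷ take t π) + d * g (take (suc t) π)) xs
      ≡⟨ permutationSum-linear (suc t) (g ∘ (x ∷_) ∘ take t) d (g ∘ take (suc t)) xs ⟩
    suc t * permutationSum (g ∘ (x ∷_) ∘ take t) xs + d * permutationSum (g ∘ take (suc t)) xs
      ≡⟨ cong₂ _+_ (cong (suc t *_) (permutationSum-take (sy ∘ Perm.prep x) xs t d (suc-injective eq)))
                   (without d (suc-injective eq)) ⟩
    suc t * (t ! * d ! * combinationSum t (g ∘ (x ∷_)) xs) + suc t ! * d ! * combinationSum (suc t) g xs
      ≡⟨ collect (suc t) (t !) (d !) _ _ ⟩
    suc t ! * d ! * (combinationSum t (g ∘ (x ∷_)) xs + combinationSum (suc t) g xs) ∎
    where
    open ≡-Reasoning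
    collect : ∀ s a b u w → s * (a * b * u) + (s * a) * b * w ≡ (s * a) * b * (u + w)
    collect = solve-∀
    permute : ∀ s a b u → s * (a * b * u) ≡ a * (s * b) * u
    permute = solve-∀
    without : ∀ d → length xs ≡ t + d →
      d * permutationSum (g ∘ take (suc t)) xs ≡ suc t ! * d ! * combinationSum (suc t) g xs
    -- With `d = 0` the list has only `t` elements, so both sides vanish.
    without zero    len = sym (trans
      (cong (suc t ! * 1 *_) (combinationSum-empty (suc t) g xs (s≤s (≤-reflexive (trans len (+-identityʳ t))))))
      (*-zeroʳ (suc t ! * 1)))
    without (suc d) len = trans
      (cong (suc d *_) (permutationSum-take sy xs (suc t) d (trans len (+-suc t d))))
      (permute (suc d) (suc t !) (d !) _)

  factorial-C : ∀ xs t d → length xs ≡ t + d → length xs ! ≡ t ! * d ! * (length xs C t)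
  factorial-C xs t d eq = begin
    length xs !                       ≡⟨ *-identityʳ _ ⟨
    length xs ! * 1                   ≡⟨ permutationSum-const 1 xs ⟨
    permutationSum (λ _ → 1) xs       ≡⟨ permutationSum-take {λ _ → 1} (λ _ → refl) xs t d eq ⟩
    t ! * d ! * combinationSum t (λ _ → 1) xs ≡⟨ cong (t ! * d ! *_) (combinationSum-count t xs) ⟩
    t ! * d ! * (length xs C t)       ∎
    where open ≡-Reasoning

  take-extends : ∀ t s (π : List A) → ∃[ ρ ] take (t + s) π ≡ take t π ++ ρ
  take-extends zero    s π       = take s π , refl
  take-extends (suc t) s []      = [] , refl
  take-extends (suc t) s (x ∷ π) with ρ , eq ← take-extends t s π = ρ , cong (x ∷_) eq

  -- A coupling: both prefixes are cut from the same random ordering and the longer extends the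
  -- shorter, so the mean of an antitone `g` can only drop.
  combinationSum-half : ∀ {g} → Symmetric g → (∀ xs ys → g (xs ++ ys) ≤ g xs) →
    ∀ xs t s → 2 * combinationSum t g xs ≤ length xs C t →
    2 * combinationSum (t + s) g xs ≤ length xs C (t + s)
  combinationSum-half {g} sy anti xs t s half with t + s ≤? length xs
  ... | no t+s≰n = subst (λ x → 2 * x ≤ length xs C (t + s))
                     (sym (combinationSum-empty (t + s) g xs (≰⇒> t+s≰n))) z≤n
  ... | yes t+s≤n = *-cancelˡ-≤ ((t + s) ! * d !) {{(t + s) !* d !≢0}} (begin
    (t + s) ! * d ! * (2 * combinationSum (t + s) g xs)
      ≡⟨ permute ((t + s) ! * d !) (combinationSum (t + s) g xs) ⟩
    2 * ((t + s) ! * d ! * combinationSum (t + s) g xs)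
      ≡⟨ cong (2 *_) (permutationSum-take sy xs (t + s) d n≡) ⟨
    2 * permutationSum (g ∘ take (t + s)) xs
      ≤⟨ *-monoʳ-≤ 2 (permutationSum-mono xs (λ π _ → shorter π)) ⟩
    2 * permutationSum (g ∘ take t) xs
      ≡⟨ cong (2 *_) (permutationSum-take sy xs t (s + d) n≡′) ⟩
    2 * (t ! * (s + d) ! * combinationSum t g xs)
      ≡⟨ permute (t ! * (s + d) !) (combinationSum t g xs) ⟨
    t ! * (s + d) ! * (2 * combinationSum t g xs)
      ≤⟨ *-monoʳ-≤ (t ! * (s + d) !) half ⟩
    t ! * (s + d) ! * (length xs C t)
      ≡⟨ factorial-C xs t (s + d) n≡′ ⟨
    length xs !
      ≡⟨ factorial-C xs (t + s) d n≡ ⟩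
    (t + s) ! * d ! * (length xs C (t + s)) ∎)
    where
    open ≤-Reasoning
    d : ℕ
    d = length xs ∸ (t + s)
    n≡ : length xs ≡ t + s + d
    n≡ = sym (m+[n∸m]≡n t+s≤n)
    n≡′ : length xs ≡ t + (s + d)
    n≡′ = trans n≡ (+-assoc t s d)
    permute : ∀ k u → k * (2 * u) ≡ 2 * (k * u)
    permute = solve-∀
    shorter : ∀ π → g (take (t + s) π) ≤ g (take t π)
    shorter π with ρ , eq ← take-extends t s π = subst (λ z → g z ≤ g (take t π)) (sym eq) (anti _ ρ)

  -- Vandermonde's convolution for sums: terms are sorted by the number of elements taken from `xs`.
  combinationSum-++ : ∀ t G xs ys → combinationSum t G (xs ++ ys) ≡
    antidiagonal (λ a b → combinationSum a (λ c → combinationSum b (λ d → G (c ++ d)) ys) xs) 0 t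
  combinationSum-++ zero    G xs ys = refl
  combinationSum-++ (suc t) G [] ys = sym (trans
    (cong (combinationSum (suc t) G ys +_) (antidiagonal-0 1 t (λ _ _ → refl)))
    (+-identityʳ _))
  combinationSum-++ (suc t) G (x ∷ xs) ys = begin
    combinationSum t (G ∘ (x ∷_)) (xs ++ ys) + combinationSum (suc t) G (xs ++ ys)
      ≡⟨ cong₂ _+_ (combinationSum-++ t (G ∘ (x ∷_)) xs ys) (combinationSum-++ (suc t) G xs ys) ⟩
    antidiagonal with-x 0 t + (without-x 0 (suc t) + antidiagonal without-x 1 t)
      ≡⟨ permute (antidiagonal with-x 0 t) (without-x 0 (suc t)) _ ⟩
    without-x 0 (suc t) + (antidiagonal with-x 0 t + antidiagonal without-x 1 t)
      ≡⟨ cong (λ s → without-x 0 (suc t) + (antidiagonal with-x 0 t + s)) (antidiagonal-shift without-x 0 t) ⟩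
    without-x 0 (suc t) + (antidiagonal with-x 0 t + antidiagonal (without-x ∘ suc) 0 t)
      ≡⟨ cong (without-x 0 (suc t) +_) (antidiagonal-+ with-x (without-x ∘ suc) 0 t) ⟨
    without-x 0 (suc t) + antidiagonal (both ∘ suc) 0 t
      ≡⟨ cong (without-x 0 (suc t) +_) (antidiagonal-shift both 0 t) ⟨
    antidiagonal both 0 (suc t) ∎
    where
    open ≡-Reasoning
    with-x without-x both : ℕ → ℕ → ℕ
    with-x a b = combinationSum a (λ c → combinationSum b (λ d → G (x ∷ c ++ d)) ys) xs
    without-x a b = combinationSum a (λ c → combinationSum b (λ d → G (c ++ d)) ys) xs
    both a b = combinationSum a (λ c → combinationSum b (λ d → G (c ++ d)) ys) (x ∷ xs)
    permute : ∀ a b c → a + (b + c) ≡ b + (a + c)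
    permute = solve-∀

  combinationSum-product : ∀ t G u w {P Q : Pred A 0ℓ} {xs ys} → All P xs → All Q ys →
    (∀ c d → All P c → All Q d → G (c ++ d) ≡ u c * w d) →
    combinationSum t G (xs ++ ys) ≡
    antidiagonal (λ a b → combinationSum a u xs * combinationSum b w ys) 0 t
  combinationSum-product t G u w {xs = xs} {ys} Pxs Qys G≡ = trans (combinationSum-++ t G xs ys)
    (antidiagonal-cong 0 t (λ a b → begin
      combinationSum a (λ c → combinationSum b (λ d → G (c ++ d)) ys) xs
        ≡⟨ combinationSum-cong a Pxs (λ c Pc → trans
             (combinationSum-cong b Qys (λ d Qd → G≡ c d Pc Qd))
             (trans (combinationSum-* b (u c) w ys) (*-comm (u c) _))) ⟩
      combinationSum a (λ c → combinationSum b w ys * u c) xs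
        ≡⟨ combinationSum-* a (combinationSum b w ys) u xs ⟩
      combinationSum b w ys * combinationSum a u xs
        ≡⟨ *-comm (combinationSum b w ys) _ ⟩
      combinationSum a u xs * combinationSum b w ys ∎))
    where open ≡-Reasoning

-- From the rarity of a bad event to a gap between the two rates.

module _ {A : Set} {F P Q : Pred A 0ℓ} (F? : Decidable F) (xs as bs : List A)
  (as++bs↭ : as ++ bs ↭ filter F? xs) (Pas : All P as) (Qbs : All Q bs)
  (G bad u w : List A → ℕ) (G-symmetric : Symmetric G)
  (G-product : ∀ c d → All P c → All Q d → G (c ++ d) ≡ u c * w d)
  (a b : ℕ)
  (G≤bad : ∀ π → π ↭ xs → G (take (a + suc b) (filter F? π)) ≤ bad π)
  (u-large : ∀ k → k ≤ a → length as C k ≤ 2 * combinationSum k u as)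
  (w-large : ∀ k → length bs C (suc b + k) ≤ 2 * combinationSum (suc b + k) w bs)
  where

  private
    p₁ p₂ t : ℕ
    p₁ = length as
    p₂ = length bs
    t = a + suc b

    h : ℕ → ℕ → ℕ
    h i j = combinationSum i u as * combinationSum j w bs

    lower : ℕ
    lower = antidiagonal (flip h) (suc b) a

  -- In the lower part at most `a` elements come from `as` and at least `suc b` from `bs`, where `u`
  -- and `w` each have mean at least 1/2; hence the factor 4.
  hyper-lower≤ : antidiagonal (flip (hyper p₁ p₂)) (suc b) a ≤ 4 * lower
  hyper-lower≤ = antidiagonal-scale 4 (suc b) a (λ i j eq → begin
    (p₁ C j) * (p₂ C (suc b + i))
      ≤⟨ *-mono-≤ (u-large j (subst (j ≤_) eq (m≤n+m j i))) (w-large i) ⟩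
    2 * combinationSum j u as * (2 * combinationSum (suc b + i) w bs)
      ≡⟨ collect (combinationSum j u as) _ ⟩
    4 * h j (suc b + i) ∎)
    where
    open ≤-Reasoning
    collect : ∀ x y → 2 * x * (2 * y) ≡ 4 * (x * y)
    collect = solve-∀

  lower≤ : lower ≤ combinationSum t G (as ++ bs)
  lower≤ = begin
    lower                                             ≤⟨ m≤n+m lower _ ⟩
    antidiagonal h (suc a) b + lower                  ≡⟨ antidiagonal-split h a b ⟨
    antidiagonal h 0 t                                ≡⟨ combinationSum-product t G u w Pas Qbs G-product ⟨
    combinationSum t G (as ++ bs)                     ∎
    where open ≤-Reasoning

  vandermonde : length (as ++ bs) C t ≡ antidiagonal (hyper p₁ p₂) 0 t
  vandermonde = begin
    length (as ++ bs) C t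
      ≡⟨ combinationSum-count t (as ++ bs) ⟨
    combinationSum t (λ _ → 1) (as ++ bs)
      ≡⟨ combinationSum-product t (λ _ → 1) (λ _ → 1) (λ _ → 1) Pas Qbs (λ _ _ _ _ → refl) ⟩
    antidiagonal (λ i j → combinationSum i (λ _ → 1) as * combinationSum j (λ _ → 1) bs) 0 t
      ≡⟨ antidiagonal-cong 0 t (λ i j → cong₂ _*_ (combinationSum-count i as) (combinationSum-count j bs)) ⟩
    antidiagonal (hyper p₁ p₂) 0 t ∎
    where open ≡-Reasoning

  -- In a random ordering of `xs`, the first `t` elements satisfying `F` form a uniform `t`-subset
  -- of `as ++ bs`. `G` of that subset is at most `bad`, so the rarity carries over.
  combination-rare : ∀ c → t ≤ p₁ + p₂ → c * permutationSum bad xs ≤ length xs ! →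
    c * combinationSum t G (as ++ bs) ≤ length (as ++ bs) C t
  combination-rare c t≤ rare with k , restrict ← permutationSum-filter F? xs =
    *-cancelˡ-≤ (t ! * d !) {{t !* d !≢0}} (*-cancelˡ-≤ (suc k) (begin
      suc k * (t ! * d ! * (c * S))
        ≡⟨ permute (suc k) (t ! * d !) c S ⟩
      c * (suc k * (t ! * d ! * S))
        ≡⟨ cong (λ z → c * (suc k * z)) (permutationSum-take G-symmetric (as ++ bs) t d n≡) ⟨
      c * (suc k * permutationSum (G ∘ take t) (as ++ bs))
        ≡⟨ cong (λ z → c * (suc k * z)) (permutationSum-↭ (G ∘ take t) as++bs↭) ⟩
      c * (suc k * permutationSum (G ∘ take t) (filter F? xs))
        ≡⟨ cong (c *_) (restrict (G ∘ take t)) ⟨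
      c * permutationSum (G ∘ take t ∘ filter F?) xs
        ≤⟨ *-monoʳ-≤ c (permutationSum-mono xs G≤bad) ⟩
      c * permutationSum bad xs
        ≤⟨ rare ⟩
      length xs !
        ≡⟨ trans (permutationSum-const 1 xs) (*-identityʳ _) ⟨
      permutationSum (λ _ → 1) xs
        ≡⟨ restrict (λ _ → 1) ⟩
      suc k * permutationSum (λ _ → 1) (filter F? xs)
        ≡⟨ cong (suc k *_) (permutationSum-↭ (λ _ → 1) as++bs↭) ⟨
      suc k * permutationSum (λ _ → 1) (as ++ bs)
        ≡⟨ cong (suc k *_) (trans (permutationSum-const 1 (as ++ bs)) (*-identityʳ _)) ⟩
      suc k * length (as ++ bs) !
        ≡⟨ cong (suc k *_) (factorial-C (as ++ bs) t d n≡) ⟩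
      suc k * (t ! * d ! * (length (as ++ bs) C t)) ∎))
    where
    open ≤-Reasoning
    d S : ℕ
    d = length (as ++ bs) ∸ t
    S = combinationSum t G (as ++ bs)
    n≡ : length (as ++ bs) ≡ t + d
    n≡ = sym (m+[n∸m]≡n (subst (t ≤_) (sym (length-++ as)) t≤))
    permute : ∀ k f c s → k * (f * (c * s)) ≡ c * (k * (f * s))
    permute = solve-∀

  -- 5220 = 4 · 1305: each of the two conditional probabilities is at least 1/2.
  rare-gap : ∀ {α β p′ q′} → α ≡ suc a → β ≡ suc b → length as ≡ p′ → length bs ≡ q′ →
    ∀ c v → 5220 < c → c * permutationSum bad xs ≤ length xs ! →
    1 ≤ v → v ≡ 1 ⊎ 40 * (v * v) ≤ α → α ≤ 160 * (v * v) →
    2 * α ≤ p′ → 2 * β ≤ q′ → p′ ≤ 2 * q′ → q′ ≤ 2 * p′ →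
    (α + v) * q′ ≤ p′ * β
  rare-gap refl refl refl refl c v 5220<c rare 1≤v v-or A≤ 2A≤p 2B≤q p≤2q q≤2p with (suc a + v) * p₂ ≤? p₁ * suc b
  ... | yes gap = gap
  -- Without the gap, rarity and anticoncentration squeeze `c * lower` below `5220 * lower`, and
  -- `lower` is positive.
  ... | no ¬gap = contradiction 5220<c (≤⇒≯ (*-cancelʳ-≤ c 5220 lower {{>-nonZero lower>0}} (begin
    c * lower
      ≤⟨ *-monoʳ-≤ c lower≤ ⟩
    c * combinationSum t G (as ++ bs)
      ≤⟨ combination-rare c t≤ rare ⟩
    length (as ++ bs) C t
      ≡⟨ vandermonde ⟩
    antidiagonal (hyper p₁ p₂) 0 t
      ≤⟨ anticoncentration ⟩
    1305 * antidiagonal (flip (hyper p₁ p₂)) (suc b) a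
      ≤⟨ *-monoʳ-≤ 1305 hyper-lower≤ ⟩
    1305 * (4 * lower)
      ≡⟨ *-assoc 1305 4 lower ⟨
    5220 * lower ∎)))
    where
    open ≤-Reasoning
    open Anticoncentration p₁ p₂ a b v 1≤v v-or A≤ 2A≤p 2B≤q p≤2q q≤2p (<⇒≤ (≰⇒> ¬gap))
    lower>0 : 0 < lower
    lower>0 = *-cancelˡ-< 4 0 lower (≤-trans lower-positive hyper-lower≤)
    t≤ : t ≤ p₁ + p₂
    t≤ = +-mono-≤ (≤-trans (n≤1+n a) (≤-trans (m≤n*m (suc a) 2) 2A≤p)) (≤-trans (m≤n*m (suc b) 2) 2B≤q)

-- The enumerations in the definitions rewritten as sums.

indicator : {P : Set} → Dec P → ℕ
indicator P? = if does P? then 1 else 0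

indicator-yes : {P : Set} (P? : Dec P) → P → indicator P? ≡ 1
indicator-yes (yes _) _ = refl
indicator-yes (no ¬p) p = contradiction p ¬p

indicator-no : {P : Set} (P? : Dec P) → ¬ P → indicator P? ≡ 0
indicator-no (yes p) ¬p = contradiction p ¬p
indicator-no (no _)  _  = refl

indicator-mono : {P Q : Set} (P? : Dec P) (Q? : Dec Q) → (P → Q) → indicator P? ≤ indicator Q?
indicator-mono (no _)  Q? f = z≤n
indicator-mono (yes p) Q? f = ≤-reflexive (sym (indicator-yes Q? (f p)))

indicator-¬ : {P : Set} (P? : Dec P) → indicator P? + indicator (¬? P?) ≡ 1
indicator-¬ (yes _) = refl
indicator-¬ (no  _) = refl

length-filter-indicator : {A : Set} {P : Pred A 0ℓ} (P? : Decidable P) (xs : List A) →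
  length (filter P? xs) ≡ sum (map (indicator ∘ P?) xs)
length-filter-indicator P? []       = refl
length-filter-indicator P? (x ∷ xs) with does (P? x)
... | true  = cong suc (length-filter-indicator P? xs)
... | false = length-filter-indicator P? xs

length-sum : {A : Set} (xs : List A) → length xs ≡ sum (map (λ _ → 1) xs)
length-sum []       = refl
length-sum (x ∷ xs) = cong suc (length-sum xs)

sum-insertions : {A : Set} (f : List A → ℕ) (x : A) (π : List A) → sum (map f (insertions x π)) ≡ insertionSum x f π
sum-insertions f x []      = +-identityʳ _
sum-insertions f x (y ∷ π) = cong (f (x ∷ y ∷ π) +_)
  (trans (cong sum (sym (map-∘ (insertions x π)))) (sum-insertions (f ∘ (y ∷_)) x π))

sum-permutations : {A : Set} (f : List A → ℕ) (xs : List A) → sum (map f (permutations xs)) ≡ permutationSum f xs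
sum-permutations f []       = +-identityʳ _
sum-permutations f (x ∷ xs) = trans (sum-concatMap (permutations xs)) (sum-permutations (insertionSum x f) xs)
  where
  sum-concatMap : ∀ πs → sum (map f (concatMap (insertions x) πs)) ≡ sum (map (insertionSum x f) πs)
  sum-concatMap []       = refl
  sum-concatMap (π ∷ πs) = begin
    sum (map f (insertions x π ++ concatMap (insertions x) πs))
      ≡⟨ cong sum (map-++ f (insertions x π) _) ⟩
    sum (map f (insertions x π) ++ map f (concatMap (insertions x) πs))
      ≡⟨ sum-++ (map f (insertions x π)) _ ⟩
    sum (map f (insertions x π)) + sum (map f (concatMap (insertions x) πs))
      ≡⟨ cong₂ _+_ (sum-insertions f x π) (sum-concatMap πs) ⟩
    insertionSum x f π + sum (map (insertionSum x f) πs) ∎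
    where open ≡-Reasoning

-- Only the Boolean answers are compared, so that the conditions on bit vectors below mostly hold by
-- computation.
filter-map-does : {A B : Set} {P : Pred B 0ℓ} {Q : Pred A 0ℓ} (P? : Decidable P) (Q? : Decidable Q) (f : A → B) →
  (∀ x → does (P? (f x)) ≡ does (Q? x)) → ∀ xs → filter P? (map f xs) ≡ map f (filter Q? xs)
filter-map-does P? Q? f eq []       = refl
filter-map-does P? Q? f eq (x ∷ xs) with does (P? (f x)) | does (Q? x) | eq x
... | true  | true  | refl = cong (f x ∷_) (filter-map-does P? Q? f eq xs)
... | false | false | refl = filter-map-does P? Q? f eq xs

filter-false : {A : Set} {P : Pred A 0ℓ} (P? : Decidable P) → (∀ x → does (P? x) ≡ false) → ∀ xs → filter P? xs ≡ []
filter-false P? eq []       = refl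
filter-false P? eq (x ∷ xs) with does (P? x) | eq x
... | false | refl = filter-false P? eq xs

filter-≗∘ : {A : Set} {P Q R : Pred A 0ℓ} (P? : Decidable P) (Q? : Decidable Q) (R? : Decidable R) →
  (∀ x → R x → P x × Q x) → (∀ x → P x → Q x → R x) → ∀ xs → filter P? (filter Q? xs) ≡ filter R? xs
filter-≗∘ P? Q? R? to from []       = refl
filter-≗∘ P? Q? R? to from (x ∷ xs) with ih ← filter-≗∘ P? Q? R? to from xs | Q? x
... | no ¬q = trans ih (sym (filter-reject R? (¬q ∘ proj₂ ∘ to x)))
... | yes q with P? x
...   | yes p = trans (cong (x ∷_) ih) (sym (filter-accept R? (from x p q)))
...   | no ¬p = trans ih (sym (filter-reject R? (¬p ∘ proj₁ ∘ to x)))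

subsets-outside : ∀ l (S : Subset N) → subsetsOfSize l (outside ∷ S) ≡ map (outside ∷_) (subsetsOfSize l S)
subsets-outside l S = trans (filter-++ _ (map (inside ∷_) (allSubsets _)) _) (cong₂ _++_
  -- No vector starting with `inside` lies in `outside ∷ S`: the test computes to `false`, like the
  -- constant decision put in its place.
  (trans (filter-map-does _ (λ _ → no (λ ())) (inside ∷_) (λ _ → refl) (allSubsets _))
    (cong (map (inside ∷_)) (filter-false {P = λ _ → Empty.⊥} (λ _ → no (λ ())) (λ _ → refl) (allSubsets _))))
  (filter-map-does _ (λ X → (X ⊆? S) ×-dec (∣ X ∣ ≟ l)) (outside ∷_) (λ _ → refl) (allSubsets _)))

subsets-inside-zero : ∀ (S : Subset N) → subsetsOfSize 0 (inside ∷ S) ≡ map (outside ∷_) (subsetsOfSize 0 S)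
subsets-inside-zero S = trans (filter-++ _ (map (inside ∷_) (allSubsets _)) _) (cong₂ _++_
  (trans (filter-map-does _ (λ _ → no (λ ())) (inside ∷_) (λ X → ∧-zeroʳ (does (X ⊆? S))) (allSubsets _))
    (cong (map (inside ∷_)) (filter-false {P = λ _ → Empty.⊥} (λ _ → no (λ ())) (λ _ → refl) (allSubsets _))))
  (filter-map-does _ (λ X → (X ⊆? S) ×-dec (∣ X ∣ ≟ 0)) (outside ∷_) (λ _ → refl) (allSubsets _)))

subsets-inside-suc : ∀ l (S : Subset N) → subsetsOfSize (suc l) (inside ∷ S) ≡
  map (inside ∷_) (subsetsOfSize l S) ++ map (outside ∷_) (subsetsOfSize (suc l) S)
subsets-inside-suc l S = trans (filter-++ _ (map (inside ∷_) (allSubsets _)) _) (cong₂ _++_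
  (filter-map-does _ (λ X → (X ⊆? S) ×-dec (∣ X ∣ ≟ l)) (inside ∷_) (λ _ → refl) (allSubsets _))
  (filter-map-does _ (λ X → (X ⊆? S) ×-dec (∣ X ∣ ≟ suc l)) (outside ∷_) (λ _ → refl) (allSubsets _)))

allFin-suc : ∀ n → allFin (suc n) ≡ zero ∷ map suc (allFin n)
allFin-suc n = cong (zero ∷_) (sym (map-tabulate (λ x → x) suc))

elements-outside : ∀ (S : Subset N) → elements (outside ∷ S) ≡ map suc (elements S)
elements-outside {N} S = trans (cong (filter (_∈? outside ∷ S)) (allFin-suc N))
  (filter-map-does (_∈? outside ∷ S) (_∈? S) suc (λ _ → refl) (allFin N))

elements-inside : ∀ (S : Subset N) → elements (inside ∷ S) ≡ zero ∷ map suc (elements S)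
elements-inside {N} S = trans (cong (filter (_∈? inside ∷ S)) (allFin-suc N))
  (cong (zero ∷_) (filter-map-does (_∈? inside ∷ S) (_∈? S) suc (λ _ → refl) (allFin N)))

length-elements : ∀ (S : Subset N) → length (elements S) ≡ ∣ S ∣
length-elements []            = refl
length-elements (outside ∷ S) = trans (cong length (elements-outside S)) (trans (length-map suc (elements S)) (length-elements S))
length-elements (inside ∷ S)  = trans (cong length (elements-inside S)) (cong suc (trans (length-map suc (elements S)) (length-elements S)))

fromList-suc : ∀ (c : List (Fin N)) → fromList (map suc c) ≡ outside ∷ fromList c
fromList-suc []      = refl
fromList-suc (x ∷ c) = cong ((outside ∷ ⁅ x ⁆) ∪_) (fromList-suc c)

fromList-zero : ∀ (c : List (Fin N)) → fromList (zero ∷ map suc c) ≡ inside ∷ fromList c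
fromList-zero c = trans (cong (⁅ zero ⁆ ∪_) (fromList-suc c)) (cong (inside ∷_) (∪-identityˡ (fromList c)))

combinationSum-map : {A B : Set} (f : A → B) → ∀ l (g : List B → ℕ) xs →
  combinationSum l g (map f xs) ≡ combinationSum l (g ∘ map f) xs
combinationSum-map f zero    g xs       = refl
combinationSum-map f (suc l) g []       = refl
combinationSum-map f (suc l) g (x ∷ xs) = cong₂ _+_ (combinationSum-map f l (g ∘ (f x ∷_)) xs) (combinationSum-map f (suc l) g xs)

combinationSum-≗ : {A : Set} {f g : List A → ℕ} → (∀ c → f c ≡ g c) → ∀ l xs → combinationSum l f xs ≡ combinationSum l g xs
combinationSum-≗ eq zero    xs       = eq []
combinationSum-≗ eq (suc l) []       = refl
combinationSum-≗ eq (suc l) (x ∷ xs) = cong₂ _+_ (combinationSum-≗ (λ c → eq (x ∷ c)) l xs) (combinationSum-≗ eq (suc l) xs)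

-- The bridge from subsets as bit vectors, in which `α` is defined, to sublists of `elements S`, in
-- which sums are split and permuted. Both sides branch on whether the first element is taken.
sum-subsets : ∀ (S : Subset N) l (g : Subset N → ℕ) →
  sum (map g (subsetsOfSize l S)) ≡ combinationSum l (g ∘ fromList) (elements S)
sum-subsets [] zero    g = +-identityʳ _
sum-subsets [] (suc l) g = refl
sum-subsets (outside ∷ S) l g = begin
  sum (map g (subsetsOfSize l (outside ∷ S)))              ≡⟨ cong (sum ∘ map g) (subsets-outside l S) ⟩
  sum (map g (map (outside ∷_) (subsetsOfSize l S)))       ≡⟨ cong sum (map-∘ (subsetsOfSize l S)) ⟨
  sum (map (g ∘ (outside ∷_)) (subsetsOfSize l S))         ≡⟨ sum-subsets S l (g ∘ (outside ∷_)) ⟩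
  combinationSum l (g ∘ (outside ∷_) ∘ fromList) (elements S)
    ≡⟨ combinationSum-≗ (λ c → cong g (fromList-suc c)) l (elements S) ⟨
  combinationSum l (g ∘ fromList ∘ map suc) (elements S)   ≡⟨ combinationSum-map suc l (g ∘ fromList) (elements S) ⟨
  combinationSum l (g ∘ fromList) (map suc (elements S))   ≡⟨ cong (combinationSum l (g ∘ fromList)) (elements-outside S) ⟨
  combinationSum l (g ∘ fromList) (elements (outside ∷ S)) ∎
  where open ≡-Reasoning
sum-subsets (inside ∷ S) zero g = begin
  sum (map g (subsetsOfSize 0 (inside ∷ S)))               ≡⟨ cong (sum ∘ map g) (subsets-inside-zero S) ⟩
  sum (map g (map (outside ∷_) (subsetsOfSize 0 S)))       ≡⟨ cong sum (map-∘ (subsetsOfSize 0 S)) ⟨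
  sum (map (g ∘ (outside ∷_)) (subsetsOfSize 0 S))         ≡⟨ sum-subsets S 0 (g ∘ (outside ∷_)) ⟩
  g ⊥                                                      ∎
  where open ≡-Reasoning
sum-subsets (inside ∷ S) (suc l) g = begin
  sum (map g (subsetsOfSize (suc l) (inside ∷ S)))
    ≡⟨ cong (sum ∘ map g) (subsets-inside-suc l S) ⟩
  sum (map g (map (inside ∷_) (subsetsOfSize l S) ++ map (outside ∷_) (subsetsOfSize (suc l) S)))
    ≡⟨ cong sum (map-++ g (map (inside ∷_) (subsetsOfSize l S)) _) ⟩
  sum (map g (map (inside ∷_) (subsetsOfSize l S)) ++ map g (map (outside ∷_) (subsetsOfSize (suc l) S)))
    ≡⟨ sum-++ (map g (map (inside ∷_) (subsetsOfSize l S))) _ ⟩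
  sum (map g (map (inside ∷_) (subsetsOfSize l S))) + sum (map g (map (outside ∷_) (subsetsOfSize (suc l) S)))
    ≡⟨ cong₂ (λ x y → sum x + sum y) (sym (map-∘ (subsetsOfSize l S))) (sym (map-∘ (subsetsOfSize (suc l) S))) ⟩
  sum (map (g ∘ (inside ∷_)) (subsetsOfSize l S)) + sum (map (g ∘ (outside ∷_)) (subsetsOfSize (suc l) S))
    ≡⟨ cong₂ _+_ (sum-subsets S l (g ∘ (inside ∷_))) (sum-subsets S (suc l) (g ∘ (outside ∷_))) ⟩
  combinationSum l (g ∘ (inside ∷_) ∘ fromList) (elements S) + combinationSum (suc l) (g ∘ (outside ∷_) ∘ fromList) (elements S)
    ≡⟨ cong₂ _+_ (combinationSum-≗ (λ c → cong g (fromList-zero c)) l (elements S))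
                 (combinationSum-≗ (λ c → cong g (fromList-suc c)) (suc l) (elements S)) ⟨
  combinationSum l (g ∘ fromList ∘ (zero ∷_) ∘ map suc) (elements S) + combinationSum (suc l) (g ∘ fromList ∘ map suc) (elements S)
    ≡⟨ cong₂ _+_ (combinationSum-map suc l (g ∘ fromList ∘ (zero ∷_)) (elements S)) (combinationSum-map suc (suc l) (g ∘ fromList) (elements S)) ⟨
  combinationSum (suc l) (g ∘ fromList) (zero ∷ map suc (elements S))
    ≡⟨ cong (combinationSum (suc l) (g ∘ fromList)) (elements-inside S) ⟨
  combinationSum (suc l) (g ∘ fromList) (elements (inside ∷ S)) ∎
  where open ≡-Reasoning

∈-fromList⁺ : ∀ {x : Fin N} {xs} → x ∈ₗ xs → x ∈ fromList xs
∈-fromList⁺ {x = x} (here refl) = x∈p∪q⁺ (inj₁ (x∈⁅x⁆ x))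
∈-fromList⁺ (there x∈)  = x∈p∪q⁺ (inj₂ (∈-fromList⁺ x∈))

∈-fromList⁻ : ∀ {x : Fin N} xs → x ∈ fromList xs → x ∈ₗ xs
∈-fromList⁻ []       x∈ = contradiction x∈ ∉⊥
∈-fromList⁻ (y ∷ ys) x∈ with x∈p∪q⁻ ⁅ y ⁆ (fromList ys) x∈
... | inj₁ x∈y = here (x∈⁅y⁆⇒x≡y y x∈y)
... | inj₂ x∈ys = there (∈-fromList⁻ ys x∈ys)

fromList-mono : ∀ {xs ys : List (Fin N)} → (∀ {x} → x ∈ₗ xs → x ∈ₗ ys) → fromList xs ⊆ fromList ys
fromList-mono {xs = xs} le x∈ = ∈-fromList⁺ (le (∈-fromList⁻ xs x∈))

fromList-↭ : ∀ {xs ys : List (Fin N)} → xs ↭ ys → fromList xs ≡ fromList ys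
fromList-↭ p = ⊆-antisym (fromList-mono (∈-resp-↭ p)) (fromList-mono (∈-resp-↭ (↭-sym p)))

∈-elements⁻ : ∀ {x : Fin N} {S} → x ∈ₗ elements S → x ∈ S
∈-elements⁻ {N} {S = S} x∈ = proj₂ (∈-filter⁻ (_∈? S) {xs = allFin N} x∈)

-- What the definition of `α` gives below and above its value.

module _ {A : Set} {P : Pred A 0ℓ} (P? : Decidable P) where

  proportion≤½ : ∀ xs → proportion P? xs ℚ.≤ ½ → 2 * length (filter P? xs) ≤ length xs
  proportion≤½ []       _           = z≤n
  proportion≤½ (x ∷ xs) (ℚ.*≤* le) = subst₂ _≤_ (*-comm (length (filter P? (x ∷ xs))) 2) (*-identityˡ (suc (length xs))) (ℤ.drop‿+≤+ (subst₂ ℤ._≤_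
    (sym (ℤ.pos-* (length (filter P? (x ∷ xs))) 2)) (sym (ℤ.pos-* 1 (suc (length xs)))) le))

  proportion≰½ : ∀ xs → ¬ proportion P? xs ℚ.≤ ½ → length xs ≤ 2 * length (filter P? xs)
  proportion≰½ []       _   = z≤n
  proportion≰½ (x ∷ xs) nle with 2 * length (filter P? (x ∷ xs)) ≤? suc (length xs)
  ... | no  ≰  = <⇒≤ (≰⇒> ≰)
  ... | yes le = contradiction (ℚ.*≤* (subst₂ ℤ._≤_
    (ℤ.pos-* (length (filter P? (x ∷ xs))) 2) (ℤ.pos-* 1 (suc (length xs)))
    (ℤ.+≤+ (subst₂ _≤_ (*-comm 2 (length (filter P? (x ∷ xs)))) (sym (*-identityˡ _)) le)))) nle

least≤ : ∀ {P : Pred ℕ 0ℓ} (P? : Decidable P) b → least P? b ≤ b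
least≤ P? zero = z≤n
least≤ P? (suc b) with P? 0
... | yes _ = z≤n
... | no  _ = s≤s (least≤ (P? ∘ suc) b)

below-least : ∀ {P : Pred ℕ 0ℓ} (P? : Decidable P) b {j} → j < least P? b → ¬ P j
below-least P? (suc b) {j} j< with P? 0
below-least P? (suc b) {zero}  j<       | no ¬P0 = ¬P0
below-least P? (suc b) {suc j} (s≤s j<) | no ¬P0 = below-least (P? ∘ suc) b j<

-- Strictness excludes the default value `b`, which is also returned when nothing below `b`
-- satisfies `P`.
at-least : ∀ {P : Pred ℕ 0ℓ} (P? : Decidable P) b → least P? b < b → P (least P? b)
at-least P? (suc b) l< with P? 0
at-least P? (suc b) l<       | yes P0 = P0
at-least P? (suc b) (s≤s l<) | no  _  = at-least (P? ∘ suc) b l<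

-- Pulls a prefix of the relevant elements back to a prefix of the whole ordering, where first
-- circuits are defined.
take-filter : {A : Set} {P : Pred A 0ℓ} (P? : Decidable P) → ∀ t xs →
  ∃[ s ] s ≤ length xs × take t (filter P? xs) ≡ filter P? (take s xs)
take-filter P? zero    xs = 0 , z≤n , refl
take-filter P? (suc t) [] = 0 , z≤n , refl
take-filter P? (suc t) (x ∷ xs) with P? x in Px
... | no ¬p with s , s≤ , eq ← take-filter P? (suc t) xs =
  suc s , s≤s s≤ , trans eq (sym (filter-reject P? ¬p))
... | yes p with s , s≤ , eq ← take-filter P? t xs =
  suc s , s≤s s≤ , trans (cong (x ∷_) eq) (sym (filter-accept P? p))

predecessor : ∀ {n} → 0 < n → ∃[ m ] n ≡ suc m
predecessor {suc m} _ = m , refl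

length-subsets : ∀ l (S : Subset N) → length (subsetsOfSize l S) ≡ length (elements S) C l
length-subsets l S = trans (length-sum (subsetsOfSize l S))
  (trans (sum-subsets S l (λ _ → 1)) (combinationSum-count l (elements S)))

module _ (M : Matroid N) where

  independence : List (Fin N) → ℕ
  independence c = indicator (Indep? M (fromList c))

  dependence : List (Fin N) → ℕ
  dependence c = indicator (¬? (Indep? M (fromList c)))

  independence-symmetric : Symmetric independence
  independence-symmetric p = cong (indicator ∘ Indep? M) (fromList-↭ p)

  independence-antitone : ∀ xs ys → independence (xs ++ ys) ≤ independence xs
  independence-antitone xs ys = indicator-mono (Indep? M _) (Indep? M _)
    (indep-⊆ M (fromList-mono {xs = xs} {ys = xs ++ ys} ∈-++⁺ˡ))

  length-independent : ∀ l S → length (filter (Indep? M) (subsetsOfSize l S)) ≡ combinationSum l independence (elements S)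
  length-independent l S = trans (length-filter-indicator (Indep? M) (subsetsOfSize l S))
    (sum-subsets S l (indicator ∘ Indep? M))

  α≤∣_∣ : ∀ S → α M S ≤ ∣ S ∣
  α≤∣ S ∣ = least≤ (λ l → proportion (Indep? M) (subsetsOfSize l S) ℚ.≤? ½) ∣ S ∣

  below-α : ∀ S k → k < α M S → length (elements S) C k ≤ 2 * combinationSum k independence (elements S)
  below-α S k k<α = subst₂ (λ x y → x ≤ 2 * y) (length-subsets k S) (length-independent k S)
    (proportion≰½ (Indep? M) (subsetsOfSize k S)
      (below-least (λ l → proportion (Indep? M) (subsetsOfSize l S) ℚ.≤? ½) ∣ S ∣ k<α))

  -- Independence is antitone, so its probability stays at most 1/2 from `α` on, and dependence is
  -- its complement. The strict bound on `α` ensures that the search did succeed.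
  from-α : ∀ S → α M S < ∣ S ∣ → ∀ k →
    length (elements S) C (α M S + k) ≤ 2 * combinationSum (α M S + k) dependence (elements S)
  from-α S α<∣S∣ k = +-cancelʳ-≤ (2 * indep) _ _ (begin
    length (elements S) C l + 2 * indep  ≤⟨ +-monoʳ-≤ (length (elements S) C l) indep≤ ⟩
    length (elements S) C l + length (elements S) C l ≡⟨ cong₂ _+_ total (sym (trans (+-identityʳ _) (sym total))) ⟩
    indep + dep + ((indep + dep) + 0)    ≡⟨ regroup indep dep ⟩
    2 * dep + 2 * indep                  ∎)
    where
    open ≤-Reasoning
    l indep dep : ℕ
    l = α M S + k
    indep = combinationSum l independence (elements S)
    dep = combinationSum l dependence (elements S)
    regroup : ∀ x y → x + y + ((x + y) + 0) ≡ 2 * y + 2 * x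
    regroup = solve-∀
    total : length (elements S) C l ≡ indep + dep
    total = trans (sym (combinationSum-count l (elements S)))
      (trans (combinationSum-≗ (λ c → sym (indicator-¬ (Indep? M (fromList c)))) l (elements S))
        (combinationSum-+ l independence dependence (elements S)))
    indep≤ : 2 * indep ≤ length (elements S) C l
    indep≤ = combinationSum-half independence-symmetric independence-antitone (elements S) (α M S) k
      (subst₂ (λ x y → 2 * x ≤ y) (length-independent (α M S) S) (length-subsets (α M S) S)
        (proportion≤½ (Indep? M) (subsetsOfSize (α M S) S)
          (at-least (λ l → proportion (Indep? M) (subsetsOfSize l S) ℚ.≤? ½) ∣ S ∣ α<∣S∣)))

  -- The only subset of size 0 is independent, so the proportion there is 1 and the search passes
  -- it.
  α-positive : ∀ S → 0 < ∣ S ∣ → 0 < α M S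
  α-positive S 0<∣S∣ with α M S in α≡
  ... | suc _ = s≤s z≤n
  ... | zero  = contradiction (subst₂ (λ x y → 2 * x ≤ y)
          (trans (length-independent 0 S) (indicator-yes (Indep? M ⊥) (indep-⊥ M)))
          (length-subsets 0 S)
          (proportion≤½ (Indep? M) (subsetsOfSize 0 S)
            (subst (λ l → proportion (Indep? M) (subsetsOfSize l S) ℚ.≤ ½) α≡
              (at-least (λ l → proportion (Indep? M) (subsetsOfSize l S) ℚ.≤? ½) ∣ S ∣ (subst (_< ∣ S ∣) (sym α≡) 0<∣S∣)))))
        (λ { (s≤s ()) })

  -- First circuits that leave `A`, and the gap they force.

  module _ (A B : Subset N) where

    Either : Pred (Fin N) 0ℓ
    Either x = x ∈ A ⊎ x ∈ B

    Either? : Decidable Either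
    Either? x = (x ∈? A) ⊎-dec (x ∈? B)

    -- The shortest prefix of π containing W is dependent, so it contains C_π;
    -- if C_π were inside A, it would lie in the independent part of W in A.
    first-circuit-outside : ∀ t π → π ↭ elements (E M) →
      let W = take t (filter Either? π) in
      Indep M (fromList (filter (_∈? A) W)) → ¬ Indep M (fromList (filter (_∈? B) W)) →
      ¬ FirstCircuitIn M A π
    first-circuit-outside t π π↭ indA depB (C , (r , _ , _ , minimal , circuit , C⊆r) , C⊆A)
      with s , s≤ , eq ← take-filter Either? t π = proj₂ (proj₁ circuit) (indep-⊆ M C⊆W indA)
      where
      W : List (Fin N)
      W = take t (filter Either? π)
      take⊆ : ∀ k {x} → x ∈ₗ take k π → x ∈ₗ π
      take⊆ k = go k π
        where
        go : ∀ k xs {x : Fin N} → x ∈ₗ take k xs → x ∈ₗ xs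
        go (suc k) (_ ∷ _)  (here px) = here px
        go (suc k) (_ ∷ xs) (there p) = there (go k xs p)
      dependent : Dependent M (fromList (take s π))
      dependent = (λ x∈ → ∈-elements⁻ (∈-resp-↭ π↭ (take⊆ s (∈-fromList⁻ (take s π) x∈)))) ,
        λ ind → depB (indep-⊆ M (fromList-mono {xs = filter (_∈? B) W} {ys = take s π} (λ x∈ →
          proj₁ (∈-filter⁻ Either? {xs = take s π} (subst (_ ∈ₗ_) eq (proj₁ (∈-filter⁻ (_∈? B) {xs = W} x∈)))))) ind)
      r≤s : r ≤ s
      r≤s = ≮⇒≥ (λ s<r → minimal s<r dependent)
      longer : ∀ {x} → x ∈ₗ take r π → x ∈ₗ take s π
      longer x∈ with ρ , eq′ ← take-extends r (s ∸ r) π =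
        subst (λ k → _ ∈ₗ take k π) (m+[n∸m]≡n r≤s) (subst (_ ∈ₗ_) (sym eq′) (∈-++⁺ˡ x∈))
      C⊆W : C ⊆ fromList (filter (_∈? A) W)
      C⊆W x∈C = ∈-fromList⁺ (∈-filter⁺ (_∈? A)
        (subst (_ ∈ₗ_) (sym eq) (∈-filter⁺ Either? (longer (∈-fromList⁻ (take r π) (C⊆r x∈C))) (inj₁ (C⊆A x∈C))))
        (C⊆A x∈C))

    missed : List (Fin N) → ℕ
    missed π = indicator (¬? (FirstCircuitIn? M A π))

    private
      G : List (Fin N) → ℕ
      G c = independence (filter (_∈? A) c) * dependence (filter (_∈? B) c)

    module _ (A⊆E : A ⊆ E M) (B⊆E : B ⊆ E M) (disjoint : ∀ {x} → x ∈ A → x ∉ B) where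

      private
        as++bs↭ : elements A ++ elements B ↭ filter Either? (elements (E M))
        as++bs↭ = ↭-sym (↭-trans (filter-split (_∈? A) both)
          (↭-trans (↭-reflexive (cong₂ _++_ B-part A-part)) (++-comm (elements B) (elements A))))
          where
          both : List (Fin N)
          both = filter Either? (elements (E M))
          both≡ : both ≡ filter Either? (allFin N)
          both≡ = filter-≗∘ Either? (_∈? E M) Either? (λ x e → e , [ A⊆E , B⊆E ]′ e) (λ _ e _ → e) (allFin N)
          A-part : filter (_∈? A) both ≡ elements A
          A-part = trans (cong (filter (_∈? A)) both≡)
            (filter-≗∘ (_∈? A) Either? (_∈? A) (λ _ x∈A → x∈A , inj₁ x∈A) (λ _ x∈A _ → x∈A) (allFin N))
          B-part : filter (¬? ∘ (_∈? A)) both ≡ elements B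
          B-part = trans (cong (filter (¬? ∘ (_∈? A))) both≡)
            (filter-≗∘ (¬? ∘ (_∈? A)) Either? (_∈? B) (λ _ x∈B → (λ x∈A → disjoint x∈A x∈B) , inj₂ x∈B)
              (λ { _ x∉A (inj₁ x∈A) → contradiction x∈A x∉A ; _ _ (inj₂ x∈B) → x∈B }) (allFin N))

        G-symmetric : Symmetric G
        G-symmetric p = cong₂ _*_ (independence-symmetric (filter-↭ (_∈? A) p))
          (cong (indicator ∘ ¬? ∘ Indep? M) (fromList-↭ (filter-↭ (_∈? B) p)))

        G-product : ∀ c d → All (_∈ A) c → All (_∈ B) d → G (c ++ d) ≡ independence c * dependence d
        G-product c d c∈A d∈B = cong₂ (λ x y → independence x * dependence y)
          (trans (filter-++ (_∈? A) c d) (trans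
            (cong₂ _++_ (filter-all (_∈? A) c∈A) (filter-none (_∈? A) (All.map (flip disjoint) d∈B))) (++-identityʳ c)))
          (trans (filter-++ (_∈? B) c d)
            (cong₂ _++_ (filter-none (_∈? B) (All.map disjoint c∈A)) (filter-all (_∈? B) d∈B)))

        G≤missed : ∀ t π → π ↭ elements (E M) → G (take t (filter Either? π)) ≤ missed π
        G≤missed t π π↭
          with Indep? M (fromList (filter (_∈? A) (take t (filter Either? π))))
             | Indep? M (fromList (filter (_∈? B) (take t (filter Either? π))))
        ... | no  _    | _       = z≤n
        ... | yes _    | yes _   = z≤n
        ... | yes indA | no depB = ≤-reflexive (sym (indicator-yes (¬? (FirstCircuitIn? M A π))
                                     (first-circuit-outside t π π↭ indA depB)))

      -- Divided by `|A| |B|`, the conclusion says that the rate `α / |·|` rises by at least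
      -- `v / |A|` from `A` to `B`. The hypotheses `2 α ≤ |·|` leave room for the estimates of
      -- neighbouring ratios.
      α-gap : ∀ c v → 5220 < c → c * permutationSum missed (elements (E M)) ≤ length (elements (E M)) ! →
        1 ≤ v → v ≡ 1 ⊎ 40 * (v * v) ≤ α M A → α M A ≤ 160 * (v * v) →
        0 < ∣ A ∣ → 0 < ∣ B ∣ → 2 * α M A ≤ ∣ A ∣ → 2 * α M B ≤ ∣ B ∣ → ∣ A ∣ ≤ 2 * ∣ B ∣ → ∣ B ∣ ≤ 2 * ∣ A ∣ →
        (α M A + v) * ∣ B ∣ ≤ ∣ A ∣ * α M B
      α-gap c v 5220<c rare 1≤v v-or αA≤ 0<A 0<B 2αA≤ 2αB≤ A≤2B B≤2A
        with a , αA≡ ← predecessor (α-positive A 0<A) | b , αB≡ ← predecessor (α-positive B 0<B) =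
        rare-gap Either? (elements (E M)) (elements A) (elements B) as++bs↭
          (all-filter (_∈? A) (allFin N)) (all-filter (_∈? B) (allFin N))
          G missed independence dependence G-symmetric G-product a b (G≤missed (a + suc b))
          (λ k k≤a → below-α A k (subst (k <_) (sym αA≡) (s≤s k≤a)))
          (λ k → subst (λ l → length (elements B) C (l + k) ≤ 2 * combinationSum (l + k) dependence (elements B)) αB≡
            (from-α B αB<∣B∣ k))
          αA≡ αB≡ (length-elements A) (length-elements B)
          c v 5220<c rare 1≤v v-or αA≤ 2αA≤ 2αB≤ A≤2B B≤2A
        where
        αB<∣B∣ : α M B < ∣ B ∣
        αB<∣B∣ = ≤-trans (subst (α M B <_) (cong (α M B +_) (sym (+-identityʳ _)))
                   (m<m+n (α M B) (α-positive B 0<B))) 2αB≤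

-- From the greedy threshold and accuracy to the rarity of missed first circuits.

p≤∣p∣ : ∀ p → p ℚ.≤ ℚ.∣ p ∣
p≤∣p∣ (mkℚᵘ (ℤ.+ _)  _) = ℚ.≤-refl
p≤∣p∣ (mkℚᵘ -[1+ _ ] _) = ℚ.*≤* ℤ.-≤+

-- For negative `b` the encoded inequality has a positive power of `m` times a power of 2 on the
-- left and 1 on the right, which is impossible for `m ≥ 2`.
log-nonNegative : ∀ h b m → 2 ≤ m → ℚ.NonNegative h → h ≤ b ·log₂ m → ℚ.NonNegative b
log-nonNegative h              (mkℚᵘ (ℤ.+ _)  _) m 2≤m h≥0 le = _
log-nonNegative (mkℚᵘ (ℤ.+ x) e) (mkℚᵘ -[1+ k ] d) m 2≤m h≥0 le =
  contradiction 2≤m (<⇒≱ (s≤s (begin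
    m                                   ≡⟨ *-identityʳ m ⟨
    m * 1                               ≤⟨ *-monoʳ-≤ m (m^n>0 m {{>-nonZero (≤-trans (s≤s z≤n) 2≤m)}} y) ⟩
    m ^ suc y                           ≤⟨ m≤n*m (m ^ suc y) (2 ^ posPart u) {{m^n≢0 2 (posPart u)}} ⟩
    2 ^ posPart u * m ^ suc y           ≤⟨ le ⟩
    1 * 2 ^ negPart u                   ≡⟨ *-identityˡ _ ⟩
    2 ^ negPart u                       ≡⟨ cong (2 ^_) (negPart-+◃ (x * suc d)) ⟩
    1                                   ∎)))
  where
  open ≤-Reasoning
  u : ℤ.ℤ
  u = ℤ.+ x ℤ.* ℤ.+ suc d
  y : ℕ
  y = e + k * suc e
  negPart-+◃ : ∀ n → negPart (Sign.+ ℤ.◃ n) ≡ 0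
  negPart-+◃ zero    = refl
  negPart-+◃ (suc n) = refl

harmonic-nonNegative : ∀ s → ℚ.NonNegative (harmonic s)
harmonic-nonNegative zero    = _
harmonic-nonNegative (suc s) = ℚ.nonNeg+nonNeg⇒nonNeg (harmonic s) {{harmonic-nonNegative s}} (ℤ.+ 1 ℚ./ suc s)

nonNegative-difference : ∀ K c p .{{_ : ℚ.Positive K}} → ℚ.NonNegative (K ℚ.* (p ℚ.- c)) → c ℚ.≤ p
nonNegative-difference K c p K*≥0 = ℚ.0≤q-p⇒p≤q (ℚ.*-cancelˡ-≤-pos K
  (ℚ.≤-respˡ-≃ (ℚ.≃-sym (ℚ.*-zeroʳ K)) (ℚ.nonNegative⁻¹ (K ℚ.* (p ℚ.- c)) {{K*≥0}})))

2⁻²⁰ : ℚᵘ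
2⁻²⁰ = (ℤ.+ 1 ℚ./ (2 ^ 20)) {{m^n≢0 2 20}}

-- The harmonic sum is nonnegative, so the threshold never falls below `1 - 2⁻²⁰`, whatever `s` is.
threshold≥ : ∀ m s p → 2 ≤ m → AboveThreshold m s p → 1ℚᵘ ℚ.- 2⁻²⁰ ℚ.≤ p
threshold≥ m s p 2≤m above = nonNegative-difference (fromℕ (2 ^ 20)) (1ℚᵘ ℚ.- 2⁻²⁰) p
  (log-nonNegative (harmonic s) (fromℕ (2 ^ 20) ℚ.* (p ℚ.- (1ℚᵘ ℚ.- 2⁻²⁰))) m 2≤m (harmonic-nonNegative s) above)

1/-antitone : ∀ K m .{{_ : NonZero K}} .{{_ : NonZero m}} → K ≤ m → ℤ.+ 1 ℚ./ m ℚ.≤ ℤ.+ 1 ℚ./ K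
1/-antitone (suc K) (suc m) K≤m = ℚ.*≤* (ℤ.*-monoˡ-≤-nonNeg (ℤ.+ 1) (ℤ.+≤+ K≤m))

estimate-bound : ∀ θ e e′ δ q q̂ → 1ℚᵘ ℚ.- θ ℚ.≤ q̂ → ℚ.∣ q̂ ℚ.- q ∣ ℚ.≤ e → e ℚ.≤ e′ → θ ℚ.+ e′ ℚ.≤ δ → 1ℚᵘ ℚ.≤ δ ℚ.+ q
estimate-bound θ e e′ δ q q̂ high close e≤e′ θ+e′≤δ = begin
  1ℚᵘ                         ≃⟨ solve 1 (λ t → con 1ℚᵘ := (con 1ℚᵘ :- t) :+ t) ℚ.≃-refl θ ⟩
  (1ℚᵘ ℚ.- θ) ℚ.+ θ           ≤⟨ ℚ.+-monoˡ-≤ θ high ⟩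
  q̂ ℚ.+ θ                     ≃⟨ solve 3 (λ q q̂ t → q̂ :+ t := (t :+ (q̂ :- q)) :+ q) ℚ.≃-refl q q̂ θ ⟩
  (θ ℚ.+ (q̂ ℚ.- q)) ℚ.+ q     ≤⟨ ℚ.+-monoˡ-≤ q (ℚ.≤-trans (ℚ.+-monoʳ-≤ θ
                                   (ℚ.≤-trans (p≤∣p∣ (q̂ ℚ.- q)) (ℚ.≤-trans close e≤e′))) θ+e′≤δ) ⟩
  δ ℚ.+ q                     ∎
  where
  open ℚ.≤-Reasoning
  open ℚ.+-*-Solver

module _ {A : Set} {P : Pred A 0ℓ} (P? : Decidable P) where

  complement-rare : ∀ c xs → 1ℚᵘ ℚ.≤ (ℤ.+ 1 ℚ./ suc c) ℚ.+ proportion P? xs →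
    suc c * length (filter (¬? ∘ P?) xs) ≤ length xs
  complement-rare c []          _           = ≤-reflexive (*-zeroʳ (suc c))
  complement-rare c (x ∷ xs) (ℚ.*≤* le) = +-cancelˡ-≤ (suc c * k) _ _ (begin
    suc c * k + suc c * length (filter (¬? ∘ P?) (x ∷ xs))
      ≡⟨ *-distribˡ-+ (suc c) k _ ⟨
    suc c * (k + length (filter (¬? ∘ P?) (x ∷ xs)))
      ≡⟨ cong (suc c *_) (trans (+-comm k _) (trans (sym (length-++ (filter (¬? ∘ P?) (x ∷ xs))))
           (sym (↭-length (filter-split P? (x ∷ xs)))))) ⟩
    suc c * suc n
      ≤⟨ le′ ⟩
    suc n + k * suc c
      ≡⟨ trans (+-comm (suc n) _) (cong (_+ suc n) (*-comm k (suc c))) ⟩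
    suc c * k + suc n ∎)
    where
    open ≤-Reasoning
    k n : ℕ
    k = length (filter P? (x ∷ xs))
    n = length xs
    le′ : suc c * suc n ≤ suc n + k * suc c
    le′ = ℤ.drop‿+≤+ (subst₂ ℤ._≤_
      (ℤ.*-identityˡ (ℤ.+ (suc c * suc n)))
      (trans (ℤ.*-identityʳ _) (cong₂ ℤ._+_ (ℤ.*-identityˡ (ℤ.+ suc n)) (sym (ℤ.pos-* k (suc c))))) le)

-- For `n₀ ≥ 2^10` the sampling error `1 / n₀²` is at most `2⁻²⁰`, so the true probability of
-- missing `A` is at most `2 · 2⁻²⁰`. The weaker bound `1 / 2^13` is kept because `2^13 = 8192`
-- already exceeds 5220.
missed-rare : ∀ n₀ .{{_ : NonZero n₀}} (M : Matroid N) (ω : Sample (n₀ ^ 10) M) A B m s → 2 ^ 10 ≤ n₀ → A ⊆ E M →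
  Accurate n₀ M ω → 2 ≤ m → AboveThreshold m s (q̂ M ω A) →
  2 ^ 13 * permutationSum (missed M A B) (elements (E M)) ≤ length (elements (E M)) !
missed-rare n₀ M ω A B m s n₀≥ A⊆E accurate 2≤m above = subst₂ _≤_
  (cong (2 ^ 13 *_) (trans (length-filter-indicator (¬? ∘ FirstCircuitIn? M A) (permutations (elements (E M))))
    (sum-permutations _ (elements (E M)))))
  (trans (length-sum (permutations (elements (E M)))) (trans (sum-permutations _ (elements (E M)))
    (trans (permutationSum-const 1 (elements (E M))) (*-identityʳ _))))
  (complement-rare (FirstCircuitIn? M A) (2 ^ 13 ∸ 1) (permutations (elements (E M)))
    (estimate-bound 2⁻²⁰ _ 2⁻²⁰ _ (q M A) (q̂ M ω A) (threshold≥ m s (q̂ M ω A) 2≤m above) (accurate A A⊆E)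
      (1/-antitone (2 ^ 20) (n₀ ^ 2) {{m^n≢0 2 20}} {{m^n≢0 n₀ 2}} (^-monoˡ-≤ 2 n₀≥))
      (toWitness {a? = 2⁻²⁰ ℚ.+ 2⁻²⁰ ℚ.≤? ℤ.+ 1 ℚ./ (2 ^ 13)} tt)))

-- Deletions, and the invariants of a run.

proportion-cong : {A : Set} {P Q : Pred A 0ℓ} (P? : Decidable P) (Q? : Decidable Q) → ∀ xs →
  All (λ x → (P x → Q x) × (Q x → P x)) xs → proportion P? xs ≡ proportion Q? xs
proportion-cong P? Q? []       []  = refl
proportion-cong {P = P} {Q} P? Q? (x ∷ xs) eqs = cong (λ k → ℤ.+ k ℚ./ suc (length xs)) (filters (x ∷ xs) eqs)
  where
  filters : ∀ ys → All (λ y → (P y → Q y) × (Q y → P y)) ys → length (filter P? ys) ≡ length (filter Q? ys)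
  filters []       []        = refl
  filters (y ∷ ys) ((to , from) ∷ eqs) with P? y | Q? y
  ... | yes _ | yes _ = cong suc (filters ys eqs)
  ... | no  _ | no  _ = filters ys eqs
  ... | yes p | no ¬q = contradiction (to p) ¬q
  ... | no ¬p | yes q = contradiction (from q) ¬p

least-cong : ∀ {P Q : Pred ℕ 0ℓ} (P? : Decidable P) (Q? : Decidable Q) b →
  (∀ l → P l → Q l) → (∀ l → Q l → P l) → least P? b ≡ least Q? b
least-cong P? Q? zero    to from = refl
least-cong P? Q? (suc b) to from with P? 0 | Q? 0
... | yes _ | yes _ = refl
... | yes p | no ¬q = contradiction (to 0 p) ¬q
... | no ¬p | yes q = contradiction (from 0 q) ¬p
... | no  _ | no  _ = cong suc (least-cong (P? ∘ suc) (Q? ∘ suc) b (to ∘ suc) (from ∘ suc))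

_IsRestrictionOf_ : Matroid N → Matroid N → Set
M′ IsRestrictionOf M = ∀ X → X ⊆ E M′ → (Indep M′ X → Indep M X) × (Indep M X → Indep M′ X)

∖-restriction : ∀ (M′ M : Matroid N) D → M′ IsRestrictionOf M → (M′ ∖ D) IsRestrictionOf M
∖-restriction M′ M D res X X⊆ =
  (λ ind → proj₁ (res X (λ x∈ → p─q⊆p (E M′) D (X⊆ x∈))) (proj₁ ind)) ,
  (λ ind → proj₂ (res X (λ x∈ → p─q⊆p (E M′) D (X⊆ x∈))) ind , X⊆)

-- `α` looks only at subsets of `S`, so the rates of sets peeled from different deletions can all be
-- compared in the input matroid.
α-restriction : ∀ (M′ M : Matroid N) → M′ IsRestrictionOf M → ∀ S → S ⊆ E M′ → α M′ S ≡ α M S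
α-restriction M′ M res S S⊆ = least-cong _ _ ∣ S ∣
  (λ l → subst (ℚ._≤ ½) (same l)) (λ l → subst (ℚ._≤ ½) (sym (same l)))
  where
  same : ∀ l → proportion (Indep? M′) (subsetsOfSize l S) ≡ proportion (Indep? M) (subsetsOfSize l S)
  same l = proportion-cong (Indep? M′) (Indep? M) (subsetsOfSize l S)
    (All.map (λ {X} sub → res X (λ x∈ → S⊆ (proj₁ sub x∈)))
      (all-filter (λ X → (X ⊆? S) ×-dec (∣ X ∣ ≟ l)) (allSubsets _)))

p─q∉q : ∀ {x} (p q : Subset N) → x ∈ p ─ q → x ∉ q
p─q∉q (_ ∷ p) (outside ∷ q) (there x∈) (there x∈q) = p─q∉q p q x∈ x∈q
p─q∉q (_ ∷ p) (inside ∷ q)  (there x∈) (there x∈q) = p─q∉q p q x∈ x∈q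

∣p─q∣+∣q∣ : ∀ (p q : Subset N) → q ⊆ p → ∣ p ─ q ∣ + ∣ q ∣ ≤ ∣ p ∣
∣p─q∣+∣q∣ []            []            q⊆p = z≤n
∣p─q∣+∣q∣ (inside  ∷ p) (inside  ∷ q) q⊆p = subst (_≤ suc ∣ p ∣) (sym (+-suc ∣ p ─ q ∣ ∣ q ∣))
  (s≤s (∣p─q∣+∣q∣ p q (λ x∈ → case q⊆p (there x∈) of λ { (there x∈p) → x∈p })))
∣p─q∣+∣q∣ (outside ∷ p) (inside  ∷ q) q⊆p = case q⊆p here of λ ()
∣p─q∣+∣q∣ (inside  ∷ p) (outside ∷ q) q⊆p =
  s≤s (∣p─q∣+∣q∣ p q (λ x∈ → case q⊆p (there x∈) of λ { (there x∈p) → x∈p }))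
∣p─q∣+∣q∣ (outside ∷ p) (outside ∷ q) q⊆p =
  ∣p─q∣+∣q∣ p q (λ x∈ → case q⊆p (there x∈) of λ { (there x∈p) → x∈p })

-- The rate of `S′` is at least that of `S` plus `v / |S|`, cross-multiplied. Quantifying over every
-- admissible `v` postpones the choice of a value near `√α`.
Separated : Matroid N → Rel (Subset N) 0ℓ
Separated M S S′ = ∀ v → 1 ≤ v → v ≡ 1 ⊎ 40 * (v * v) ≤ α M S → α M S ≤ 160 * (v * v) →
  ∣ S ∣ ≤ 2 * ∣ S′ ∣ → ∣ S′ ∣ ≤ 2 * ∣ S ∣ → (α M S + v) * ∣ S′ ∣ ≤ ∣ S ∣ * α M S′

Sparse : Matroid N → Pred (Subset N) 0ℓ
Sparse M S = 2 ≤ ∣ S ∣ × 2 * α M S ≤ ∣ S ∣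

module _ (_≺_ : Rel (Fin N) 0ℓ) where

  GreedyFrom-⊆ : ∀ {P S S*} → GreedyFrom _≺_ P S S* → S* ⊆ S
  GreedyFrom-⊆ (stop _) x∈ = x∈
  GreedyFrom-⊆ {S = S} (remove {x} _ run) x∈ = p─q⊆p S ⁅ x ⁆ (GreedyFrom-⊆ run x∈)

  -- The threshold is tested only at removals: the starting set may be returned untested, and
  -- otherwise the last removal certifies the result.
  GreedyFrom-threshold : ∀ {s} (M : Matroid N) (ω : Sample s M) {S S*} → GreedyFrom _≺_ (Removable _≺_ M ω) S S* →
    S* ≡ S ⊎ ∃[ k ] AboveThreshold ∣ E M ∣ k (q̂ M ω S*)
  GreedyFrom-threshold M ω (stop _) = inj₁ refl
  GreedyFrom-threshold M ω {S} (remove {x} ((_ , above) , _) run) with GreedyFrom-threshold M ω run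
  ... | inj₁ refl  = inj₂ (∣ S ∣ ∸ 1 , above)
  ... | inj₂ found = inj₂ found

  module _ (n₀ n : ℕ) where

    -- Not stopping means `n ^ α < 2 ^ |S|` and `2 |S| ≤ n`. For `n ≥ 4` the first gives
    -- `2 α ≤ |S|`. Size 0 would give `1 < 1`, and sizes 1 and 2 would give
    -- `n < 2 ^ |S| = 2 |S| ≤ n`.
    ¬StopAt-sparse : ∀ (M : Matroid N) S → ¬ StopAt _≺_ n₀ n M S → Sparse M S
    ¬StopAt-sparse M S ¬stop = sparse ∣ S ∣ refl
      where
      open ≤-Reasoning
      2∣S∣≤n : 2 * ∣ S ∣ ≤ n
      2∣S∣≤n = ≮⇒≥ (¬stop ∘ inj₂)
      n^α<2^∣S∣ : n ^ α M S < 2 ^ ∣ S ∣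
      n^α<2^∣S∣ = ≰⇒> λ le → ¬stop (inj₁ (log-≤ ∣ S ∣ (α M S) le))
        where
        log-≤ : ∀ s a → 2 ^ s ≤ n ^ a → fromℕ s ≤ fromℕ a ·log₂ n
        log-≤ s a le rewrite ℤ.*-identityʳ (ℤ.+ s) | ℤ.*-identityʳ (ℤ.+ a) =
          subst₂ _≤_ (sym (*-identityʳ _)) (sym (*-identityʳ _)) le
      n<2^∣S∣ : 0 < ∣ S ∣ → n < 2 ^ ∣ S ∣
      n<2^∣S∣ 0<∣S∣ = ≤-<-trans (begin
        n            ≡⟨ ^-identityʳ n ⟨
        n ^ 1        ≤⟨ ^-monoʳ-≤ n {{>-nonZero (≤-trans 0<∣S∣ (≤-trans (m≤n*m ∣ S ∣ 2) 2∣S∣≤n))}} (α-positive M S 0<∣S∣) ⟩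
        n ^ α M S    ∎) n^α<2^∣S∣
      4^α<2^∣S∣⇒ : ∀ a s → 4 ^ a < 2 ^ s → 2 * a ≤ s
      4^α<2^∣S∣⇒ a s lt = ≮⇒≥ λ s<2a → <⇒≱ lt (begin
        2 ^ s        ≤⟨ ^-monoʳ-≤ 2 (<⇒≤ s<2a) ⟩
        2 ^ (2 * a)  ≡⟨ ^-*-assoc 2 2 a ⟨
        4 ^ a        ∎)
      sparse : ∀ s → ∣ S ∣ ≡ s → Sparse M S
      sparse 0 eq = contradiction
        (subst₂ (λ a s → n ^ a < 2 ^ s) (n≤0⇒n≡0 (subst (α M S ≤_) eq (α≤∣_∣ M S))) eq n^α<2^∣S∣) (<-irrefl refl)
      sparse 1 eq = contradiction (≤-trans (subst (λ s → n < 2 ^ s) eq (n<2^∣S∣ (≤-reflexive (sym eq))))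
        (subst (λ s → 2 * s ≤ n) eq 2∣S∣≤n)) (<-irrefl refl)
      sparse 2 eq = contradiction (≤-trans (subst (λ s → n < 2 ^ s) eq (n<2^∣S∣ (≤-trans (s≤s z≤n) (≤-reflexive (sym eq)))))
        (subst (λ s → 2 * s ≤ n) eq 2∣S∣≤n)) (<-irrefl refl)
      sparse (suc (suc (suc s))) eq = 2≤∣S∣ , 4^α<2^∣S∣⇒ (α M S) ∣ S ∣ (≤-<-trans (^-monoˡ-≤ (α M S) 4≤n) n^α<2^∣S∣)
        where
        2≤∣S∣ : 2 ≤ ∣ S ∣
        2≤∣S∣ = ≤-trans (s≤s (s≤s z≤n)) (≤-reflexive (sym eq))
        4≤n : 4 ≤ n
        4≤n = ≤-trans (*-monoʳ-≤ 2 2≤∣S∣) 2∣S∣≤n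

    module _ .{{_ : NonZero n₀}} (n₀≥ : 2 ^ 10 ≤ n₀) (M : Matroid N) where

      peeled-separated : ∀ M′ → M′ IsRestrictionOf M → (ω : Sample (n₀ ^ 10) M′) → Accurate n₀ M′ ω →
        ∀ S → FindGreedilyOptimal _≺_ M′ ω S → Sparse M S →
        ∀ S′ → S′ ⊆ E M′ ─ S → Sparse M S′ → Separated M S S′
      peeled-separated M′ res ω accurate S greedy (2≤S , 2α≤S) S′ S′⊆ (2≤S′ , 2α≤S′) =
        [ (λ S≡E → contradiction (exhausted S≡E) (λ ())) , (λ (k , above) → separated k above) ]′
          (GreedyFrom-threshold M′ ω greedy)
        where
        open ≤-Reasoning
        S⊆E : S ⊆ E M′
        S⊆E = GreedyFrom-⊆ greedy
        -- If the whole ground set was returned untested, nothing would be left for `S′`, which has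
        -- at least two elements.
        exhausted : S ≡ E M′ → 2 ≤ 0
        exhausted S≡E = begin
          2              ≤⟨ 2≤S′ ⟩
          ∣ S′ ∣         ≤⟨ p⊆q⇒∣p∣≤∣q∣ S′⊆ ⟩
          ∣ E M′ ─ S ∣   ≤⟨ +-cancelʳ-≤ ∣ S ∣ _ 0 (≤-trans (∣p─q∣+∣q∣ (E M′) S S⊆E) (≤-reflexive (cong ∣_∣ (sym S≡E)))) ⟩
          0              ∎
        S′⊆E : S′ ⊆ E M′
        S′⊆E x∈ = p─q⊆p (E M′) S (S′⊆ x∈)
        αS : α M′ S ≡ α M S
        αS = α-restriction M′ M res S S⊆E
        αS′ : α M′ S′ ≡ α M S′
        αS′ = α-restriction M′ M res S′ S′⊆E
        separated : ∀ k → AboveThreshold ∣ E M′ ∣ k (q̂ M′ ω S) → Separated M S S′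
        separated k above v 1≤v v-or α≤ S≤2S′ S′≤2S = subst₂ (λ a b → (a + v) * ∣ S′ ∣ ≤ ∣ S ∣ * b) αS αS′
          (α-gap M′ S S′ S⊆E S′⊆E (λ x∈S x∈S′ → p─q∉q (E M′) S (S′⊆ x∈S′) x∈S)
            (2 ^ 13) v (toWitness {a? = 5220 <? 2 ^ 13} tt)
            (missed-rare n₀ M′ ω S S′ ∣ E M′ ∣ k n₀≥ S⊆E accurate (≤-trans 2≤S (p⊆q⇒∣p∣≤∣q∣ S⊆E)) above)
            1≤v (subst (λ a → v ≡ 1 ⊎ 40 * (v * v) ≤ a) (sym αS) v-or) (subst (_≤ 160 * (v * v)) (sym αS) α≤)
            (≤-trans (s≤s z≤n) 2≤S) (≤-trans (s≤s z≤n) 2≤S′)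
            (subst (λ a → 2 * a ≤ ∣ S ∣) (sym αS) 2α≤S) (subst (λ a → 2 * a ≤ ∣ S′ ∣) (sym αS′) 2α≤S′)
            S≤2S′ S′≤2S)

      -- Every later set lies in what the earlier ones left. This disjointness yields both the
      -- separation of each pair and the bound on the total size.
      peeled : ∀ M′ → M′ IsRestrictionOf M → ∀ Ss (run : PeelFrom _≺_ n₀ n M′ Ss) → AllAccurate _≺_ n₀ n run →
        All (λ S → S ⊆ E M′ × Sparse M S) Ss × AllPairs (Separated M) Ss × sum (map ∣_∣ Ss) ≤ ∣ E M′ ∣
      peeled M′ res [] (finish _)     _ = [] , [] , z≤n
      peeled M′ res [] (halt _ _ _ _) _ = [] , [] , z≤n
      peeled M′ res (S ∷ Ss) (peel _ ω greedy ¬stop run) (accurate , accurates) =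
        extend (peeled (M′ ∖ S) (∖-restriction M′ M S res) Ss run accurates)
        where
        open ≤-Reasoning
        S⊆E : S ⊆ E M′
        S⊆E = GreedyFrom-⊆ greedy
        sparse : Sparse M S
        sparse = subst (λ a → 2 ≤ ∣ S ∣ × 2 * a ≤ ∣ S ∣) (α-restriction M′ M res S S⊆E) (¬StopAt-sparse M′ S ¬stop)
        separated : ∀ {S′} → S′ ⊆ E M′ ─ S × Sparse M S′ → Separated M S S′
        separated {S′} (S′⊆ , sparse′) = peeled-separated M′ res ω accurate S greedy sparse S′ S′⊆ sparse′
        weaken : ∀ {S′} → S′ ⊆ E M′ ─ S × Sparse M S′ → S′ ⊆ E M′ × Sparse M S′
        weaken (S′⊆ , sparse′) = (λ {_} x∈ → p─q⊆p (E M′) S (S′⊆ x∈)) , sparse′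
        extend : All (λ S′ → S′ ⊆ E M′ ─ S × Sparse M S′) Ss × AllPairs (Separated M) Ss × sum (map ∣_∣ Ss) ≤ ∣ E M′ ─ S ∣ →
          All (λ S′ → S′ ⊆ E M′ × Sparse M S′) (S ∷ Ss) × AllPairs (Separated M) (S ∷ Ss) × sum (map ∣_∣ (S ∷ Ss)) ≤ ∣ E M′ ∣
        extend (facts , pairs , total) =
          ((λ {_} → S⊆E) , sparse) ∷ All.map weaken facts ,
          All.map separated facts ∷ pairs ,
          (begin
            ∣ S ∣ + sum (map ∣_∣ Ss)  ≤⟨ +-monoʳ-≤ ∣ S ∣ total ⟩
            ∣ S ∣ + ∣ E M′ ─ S ∣      ≡⟨ +-comm ∣ S ∣ _ ⟩
            ∣ E M′ ─ S ∣ + ∣ S ∣      ≤⟨ ∣p─q∣+∣q∣ (E M′) S S⊆E ⟩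
            ∣ E M′ ∣                  ∎)

-- Quadratic growth of the rates along a size class.

bracket : ∀ (f : ℕ → ℕ) m → f 0 ≤ m → m < f (suc m) → ∃[ k ] f k ≤ m × m < f (suc k)
bracket f m f0≤m m<f = search m 0 f0≤m (subst (λ k → m < f (suc k)) (sym (+-identityʳ m)) m<f)
  where
  search : ∀ fuel k → f k ≤ m → m < f (suc (fuel + k)) → ∃[ j ] f j ≤ m × m < f (suc j)
  search zero       k fk≤m m<f = k , fk≤m , m<f
  search (suc fuel) k fk≤m m<f with m <? f (suc k)
  ... | yes m<fk = k , fk≤m , m<fk
  ... | no  m≮fk = search fuel (suc k) (≮⇒≥ m≮fk) (subst (λ j → m < f (suc j)) (sym (+-suc fuel k)) m<f)

-- Take `v` to be the integer part of `√(a / c)`, raised to 1 if it is 0. Then `(v + 1)² ≤ 4 v²`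
-- costs the factor 4; with `c = 40` this is the origin of 160.
sqrt-window : ∀ c a → 0 < c → 0 < a → ∃[ v ] 1 ≤ v × (v ≡ 1 ⊎ c * (v * v) ≤ a) × a ≤ 4 * c * (v * v)
sqrt-window c a 0<c 0<a = choose (bracket (λ k → c * (k * k)) a (subst (_≤ a) (sym (*-zeroʳ c)) z≤n)
  (≤-trans (m≤m*n (suc a) (suc a)) (m≤n*m′ (suc a * suc a) 0<c)))
  where
  open ≤-Reasoning
  choose : (∃[ k ] c * (k * k) ≤ a × a < c * (suc k * suc k)) →
           ∃[ v ] 1 ≤ v × (v ≡ 1 ⊎ c * (v * v) ≤ a) × a ≤ 4 * c * (v * v)
  choose (zero  , _  , hi) = 1 , s≤s z≤n , inj₁ refl , ≤-trans (<⇒≤ hi) (*-monoˡ-≤ 1 (m≤n*m c 4))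
  choose (suc w , lo , hi) = suc w , s≤s z≤n , inj₂ lo , (begin
    a                                                ≤⟨ <⇒≤ hi ⟩
    c * (suc (suc w) * suc (suc w))                  ≤⟨ m≤m+n _ (c * (3 * (w * w) + 4 * w)) ⟩
    c * (suc (suc w) * suc (suc w)) + c * (3 * (w * w) + 4 * w) ≡⟨ quadruple c w ⟩
    4 * c * (suc w * suc w)                          ∎)
    where
    quadruple : ∀ c w → c * (suc (suc w) * suc (suc w)) + c * (3 * (w * w) + 4 * w) ≡ 4 * c * (suc w * suc w)
    quadruple = solve-∀

-- With x = a / s, the lower bound i² / K on Q x may be raised to (i + 1)² / K
-- when x grows by v / s, provided v is of order √a.
potential-step : ∀ K Q a s i v → 9 * (320 * K) ≤ K * K → s ≤ Q → Q ≤ 2 * s → 0 < s → 1 ≤ i → a ≤ 160 * (v * v) →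
  i * i * s ≤ K * Q * a → suc i * suc i * s ≤ K * Q * (a + v)
potential-step K Q a s i v K-large s≤Q Q≤2s 0<s 1≤i a≤ good = begin
  suc i * suc i * s                ≡⟨ expand i s ⟩
  i * i * s + (1 + 2 * i) * s      ≤⟨ +-mono-≤ good (*-mono-≤ growth s≤Q) ⟩
  K * Q * a + K * v * Q            ≡⟨ collect K Q a v ⟩
  K * Q * (a + v)                  ∎
  where
  open ≤-Reasoning
  expand : ∀ i s → suc i * suc i * s ≡ i * i * s + (1 + 2 * i) * s
  expand = solve-∀
  collect : ∀ K Q a v → K * Q * a + K * v * Q ≡ K * Q * (a + v)
  collect = solve-∀
  i²≤ : i * i ≤ 320 * K * (v * v)
  i²≤ = *-cancelʳ-≤ (i * i) _ s {{>-nonZero 0<s}} (begin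
    i * i * s                       ≤⟨ good ⟩
    K * Q * a                       ≤⟨ *-mono-≤ (*-monoʳ-≤ K Q≤2s) a≤ ⟩
    K * (2 * s) * (160 * (v * v))   ≡⟨ regroup K s 160 (v * v) ⟩
    320 * K * (v * v) * s           ∎)
    where
    regroup : ∀ K s c w → K * (2 * s) * (c * w) ≡ 2 * c * K * w * s
    regroup = solve-∀
  -- It suffices that `3 i ≤ K v`, and `(3 i)² ≤ 9 · 320 K v² ≤ (K v)²`. This is the condition that
  -- fixes the size of `K`.
  growth : 1 + 2 * i ≤ K * v
  growth = ≤-trans (+-monoˡ-≤ (2 * i) 1≤i) (≮⇒≥ λ lt → <⇒≱ (*-mono-< lt lt) (begin
    (i + 2 * i) * (i + 2 * i)   ≡⟨ nine i ⟩
    9 * (i * i)                 ≤⟨ *-monoʳ-≤ 9 i²≤ ⟩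
    9 * (320 * K * (v * v))     ≡⟨ *-assoc 9 (320 * K) (v * v) ⟨
    9 * (320 * K) * (v * v)     ≤⟨ *-monoˡ-≤ (v * v) K-large ⟩
    K * K * (v * v)             ≡⟨ square K v ⟩
    K * v * (K * v)             ∎))
    where
    nine : ∀ i → (i + 2 * i) * (i + 2 * i) ≡ 9 * (i * i)
    nine = solve-∀
    square : ∀ k v → k * k * (v * v) ≡ k * v * (k * v)
    square = solve-∀

InClass : ℕ → Pred (Subset N) 0ℓ
InClass ℓ S = 2 ^ ℓ ≤ ∣ S ∣ × ∣ S ∣ ≤ 2 ^ suc ℓ ∸ 1

inClass? : ∀ ℓ → Decidable (InClass {N} ℓ)
inClass? ℓ S = (2 ^ ℓ ≤? ∣ S ∣) ×-dec (∣ S ∣ ≤? 2 ^ suc ℓ ∸ 1)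

∣sizeClass∣ : ∀ (Ss : List (Subset N)) ℓ → ∣ sizeClass Ss ℓ ∣ ≡ sum (map (indicator ∘ inClass? ℓ) Ss)
∣sizeClass∣ []       ℓ = refl
∣sizeClass∣ (S ∷ Ss) ℓ = trans (head (inClass? ℓ S) (sizeClass Ss ℓ))
  (cong (indicator (inClass? ℓ S) +_) (∣sizeClass∣ Ss ℓ))
  where
  head : ∀ {P : Set} {n} (d : Dec P) (T : Subset n) → ∣ does d ∷ T ∣ ≡ indicator d + ∣ T ∣
  head (yes _) T = refl
  head (no _)  T = refl

∈-sizeClass⁻ : ∀ (Ss : List (Subset N)) ℓ a → a ∈ sizeClass Ss ℓ → InClass ℓ (lookup Ss a)
∈-sizeClass⁻ Ss ℓ a a∈ = from-does (inClass? ℓ (lookup Ss a))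
  (trans (sym (lookup∘tabulate (λ i → does (inClass? ℓ (lookup Ss i))) a)) ([]=⇒lookup a∈))
  where
  from-does : ∀ {P : Set} (d : Dec P) → does d ≡ true → P
  from-does (yes p) _ = p

∃-last : ∀ {k} (T : Subset k) → ∣ T ∣ ≡ 0 ⊎ ∃[ a ] IsLast T a
∃-last [] = inj₁ refl
∃-last (b ∷ T) with ∃-last T
∃-last (b ∷ T)       | inj₂ (a , a∈ , last) = inj₂ (suc a , there a∈ , λ { zero _ → z≤n ; (suc j) (there j∈) → s≤s (last j j∈) })
∃-last (outside ∷ T) | inj₁ ∣T∣≡0 = inj₁ ∣T∣≡0
∃-last (inside ∷ T)  | inj₁ ∣T∣≡0 = inj₂ (zero , here , λ { zero _ → z≤n ; (suc j) (there j∈) → contradiction (∣T∣≡0⇒ j∈) (λ ()) })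
  where
  ∣T∣≡0⇒ : ∀ {j} → j ∈ T → 1 ≤ 0
  ∣T∣≡0⇒ {j} j∈ = subst (1 ≤_) ∣T∣≡0 (member T j∈)
    where
    member : ∀ {n} (T : Subset n) {j} → j ∈ T → 1 ≤ ∣ T ∣
    member (inside ∷ T)  here       = s≤s z≤n
    member (inside ∷ T)  (there j∈) = s≤s z≤n
    member (outside ∷ T) (there j∈) = member T j∈

class-≤ : ∀ ℓ {S : Subset N} → InClass ℓ S → ∣ S ∣ ≤ 2 * 2 ^ ℓ
class-≤ ℓ (_ , hi) = ≤-trans hi (m∸n≤m (2 ^ suc ℓ) 1)

module _ (K : ℕ) (0<K : 0 < K) (K-large : 9 * (320 * K) ≤ K * K) (M : Matroid N) (ℓ : ℕ) where

  -- The rate `α / |S|` is at least `i² / (K Q)`, where `Q = 2 · 2^ℓ` bounds the sizes in the class;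
  -- `i` will be the position of `S` within its class.
  Potential : ℕ → Pred (Subset N) 0ℓ
  Potential i S = i * i * ∣ S ∣ ≤ K * (2 * 2 ^ ℓ) * α M S

  potential-separated : ∀ i {S S′} → 1 ≤ i → InClass ℓ S → InClass ℓ S′ → Sparse M S →
    Separated M S S′ → Potential i S → Potential (suc i) S′
  potential-separated i {S} {S′} 1≤i S∈ S′∈ sparse separated pot =
    by-window (sqrt-window 40 (α M S) (s≤s z≤n) (α-positive M S 0<s))
    where
    open ≤-Reasoning
    Q s s′ : ℕ
    Q = 2 * 2 ^ ℓ
    s = ∣ S ∣
    s′ = ∣ S′ ∣
    0<s : 0 < s
    0<s = ≤-trans (s≤s z≤n) (proj₁ sparse)
    s≤2s′ : s ≤ 2 * s′
    s≤2s′ = ≤-trans (class-≤ ℓ {S} S∈) (*-monoʳ-≤ 2 (proj₁ S′∈))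
    s′≤2s : s′ ≤ 2 * s
    s′≤2s = ≤-trans (class-≤ ℓ {S′} S′∈) (*-monoʳ-≤ 2 (proj₁ S∈))
    permuteˡ : ∀ a b c → a * (b * c) ≡ b * a * c
    permuteˡ = solve-∀
    permuteʳ : ∀ a b c → a * (b * c) ≡ b * (a * c)
    permuteʳ = solve-∀
    advance : ∀ a a′ v → i * i * s ≤ K * Q * a → a ≤ 160 * (v * v) → (a + v) * s′ ≤ s * a′ →
      suc i * suc i * s′ ≤ K * Q * a′
    advance a a′ v pot a≤ gap = *-cancelˡ-≤ s {{>-nonZero 0<s}} (begin
      s * (suc i * suc i * s′)     ≡⟨ permuteˡ s (suc i * suc i) s′ ⟩
      suc i * suc i * s * s′       ≤⟨ *-monoˡ-≤ s′ (potential-step K Q a s i v K-large (class-≤ ℓ {S} S∈)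
                                         (*-monoʳ-≤ 2 (proj₁ S∈)) 0<s 1≤i a≤ pot) ⟩
      K * Q * (a + v) * s′         ≡⟨ *-assoc (K * Q) (a + v) s′ ⟩
      K * Q * ((a + v) * s′)       ≤⟨ *-monoʳ-≤ (K * Q) gap ⟩
      K * Q * (s * a′)             ≡⟨ permuteʳ (K * Q) s a′ ⟩
      s * (K * Q * a′)             ∎)
    by-window : (∃[ v ] 1 ≤ v × (v ≡ 1 ⊎ 40 * (v * v) ≤ α M S) × α M S ≤ 160 * (v * v)) → Potential (suc i) S′
    by-window (v , 1≤v , v-or , α≤) = advance (α M S) (α M S′) v pot α≤ (separated v 1≤v v-or α≤ s≤2s′ s′≤2s)

  -- Once `i` members of the class have been passed, all remaining members have potential `suc i`.
  -- Passing one more raises this for every later member at once, since separation holds for all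
  -- pairs.
  last-potential : ∀ i Ss → All (Sparse M) Ss → AllPairs (Separated M) Ss →
    All (λ S → InClass ℓ S → Potential (suc i) S) Ss →
    ∀ a → IsLast (sizeClass Ss ℓ) a → Potential (i + ∣ sizeClass Ss ℓ ∣) (lookup Ss a)
  last-potential i (S ∷ Ss) (sparse ∷ sparses) (seps ∷ pairs) (pot ∷ pots) = by-head (inClass? ℓ S)
    where
    T : Subset (length Ss)
    T = sizeClass Ss ℓ
    by-head : (d : Dec (InClass ℓ S)) → ∀ a → IsLast (does d ∷ T) a →
      Potential (i + ∣ does d ∷ T ∣) (lookup (S ∷ Ss) a)
    by-head (no _)   (suc a) (there a∈ , last) =
      last-potential i Ss sparses pairs pots a (a∈ , λ j j∈ → s≤s⁻¹ (last (suc j) (there j∈)))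
    by-head (yes S∈) (suc a) (there a∈ , last) = subst (λ k → Potential k (lookup Ss a)) (sym (+-suc i ∣ T ∣))
      (last-potential (suc i) Ss sparses pairs
        (All.map (λ {S′} sep S′∈ → potential-separated (suc i) {S} {S′} (s≤s z≤n) S∈ S′∈ sparse sep (pot S∈)) seps)
        a (a∈ , λ j j∈ → s≤s⁻¹ (last (suc j) (there j∈))))
    by-head (yes S∈) zero (_ , last) = subst (λ k → Potential k S)
      (trans (+-comm 1 i) (cong (λ n → i + suc n) (sym ∣T∣≡0))) (pot S∈)
      where
      ∣T∣≡0 : ∣ T ∣ ≡ 0
      ∣T∣≡0 = trans (cong ∣_∣ (Empty-unique {p = T} (λ (j , j∈) → case last (suc j) (there j∈) of λ ()))) (∣⊥∣≡0 (length Ss))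

  class-bound : ∀ Ss → All (Sparse M) Ss → AllPairs (Separated M) Ss →
    ∀ a → IsLast (sizeClass Ss ℓ) a → ∣ sizeClass Ss ℓ ∣ ^ 2 ≤ K * 2 * α M (lookup Ss a)
  class-bound Ss sparses pairs a last = *-cancelʳ-≤ (γ ^ 2) _ s {{>-nonZero 0<s}} (begin
    γ ^ 2 * s                       ≡⟨ cong (λ x → γ * x * s) (*-identityʳ γ) ⟩
    γ * γ * s                       ≤⟨ last-potential 0 Ss sparses pairs initial a last ⟩
    -- The lower end of the size class, `2 ^ ℓ ≤ s`, turns the bound on the rate back into a bound
    -- on `α`.
    K * (2 * 2 ^ ℓ) * α M S         ≤⟨ *-monoˡ-≤ (α M S) (*-monoʳ-≤ K (*-monoʳ-≤ 2 (proj₁ S∈))) ⟩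
    K * (2 * s) * α M S             ≡⟨ permute K s (α M S) ⟩
    K * 2 * α M S * s               ∎)
    where
    open ≤-Reasoning
    S : Subset N
    S = lookup Ss a
    γ s : ℕ
    γ = ∣ sizeClass Ss ℓ ∣
    s = ∣ S ∣
    S∈ : InClass ℓ S
    S∈ = ∈-sizeClass⁻ Ss ℓ a (proj₁ last)
    0<s : 0 < s
    0<s = ≤-trans (m^n>0 2 ℓ) (proj₁ S∈)
    permute : ∀ k s a → k * (2 * s) * a ≡ k * 2 * a * s
    permute = solve-∀
    -- Potential 1 is free: `|S| ≤ 2 · 2^ℓ` and `α ≥ 1`.
    initial : All (λ S → InClass ℓ S → Potential 1 S) Ss
    initial = All.map (λ {S} sparse S∈ → ≤-trans (≤-reflexive (+-identityʳ ∣ S ∣))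
      (≤-trans (class-≤ ℓ {S} S∈) (≤-trans (m≤n*m′ (2 * 2 ^ ℓ) 0<K)
        (m≤m*n′ (K * (2 * 2 ^ ℓ)) (α-positive M S (≤-trans (s≤s z≤n) (proj₁ sparse))))))) sparses

  class-count : ∀ Ss → All (Sparse M) Ss → AllPairs (Separated M) Ss → ∣ sizeClass Ss ℓ ∣ ^ 2 ≤ K * 4 * 2 ^ ℓ
  class-count Ss sparses pairs = [ (λ γ≡0 → subst (λ γ → γ ^ 2 ≤ K * 4 * 2 ^ ℓ) (sym γ≡0) z≤n) , from-last ]′
    (∃-last (sizeClass Ss ℓ))
    where
    open ≤-Reasoning
    permute : ∀ k q → k * 2 * (2 * q) ≡ k * 4 * q
    permute = solve-∀
    from-last : (∃[ a ] IsLast (sizeClass Ss ℓ) a) → ∣ sizeClass Ss ℓ ∣ ^ 2 ≤ K * 4 * 2 ^ ℓ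
    from-last (a , last) = begin
      ∣ sizeClass Ss ℓ ∣ ^ 2      ≤⟨ class-bound Ss sparses pairs a last ⟩
      K * 2 * α M S               ≤⟨ *-monoʳ-≤ (K * 2) α≤2^ℓ ⟩
      K * 2 * (2 * 2 ^ ℓ)         ≡⟨ permute K (2 ^ ℓ) ⟩
      K * 4 * 2 ^ ℓ               ∎
      where
      S : Subset N
      S = lookup Ss a
      α≤2^ℓ : α M S ≤ 2 * 2 ^ ℓ
      α≤2^ℓ = ≤-trans (α≤∣_∣ M S) (class-≤ ℓ {S} (∈-sizeClass⁻ Ss ℓ a (proj₁ last)))

-- Counting all the peeled sets.

sum-map-≤ : {A : Set} (f g h : A → ℕ) → ∀ {xs} → All (λ x → f x ≤ g x + h x) xs →
  sum (map f xs) ≤ sum (map g xs) + sum (map h xs)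
sum-map-≤ f g h []         = z≤n
sum-map-≤ f g h {x ∷ xs} (le ∷ les) = ≤-trans (+-mono-≤ le (sum-map-≤ f g h les))
  (≤-reflexive (permute (g x) (h x) (sum (map g xs)) (sum (map h xs))))
  where
  permute : ∀ a b c d → a + b + (c + d) ≡ a + c + (b + d)
  permute = solve-∀

smaller larger : ℕ → List (Subset N) → ℕ
smaller Λ Ss = sum (map (λ S → indicator (∣ S ∣ <? 2 ^ Λ)) Ss)
larger Λ Ss = sum (map (λ S → indicator (2 ^ Λ ≤? ∣ S ∣)) Ss)

smaller-suc : ∀ Λ (Ss : List (Subset N)) → smaller (suc Λ) Ss ≤ smaller Λ Ss + ∣ sizeClass Ss Λ ∣
smaller-suc Λ Ss = subst (λ k → smaller (suc Λ) Ss ≤ smaller Λ Ss + k) (sym (∣sizeClass∣ Ss Λ))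
  (sum-map-≤ _ _ (indicator ∘ inClass? Λ) (All.universal (λ S → pointwise S (∣ S ∣ <? 2 ^ Λ)) Ss))
  where
  pointwise : ∀ S (d : Dec (∣ S ∣ < 2 ^ Λ)) → indicator (∣ S ∣ <? 2 ^ suc Λ) ≤ indicator d + indicator (inClass? Λ S)
  pointwise S (yes _)  = ≤-trans (indicator-mono (∣ S ∣ <? 2 ^ suc Λ) (yes tt) (λ _ → tt)) (s≤s z≤n)
  pointwise S (no ≮)   = indicator-mono (∣ S ∣ <? 2 ^ suc Λ) (inClass? Λ S) (λ lt → ≮⇒≥ ≮ , ∸-monoˡ-≤ 1 lt)

smaller-zero : ∀ {Ss : List (Subset N)} → All (λ S → 1 ≤ ∣ S ∣) Ss → smaller 0 Ss ≡ 0
smaller-zero []                 = refl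
smaller-zero {Ss = S ∷ Ss} (1≤S ∷ 1≤Ss) = cong₂ _+_ (indicator-no (∣ S ∣ <? 1) (≤⇒≯ 1≤S)) (smaller-zero 1≤Ss)

length≤smaller+larger : ∀ Λ (Ss : List (Subset N)) → length Ss ≤ smaller Λ Ss + larger Λ Ss
length≤smaller+larger Λ Ss = subst (_≤ smaller Λ Ss + larger Λ Ss) (sym (length-sum Ss))
  (sum-map-≤ (λ _ → 1) _ _ (All.universal (λ S → pointwise S (∣ S ∣ <? 2 ^ Λ)) Ss))
  where
  pointwise : ∀ S (d : Dec (∣ S ∣ < 2 ^ Λ)) → 1 ≤ indicator d + indicator (2 ^ Λ ≤? ∣ S ∣)
  pointwise S (yes _) = s≤s z≤n
  pointwise S (no ≮)  = ≤-reflexive (sym (indicator-yes (2 ^ Λ ≤? ∣ S ∣) (≮⇒≥ ≮)))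

larger-* : ∀ Λ (Ss : List (Subset N)) → larger Λ Ss * 2 ^ Λ ≤ sum (map ∣_∣ Ss)
larger-* Λ []       = z≤n
larger-* Λ (S ∷ Ss) = ≤-trans (≤-reflexive (*-distribʳ-+ (2 ^ Λ) (indicator (2 ^ Λ ≤? ∣ S ∣)) (larger Λ Ss)))
  (+-mono-≤ (pointwise (2 ^ Λ ≤? ∣ S ∣)) (larger-* Λ Ss))
  where
  pointwise : (d : Dec (2 ^ Λ ≤ ∣ S ∣)) → indicator d * 2 ^ Λ ≤ ∣ S ∣
  pointwise (yes le) = ≤-trans (≤-reflexive (*-identityˡ _)) le
  pointwise (no _)   = z≤n

length≤sum : ∀ {Ss : List (Subset N)} → All (λ S → 1 ≤ ∣ S ∣) Ss → length Ss ≤ sum (map ∣_∣ Ss)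
length≤sum []            = z≤n
length≤sum (1≤S ∷ 1≤Ss)  = +-mono-≤ 1≤S (length≤sum 1≤Ss)

2xy≤x²+y² : ∀ x y → 2 * (x * y) ≤ x * x + y * y
2xy≤x²+y² x y = [ ordered x y , (λ y≤x → subst₂ _≤_ (cong (2 *_) (*-comm y x)) (+-comm (y * y) (x * x)) (ordered y x y≤x)) ]′
  (≤-total x y)
  where
  ordered : ∀ x y → x ≤ y → 2 * (x * y) ≤ x * x + y * y
  ordered x y x≤y = subst (λ y → 2 * (x * y) ≤ x * x + y * y) (m+[n∸m]≡n x≤y)
    (≤-trans (m≤m+n _ ((y ∸ x) * (y ∸ x))) (≤-reflexive (eq x (y ∸ x))))
    where
    eq : ∀ x r → 2 * (x * (x + r)) + r * r ≡ x * x + (x + r) * (x + r)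
    eq = solve-∀

-- From `2 (x + y)² ≤ 3 x² + 6 y²`, where `6 c ≤ d` absorbs the second term. Doubling `t` at each
-- step replaces the summation of a geometric series in `√2`.
square-sum : ∀ x y d c t → 6 * c ≤ d → x * x ≤ d * t → y * y ≤ c * t → (x + y) * (x + y) ≤ d * (2 * t)
square-sum x y d c t 6c≤d x²≤ y²≤ = *-cancelˡ-≤ 2 (begin
  2 * ((x + y) * (x + y))        ≤⟨ cross ⟩
  3 * (x * x) + 6 * (y * y)      ≤⟨ +-mono-≤ (*-monoʳ-≤ 3 x²≤) (*-monoʳ-≤ 6 y²≤) ⟩
  3 * (d * t) + 6 * (c * t)      ≡⟨ cong (3 * (d * t) +_) (sym (*-assoc 6 c t)) ⟩
  3 * (d * t) + 6 * c * t        ≤⟨ +-monoʳ-≤ (3 * (d * t)) (*-monoˡ-≤ t 6c≤d) ⟩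
  3 * (d * t) + d * t            ≡⟨ collect d t ⟩
  2 * (d * (2 * t))              ∎)
  where
  open ≤-Reasoning
  collect : ∀ d t → 3 * (d * t) + d * t ≡ 2 * (d * (2 * t))
  collect = solve-∀
  cross : 2 * ((x + y) * (x + y)) ≤ 3 * (x * x) + 6 * (y * y)
  cross = begin
    2 * ((x + y) * (x + y))                            ≡⟨ expand x y ⟩
    2 * (x * x) + 2 * (y * y) + 2 * (x * (2 * y))      ≤⟨ +-monoʳ-≤ (2 * (x * x) + 2 * (y * y)) (2xy≤x²+y² x (2 * y)) ⟩
    2 * (x * x) + 2 * (y * y) + (x * x + 2 * y * (2 * y)) ≡⟨ gather x y ⟩
    3 * (x * x) + 6 * (y * y)                          ∎
    where
    expand : ∀ x y → 2 * ((x + y) * (x + y)) ≡ 2 * (x * x) + 2 * (y * y) + 2 * (x * (2 * y))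
    expand = solve-∀
    gather : ∀ x y → 2 * (x * x) + 2 * (y * y) + (x * x + 2 * y * (2 * y)) ≡ 3 * (x * x) + 6 * (y * y)
    gather = solve-∀

smaller-square : ∀ c d → 6 * c ≤ d → ∀ (Ss : List (Subset N)) → All (λ S → 1 ≤ ∣ S ∣) Ss →
  (∀ ℓ → ∣ sizeClass Ss ℓ ∣ ^ 2 ≤ c * 2 ^ ℓ) → ∀ Λ → smaller Λ Ss * smaller Λ Ss ≤ d * 2 ^ Λ
smaller-square c d 6c≤d Ss 1≤Ss count zero = subst (λ x → x * x ≤ d * 1) (sym (smaller-zero 1≤Ss)) z≤n
smaller-square c d 6c≤d Ss 1≤Ss count (suc Λ) = ≤-trans (*-mono-≤ (smaller-suc Λ Ss) (smaller-suc Λ Ss))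
  (square-sum (smaller Λ Ss) γ d c (2 ^ Λ) 6c≤d (smaller-square c d 6c≤d Ss 1≤Ss count Λ)
    (subst (λ x → γ * x ≤ c * 2 ^ Λ) (*-identityʳ γ) (count Λ)))
  where
  γ : ℕ
  γ = ∣ sizeClass Ss Λ ∣

square-cancel : ∀ x y → x * x ≤ y * y → x ≤ y
square-cancel x y le = ≮⇒≥ λ y<x → <⇒≱ (*-mono-< y<x y<x) le

-- Here `t` is `n^(2/3)` up to a constant, so that `c √t` and `n / t` are both of order `n^(1/3)`.
-- The first is compared through sixth powers, the second through cubes, and the sum is at most
-- twice the larger.
cube-sum : ∀ x y c t n → 2 ≤ c → 0 < n → x * x ≤ c * c * t → y * t ≤ n →
  t * t * t ≤ n * n → n * n ≤ 8 * (t * t * t) → (x + y) ^ 3 ≤ (2 * c) ^ 3 * n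
cube-sum x y c t n 2≤c 0<n x²≤ yt≤n t³≤n² n²≤8t³ = [ (λ x≤y → doubled y (+-monoˡ-≤ y x≤y) y³≤) , (λ y≤x → doubled x (+-monoʳ-≤ x y≤x) x³≤) ]′ (≤-total x y)
  where
  open ≤-Reasoning
  x³≤ : x * x * x ≤ c * c * c * n
  x³≤ = square-cancel _ _ (begin
    x * x * x * (x * x * x)                      ≡⟨ sixth x ⟩
    x * x * (x * x) * (x * x)                    ≤⟨ *-mono-≤ (*-mono-≤ x²≤ x²≤) x²≤ ⟩
    c * c * t * (c * c * t) * (c * c * t)        ≡⟨ gather c t ⟩
    c * c * c * (c * c * c) * (t * t * t)        ≤⟨ *-monoʳ-≤ (c * c * c * (c * c * c)) t³≤n² ⟩
    c * c * c * (c * c * c) * (n * n)            ≡⟨ square (c * c * c) n ⟩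
    c * c * c * n * (c * c * c * n)              ∎)
    where
    sixth : ∀ x → x * x * x * (x * x * x) ≡ x * x * (x * x) * (x * x)
    sixth = solve-∀
    gather : ∀ c t → c * c * t * (c * c * t) * (c * c * t) ≡ c * c * c * (c * c * c) * (t * t * t)
    gather = solve-∀
    square : ∀ k n → k * k * (n * n) ≡ k * n * (k * n)
    square = solve-∀
  y³≤ : y * y * y ≤ c * c * c * n
  y³≤ = ≤-trans (*-cancelʳ-≤ (y * y * y) (8 * n) (n * n) {{>-nonZero (*-mono-≤ 0<n 0<n)}} (begin
    y * y * y * (n * n)                ≤⟨ *-monoʳ-≤ (y * y * y) n²≤8t³ ⟩
    y * y * y * (8 * (t * t * t))      ≡⟨ gather y t ⟩
    8 * (y * t * (y * t) * (y * t))    ≤⟨ *-monoʳ-≤ 8 (*-mono-≤ (*-mono-≤ yt≤n yt≤n) yt≤n) ⟩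
    8 * (n * n * n)                    ≡⟨ permute n ⟩
    8 * n * (n * n)                    ∎)) (*-monoˡ-≤ n (*-mono-≤ (*-mono-≤ 2≤c 2≤c) 2≤c))
    where
    gather : ∀ y t → y * y * y * (8 * (t * t * t)) ≡ 8 * (y * t * (y * t) * (y * t))
    gather = solve-∀
    permute : ∀ n → 8 * (n * n * n) ≡ 8 * n * (n * n)
    permute = solve-∀
  doubled : ∀ z → x + y ≤ z + z → z * z * z ≤ c * c * c * n → (x + y) ^ 3 ≤ (2 * c) ^ 3 * n
  doubled z le z³≤ = begin
    (x + y) ^ 3              ≤⟨ ^-monoˡ-≤ 3 le ⟩
    (z + z) ^ 3              ≡⟨ cube z ⟩
    8 * (z * z * z)          ≤⟨ *-monoʳ-≤ 8 z³≤ ⟩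
    8 * (c * c * c * n)      ≡⟨ cube′ c n ⟩
    (2 * c) ^ 3 * n          ∎
    where
    cube : ∀ z → (z + z) * ((z + z) * ((z + z) * 1)) ≡ 8 * (z * z * z)
    cube = solve-∀
    cube′ : ∀ c n → 8 * (c * c * c * n) ≡ 2 * c * (2 * c * (2 * c * 1)) * n
    cube′ = solve-∀

n<2^n : ∀ n → n < 2 ^ n
n<2^n zero    = s≤s z≤n
n<2^n (suc n) = ≤-trans (s≤s (n<2^n n)) (≤-trans (+-monoˡ-≤ (2 ^ n) (m^n>0 2 n)) (≤-reflexive (cong (2 ^ n +_) (sym (+-identityʳ _)))))

length-bound : ∀ b c → 2 ≤ c → 6 * b ≤ c * c → ∀ n (Ss : List (Subset N)) → All (λ S → 1 ≤ ∣ S ∣) Ss →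
  sum (map ∣_∣ Ss) ≤ n → (∀ ℓ → ∣ sizeClass Ss ℓ ∣ ^ 2 ≤ b * 2 ^ ℓ) → length Ss ^ 3 ≤ (2 * c) ^ 3 * n
length-bound b c 2≤c 6b≤c² zero Ss 1≤Ss total count =
  ≤-trans (≤-reflexive (cong (_^ 3) (n≤0⇒n≡0 (≤-trans (length≤sum 1≤Ss) total)))) z≤n
length-bound b c 2≤c 6b≤c² n@(suc _) Ss 1≤Ss total count =
  -- The scale `2 ^ Λ` is the largest power of 2 whose cube is at most `n²`.
  at-scale (bracket cube (n * n) (s≤s z≤n) n²<cube)
  where
  open ≤-Reasoning
  cube : ℕ → ℕ
  cube Λ = 2 ^ Λ * 2 ^ Λ * 2 ^ Λ
  n²<cube : n * n < cube (suc (n * n))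
  n²<cube = ≤-trans (n<2^n (n * n)) (≤-trans (^-monoʳ-≤ 2 (n≤1+n (n * n)))
    (m≤n*m (2 ^ suc (n * n)) (2 ^ suc (n * n) * 2 ^ suc (n * n)) {{>-nonZero (*-mono-≤ (m^n>0 2 (suc (n * n))) (m^n>0 2 (suc (n * n))))}}))
  eightfold : ∀ t → 2 * t * (2 * t) * (2 * t) ≡ 8 * (t * t * t)
  eightfold = solve-∀
  at-scale : (∃[ Λ ] cube Λ ≤ n * n × n * n < cube (suc Λ)) → length Ss ^ 3 ≤ (2 * c) ^ 3 * n
  at-scale (Λ , lo , hi) = ≤-trans (^-monoˡ-≤ 3 (length≤smaller+larger Λ Ss))
    (cube-sum (smaller Λ Ss) (larger Λ Ss) c (2 ^ Λ) n 2≤c (s≤s z≤n)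
      (smaller-square b (c * c) 6b≤c² Ss 1≤Ss count Λ) (≤-trans (larger-* Λ Ss) total)
      lo (≤-trans (<⇒≤ hi) (≤-reflexive (eightfold (2 ^ Λ)))))

-- The constants stay variables tied by inequalities: `K` drives the potential, `4 K` is the
-- constant for a single class, `c₂` bounds its square root, and `c₃` bounds the square root of
-- `6 · 4 K` from `square-sum`.
peeling-bounds : ∀ K c₂ c₃ → 0 < K → 9 * (320 * K) ≤ K * K → K * 4 ≤ c₂ ^ 2 → 2 ≤ c₃ → 6 * (K * 4) ≤ c₃ * c₃ →
  ∀ (n₀ : ℕ) .{{_ : NonZero n₀}} → 2 ^ 10 ≤ n₀ → ∀ (N : ℕ) (M : Matroid N) →
  ∀ (_≺_ : Rel (Fin N) 0ℓ) (sto : IsStrictTotalOrder _≡_ _≺_)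
    (Ss : List (Subset N)) (run : IterativePeel _≺_ sto n₀ M Ss) →
  EstimatesAccurate {sto = sto} {M = M} run → ∀ ℓ →
  (∀ a → IsLast (sizeClass Ss ℓ) a → ∣ sizeClass Ss ℓ ∣ ^ 2 ≤ K * 2 * α M (lookup Ss a))
  × (∣ sizeClass Ss ℓ ∣ ^ 2 ≤ c₂ ^ 2 * 2 ^ ℓ)
  × (length Ss ^ 3 ≤ (2 * c₃) ^ 3 * ∣ E M ∣)
peeling-bounds K c₂ c₃ 0<K K-large c₂-large 2≤c₃ c₃-large n₀ n₀≥ N M _≺_ sto Ss run accurate ℓ =
  bounds (peeled _≺_ n₀ ∣ E M ∣ n₀≥ M M₀ (∖-restriction M M D (λ X _ → (λ i → i) , (λ i → i))) Ss run accurate)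
  where
  D : Subset N
  D = comprehension (StartsSmallDependent? _≺_ sto M)
  M₀ : Matroid N
  M₀ = M ∖ D
  bounds : All (λ S → _ × Sparse M S) Ss × AllPairs (Separated M) Ss × sum (map ∣_∣ Ss) ≤ ∣ E M₀ ∣ → _
  bounds (facts , pairs , total) =
    class-bound K 0<K K-large M ℓ Ss sparses pairs ,
    ≤-trans (class-count K 0<K K-large M ℓ Ss sparses pairs) (*-monoˡ-≤ (2 ^ ℓ) c₂-large) ,
    length-bound (K * 4) c₃ 2≤c₃ c₃-large ∣ E M ∣ Ss
      (All.map (λ sparse → ≤-trans (s≤s z≤n) (proj₁ sparse)) sparses)
      (≤-trans total (∣p─q∣≤∣p∣ (E M) D))
      (λ ℓ → class-count K 0<K K-large M ℓ Ss sparses pairs)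
    where
    sparses : All (Sparse M) Ss
    sparses = All.map proj₂ facts

theorem4p16 :
  ∃[ C₁ ] ∃[ C₂ ] ∃[ C₃ ] ∃[ N₀ ]
    (∀ (n₀ : ℕ) .{{_ : NonZero n₀}} → N₀ ≤ n₀ →
     ∀ (N : ℕ) (M : Matroid N) → let n = ∣ Matroid.E M ∣ in n ≤ n₀ →
     ∀ (_≺_ : Rel (Fin N) 0ℓ) (sto : IsStrictTotalOrder _≡_ _≺_)
       (Ss : List (Subset N)) (run : IterativePeel _≺_ sto n₀ M Ss) →
     EstimatesAccurate {sto = sto} {M = M} run →
     ∀ (ℓ : ℕ) → 1 ≤ ℓ → fromℕ ℓ ≤ 1ℚᵘ ·log₂ n →
     let k = length Ss
         T = sizeClass Ss ℓ
         γ = ∣ T ∣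
     in  (∀ a → IsLast T a → γ ^ 2 ≤ C₁ * α M (lookup Ss a))
       × (γ ^ 2 ≤ C₂ ^ 2 * 2 ^ ℓ)
       × (k ^ 3 ≤ C₃ ^ 3 * n))
-- 9 · 320 · 2880 = 2880², 4 · 2880 ≤ 108² and 24 · 2880 ≤ 263².
theorem4p16 = 2880 * 2 , 108 , 2 * 263 , 2 ^ 10 ,
  λ n₀ n₀≥ N M n≤n₀ _≺_ sto Ss run accurate ℓ 1≤ℓ ℓ≤log →
    peeling-bounds 2880 108 263 (s≤s z≤n) ≤-refl
      (toWitness {a? = 2880 * 4 ≤? 108 ^ 2} tt) (s≤s (s≤s z≤n)) (toWitness {a? = 6 * (2880 * 4) ≤? 263 * 263} tt)
      n₀ n₀≥ N M _≺_ sto Ss run accurate ℓ
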